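{- For every integer $d\geq 2$ there exist $\varepsilon=\varepsilon(d)>0$ and $\eta=\eta(d)>0$ such that every distance-regular graph $X$ of diameter $d$ and degree $k$ satisfies at least one of: (1) there is $0\le i\le d-1$ with $b_i\geq\varepsilon k$ and $c_{i+1}\geq\varepsilon k$; (2) the zero-weight spectral radius $\xi$ of $X$ satisfies $\xi\leq k(1-\eta)$. Moreover, one may take $\eta=\frac14 d^{ -(1+\log_2 d)}$ and $\varepsilon=200^{ -(d+1)}d^{ -(d+1)(\log_2 d+3)}$.
   Context: A connected graph $X$ of diameter $d$ is distance-regular if there are integers $a_i,b_i,c_i$ ($0\le i\le d$) such that for all vertices $v,w$ with $\mathrm{dist}(v,w)=i$, $w$ has exactly $c_i$ neighbours at distance $i-1$, $a_i$ at distance $i$, $b_i$ at distance $i+1$ from $v$; $X$ is $k$-regular with $k=b_0$. For a $k$-regular graph with adjacency eigenvalues $k=\xi_1\ge\dots\ge\xi_n$, the zero-weight spectral radius is $\xi=\max\{|\xi_i|:2\le i\le n\}$. -}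

module Defs where

open import Data.Bool using (Bool; false; T; if_then_else_)
open import Data.Empty using (⊥-elim)
open import Data.Fin using (Fin; zero; suc; toℕ; inject₁)
import Data.Fin as Fin
open import Data.Fin.Subset using (Subset; _∈_) renaming (∣_∣ to card)
open import Data.Integer using (ℤ; +_; -[1+_])
import Data.Integer as ℤ
import Data.Integer.Properties as ℤP
import Data.Integer.Solver as ℤSolver
open import Data.Nat using (ℕ; zero; suc)
import Data.Nat as ℕ
import Data.Nat.Properties as ℕP
import Data.Nat.Solver as ℕSolver
open import Data.Product using (∃-syntax; _×_; _,_; proj₁; proj₂)
open import Data.Rational using (ℚ; 0ℚ; 1ℚ; ½; ↥_; ↧ₙ_; _/_)
import Data.Rational as ℚ
import Data.Rational.Properties as ℚP
import Data.Rational.Solver as ℚSolver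
import Data.Rational.Unnormalised as ℚᵘ
import Data.Rational.Unnormalised.Properties as ℚᵘP
open import Data.Sum using (_⊎_; inj₁; inj₂)
open import Data.Vec.Functional using (Vector; foldr)
open import Function.Bundles using (_⇔_)
open import Relation.Binary.PropositionalEquality
  using (_≡_; refl; sym; trans; cong; cong₂; subst; subst₂)
open import Relation.Nullary using (¬_; yes; no)
open import Relation.Unary using (Decidable)

Cauchy : (ℕ → ℚ) → Set
Cauchy x = ∀ ε → 0ℚ ℚ.< ε →
  ∃[ N ] (∀ m n → N ℕ.≤ m → N ℕ.≤ n → ℚ.∣ x m ℚ.- x n ∣ ℚ.≤ ε)

record ℝ : Set where
  constructor mkℝ
  field
    seq    : ℕ → ℚ
    cauchy : Cauchy seq

open ℝ public

infix  4 _≤_ _<_ _≈_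
infixl 6 _+_ _-_
infixl 7 _*_
infix  8 -_

record _≤_ (x y : ℝ) : Set where
  constructor mk≤
  field
    eventually-≤ : ∀ ε → 0ℚ ℚ.< ε → ∃[ N ] (∀ n → N ℕ.≤ n → seq x n ℚ.≤ seq y n ℚ.+ ε)

record _<_ (x y : ℝ) : Set where
  constructor mk<
  field
    eventually-< : ∃[ δ ] 0ℚ ℚ.< δ × ∃[ N ] (∀ n → N ℕ.≤ n → seq x n ℚ.+ δ ℚ.≤ seq y n)

open _≤_ public
open _<_ public

_≈_ : ℝ → ℝ → Set
x ≈ y = x ≤ y × y ≤ x

p-q≤r : ∀ p q {r} → p ℚ.≤ q ℚ.+ r → p ℚ.- q ℚ.≤ r
p-q≤r p q {r} h = subst (p ℚ.- q ℚ.≤_)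
  (solve 2 (λ q r → (q :+ r) :- q := r) refl q r) (ℚP.+-monoˡ-≤ (ℚ.- q) h)
  where open ℚSolver.+-*-Solver

p≤q+r : ∀ p q {r} → p ℚ.- q ℚ.≤ r → p ℚ.≤ q ℚ.+ r
p≤q+r p q {r} h = subst (ℚ._≤ q ℚ.+ r)
  (solve 2 (λ p q → q :+ (p :- q) := p) refl p q) (ℚP.+-monoʳ-≤ q h)
  where open ℚSolver.+-*-Solver

-[p-q]≡q-p : ∀ p q → ℚ.- (p ℚ.- q) ≡ q ℚ.- p
-[p-q]≡q-p = solve 2 (λ p q → :- (p :- q) := q :- p) refl
  where open ℚSolver.+-*-Solver

p≤∣p∣ : ∀ p → p ℚ.≤ ℚ.∣ p ∣
p≤∣p∣ p with ℚP.≤-total 0ℚ p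
... | inj₁ 0≤p = ℚP.≤-reflexive (sym (ℚP.0≤p⇒∣p∣≡p 0≤p))
... | inj₂ p≤0 = ℚP.≤-trans p≤0 (ℚP.0≤∣p∣ p)

abs-≤ : ∀ p {r} → p ℚ.≤ r → ℚ.- p ℚ.≤ r → ℚ.∣ p ∣ ℚ.≤ r
abs-≤ p {r} h₁ h₂ with ℚP.∣p∣≡p∨∣p∣≡-p p
... | inj₁ eq = subst (ℚ._≤ r) (sym eq) h₁
... | inj₂ eq = subst (ℚ._≤ r) (sym eq) h₂

∣p-q∣≤r : ∀ p q {r} → p ℚ.≤ q ℚ.+ r → q ℚ.≤ p ℚ.+ r → ℚ.∣ p ℚ.- q ∣ ℚ.≤ r
∣p-q∣≤r p q {r} h₁ h₂ = abs-≤ (p ℚ.- q) (p-q≤r p q h₁)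
  (subst (ℚ._≤ r) (sym (-[p-q]≡q-p p q)) (p-q≤r q p h₂))

∣p-q∣≤r⇒p≤q+r : ∀ p q {r} → ℚ.∣ p ℚ.- q ∣ ℚ.≤ r → p ℚ.≤ q ℚ.+ r
∣p-q∣≤r⇒p≤q+r p q h = p≤q+r p q (ℚP.≤-trans (p≤∣p∣ (p ℚ.- q)) h)

½-pos : ∀ {ε} → 0ℚ ℚ.< ε → 0ℚ ℚ.< ½ ℚ.* ε
½-pos {ε} h = subst (ℚ._< ½ ℚ.* ε) (ℚP.*-zeroʳ ½) (ℚP.*-monoʳ-<-pos ½ h)

½+½ : ∀ ε → ½ ℚ.* ε ℚ.+ ½ ℚ.* ε ≡ ε
½+½ ε = trans (sym (ℚP.*-distribʳ-+ ε ½ ½)) (ℚP.*-identityˡ ε)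

1/pos : ∀ {C} → 0ℚ ℚ.< C → ∃[ C⁻¹ ] 0ℚ ℚ.< C⁻¹ × (C ℚ.* C⁻¹ ≡ 1ℚ)
1/pos {C} 0<C = (ℚ.1/ C) , ℚP.positive⁻¹ _ {{ℚP.1/pos⇒pos C}} , ℚP.*-inverseʳ C
  where
  instance
    C⁺ : ℚ.Positive C
    C⁺ = ℚ.positive 0<C
    C≢0 : ℚ.NonZero C
    C≢0 = ℚP.pos⇒nonZero C

*-pos : ∀ {p q} → 0ℚ ℚ.< p → 0ℚ ℚ.< q → 0ℚ ℚ.< p ℚ.* q
*-pos {p} {q} 0<p 0<q =
  ℚP.positive⁻¹ _ {{ℚP.pos*pos⇒pos p {{ℚ.positive 0<p}} q {{ℚ.positive 0<q}}}}

≤-*-mono : ∀ {p p′ q q′} → 0ℚ ℚ.≤ q → 0ℚ ℚ.≤ p′ → p ℚ.≤ p′ → q ℚ.≤ q′ →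
           p ℚ.* q ℚ.≤ p′ ℚ.* q′
≤-*-mono {p} {p′} {q} {q′} 0≤q 0≤p′ h h′ = ℚP.≤-trans
  (ℚP.*-monoʳ-≤-nonNeg q {{ℚ.nonNegative 0≤q}} h)
  (ℚP.*-monoˡ-≤-nonNeg p′ {{ℚ.nonNegative 0≤p′}} h′)

-- The Cauchy proofs are opaque to keep normal forms of reals small.

opaque
  const-cauchy : ∀ q → Cauchy (λ _ → q)
  const-cauchy q ε 0<ε = 0 , λ _ _ _ _ →
    subst (ℚ._≤ ε) (sym (cong ℚ.∣_∣ (ℚP.+-inverseʳ q))) (ℚP.<⇒≤ 0<ε)

fromℚ : ℚ → ℝ
fromℚ q = mkℝ (λ _ → q) (const-cauchy q)

fromℕ : ℕ → ℝ
fromℕ n = fromℚ (+ n / 1)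

0ℝ 1ℝ : ℝ
0ℝ = fromℚ 0ℚ
1ℝ = fromℚ 1ℚ

∣+-+∣≤ : ∀ xₘ xₙ yₘ yₙ {δ ε} → ℚ.∣ xₘ ℚ.- xₙ ∣ ℚ.≤ δ → ℚ.∣ yₘ ℚ.- yₙ ∣ ℚ.≤ ε →
  ℚ.∣ (xₘ ℚ.+ yₘ) ℚ.- (xₙ ℚ.+ yₙ) ∣ ℚ.≤ δ ℚ.+ ε
∣+-+∣≤ xₘ xₙ yₘ yₙ {δ} {ε} hx hy = begin
  ℚ.∣ (xₘ ℚ.+ yₘ) ℚ.- (xₙ ℚ.+ yₙ) ∣
    ≡⟨ cong ℚ.∣_∣ (rearrange xₘ xₙ yₘ yₙ) ⟨
  ℚ.∣ (xₘ ℚ.- xₙ) ℚ.+ (yₘ ℚ.- yₙ) ∣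
    ≤⟨ ℚP.∣p+q∣≤∣p∣+∣q∣ (xₘ ℚ.- xₙ) (yₘ ℚ.- yₙ) ⟩
  ℚ.∣ xₘ ℚ.- xₙ ∣ ℚ.+ ℚ.∣ yₘ ℚ.- yₙ ∣
    ≤⟨ ℚP.+-mono-≤ hx hy ⟩
  δ ℚ.+ ε ∎
  where
  open ℚP.≤-Reasoning
  rearrange : ∀ a b c d → (a ℚ.- b) ℚ.+ (c ℚ.- d) ≡ (a ℚ.+ c) ℚ.- (b ℚ.+ d)
  rearrange = solve 4 (λ a b c d → (a :- b) :+ (c :- d) := (a :+ c) :- (b :+ d)) refl
    where open ℚSolver.+-*-Solver

opaque
  +-cauchy : ∀ x y → Cauchy (λ n → seq x n ℚ.+ seq y n)
  +-cauchy x y ε 0<ε =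
    let Nx , hx = cauchy x (½ ℚ.* ε) (½-pos 0<ε)
        Ny , hy = cauchy y (½ ℚ.* ε) (½-pos 0<ε)
    in Nx ℕ.⊔ Ny , λ m n N≤m N≤n →
       subst (ℚ.∣ (seq x m ℚ.+ seq y m) ℚ.- (seq x n ℚ.+ seq y n) ∣ ℚ.≤_) (½+½ ε)
         (∣+-+∣≤ (seq x m) (seq x n) (seq y m) (seq y n)
           (hx m n (ℕP.m⊔n≤o⇒m≤o Nx Ny N≤m) (ℕP.m⊔n≤o⇒m≤o Nx Ny N≤n))
           (hy m n (ℕP.m⊔n≤o⇒n≤o Nx Ny N≤m) (ℕP.m⊔n≤o⇒n≤o Nx Ny N≤n)))

_+_ : ℝ → ℝ → ℝ
x + y = mkℝ (λ n → seq x n ℚ.+ seq y n) (+-cauchy x y)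

opaque
  neg-cauchy : ∀ x → Cauchy (λ n → ℚ.- seq x n)
  neg-cauchy x ε 0<ε =
    let N , h = cauchy x ε 0<ε
    in N , λ m n N≤m N≤n →
       subst (ℚ._≤ ε)
         (trans (sym (ℚP.∣-p∣≡∣p∣ (seq x m ℚ.- seq x n)))
                (cong ℚ.∣_∣ (ℚP.neg-distrib-+ (seq x m) (ℚ.- seq x n))))
         (h m n N≤m N≤n)

-_ : ℝ → ℝ
- x = mkℝ (λ n → ℚ.- seq x n) (neg-cauchy x)

_-_ : ℝ → ℝ → ℝ
x - y = x + (- y)

bounded : ∀ x → ∃[ B ] 0ℚ ℚ.< B × ∃[ N ] (∀ n → N ℕ.≤ n → ℚ.∣ seq x n ∣ ℚ.≤ B)
bounded x with cauchy x 1ℚ (ℚP.positive⁻¹ 1ℚ)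
... | N , h = ℚ.∣ seq x N ∣ ℚ.+ 1ℚ , 0<B , N , λ n N≤n → begin
    ℚ.∣ seq x n ∣
      ≡⟨ cong ℚ.∣_∣ (rearrange (seq x N) (seq x n)) ⟨
    ℚ.∣ seq x N ℚ.+ (seq x n ℚ.- seq x N) ∣
      ≤⟨ ℚP.∣p+q∣≤∣p∣+∣q∣ (seq x N) (seq x n ℚ.- seq x N) ⟩
    ℚ.∣ seq x N ∣ ℚ.+ ℚ.∣ seq x n ℚ.- seq x N ∣
      ≤⟨ ℚP.+-monoʳ-≤ ℚ.∣ seq x N ∣ (h n N N≤n ℕP.≤-refl) ⟩
    ℚ.∣ seq x N ∣ ℚ.+ 1ℚ ∎
  where
  open ℚP.≤-Reasoning
  0<B : 0ℚ ℚ.< ℚ.∣ seq x N ∣ ℚ.+ 1ℚ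
  0<B = ℚP.+-mono-≤-< {0ℚ} {ℚ.∣ seq x N ∣} {0ℚ} {1ℚ}
          (ℚP.0≤∣p∣ (seq x N)) (ℚP.positive⁻¹ 1ℚ)
  rearrange : ∀ a b → a ℚ.+ (b ℚ.- a) ≡ b
  rearrange = solve 2 (λ a b → a :+ (b :- a) := b) refl
    where open ℚSolver.+-*-Solver

∣*-*∣≤ : ∀ xₘ xₙ yₘ yₙ {Bx By δ ε} → 0ℚ ℚ.≤ Bx → 0ℚ ℚ.≤ By →
  ℚ.∣ xₘ ∣ ℚ.≤ Bx → ℚ.∣ yₙ ∣ ℚ.≤ By →
  ℚ.∣ yₘ ℚ.- yₙ ∣ ℚ.≤ δ → ℚ.∣ xₘ ℚ.- xₙ ∣ ℚ.≤ ε →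
  ℚ.∣ xₘ ℚ.* yₘ ℚ.- xₙ ℚ.* yₙ ∣ ℚ.≤ Bx ℚ.* δ ℚ.+ By ℚ.* ε
∣*-*∣≤ xₘ xₙ yₘ yₙ {Bx} {By} {δ} {ε} 0≤Bx 0≤By hx hy hδ hε = begin
  ℚ.∣ xₘ ℚ.* yₘ ℚ.- xₙ ℚ.* yₙ ∣
    ≡⟨ cong ℚ.∣_∣ (split xₘ xₙ yₘ yₙ) ⟨
  ℚ.∣ xₘ ℚ.* (yₘ ℚ.- yₙ) ℚ.+ yₙ ℚ.* (xₘ ℚ.- xₙ) ∣
    ≤⟨ ℚP.∣p+q∣≤∣p∣+∣q∣ (xₘ ℚ.* (yₘ ℚ.- yₙ)) (yₙ ℚ.* (xₘ ℚ.- xₙ)) ⟩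
  ℚ.∣ xₘ ℚ.* (yₘ ℚ.- yₙ) ∣ ℚ.+ ℚ.∣ yₙ ℚ.* (xₘ ℚ.- xₙ) ∣
    ≡⟨ cong₂ ℚ._+_ (ℚP.∣p*q∣≡∣p∣*∣q∣ xₘ (yₘ ℚ.- yₙ)) (ℚP.∣p*q∣≡∣p∣*∣q∣ yₙ (xₘ ℚ.- xₙ)) ⟩
  ℚ.∣ xₘ ∣ ℚ.* ℚ.∣ yₘ ℚ.- yₙ ∣ ℚ.+ ℚ.∣ yₙ ∣ ℚ.* ℚ.∣ xₘ ℚ.- xₙ ∣
    ≤⟨ ℚP.+-mono-≤ (≤-*-mono {ℚ.∣ xₘ ∣} {Bx} (ℚP.0≤∣p∣ (yₘ ℚ.- yₙ)) 0≤Bx hx hδ)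
                   (≤-*-mono {ℚ.∣ yₙ ∣} {By} (ℚP.0≤∣p∣ (xₘ ℚ.- xₙ)) 0≤By hy hε) ⟩
  Bx ℚ.* δ ℚ.+ By ℚ.* ε ∎
  where
  open ℚP.≤-Reasoning
  split : ∀ a b c d → a ℚ.* (c ℚ.- d) ℚ.+ d ℚ.* (a ℚ.- b) ≡ a ℚ.* c ℚ.- b ℚ.* d
  split = solve 4 (λ a b c d → a :* (c :- d) :+ d :* (a :- b) := a :* c :- b :* d) refl
    where open ℚSolver.+-*-Solver

cancel-1/ : ∀ B B⁻¹ e → B ℚ.* B⁻¹ ≡ 1ℚ → B ℚ.* (B⁻¹ ℚ.* e) ≡ e
cancel-1/ B B⁻¹ e eq = trans (sym (ℚP.*-assoc B B⁻¹ e))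
  (trans (cong (ℚ._* e) eq) (ℚP.*-identityˡ e))

opaque
  *-cauchy : ∀ x y → Cauchy (λ n → seq x n ℚ.* seq y n)
  *-cauchy x y ε 0<ε =
    let Bx , 0<Bx , Mx , bx = bounded x
        By , 0<By , My , by = bounded y
        Bx⁻¹ , 0<Bx⁻¹ , invx = 1/pos 0<Bx
        By⁻¹ , 0<By⁻¹ , invy = 1/pos 0<By
        Nx , hx = cauchy x (By⁻¹ ℚ.* (½ ℚ.* ε)) (*-pos 0<By⁻¹ (½-pos 0<ε))
        Ny , hy = cauchy y (Bx⁻¹ ℚ.* (½ ℚ.* ε)) (*-pos 0<Bx⁻¹ (½-pos 0<ε))
    in combine ε 0<Bx 0<By invx invy Mx My Nx Ny bx by hx hy
    where
    combine : ∀ ε {Bx By Bx⁻¹ By⁻¹} → 0ℚ ℚ.< Bx → 0ℚ ℚ.< By →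
      Bx ℚ.* Bx⁻¹ ≡ 1ℚ → By ℚ.* By⁻¹ ≡ 1ℚ → ∀ Mx My Nx Ny →
      (∀ n → Mx ℕ.≤ n → ℚ.∣ seq x n ∣ ℚ.≤ Bx) →
      (∀ n → My ℕ.≤ n → ℚ.∣ seq y n ∣ ℚ.≤ By) →
      (∀ m n → Nx ℕ.≤ m → Nx ℕ.≤ n →
        ℚ.∣ seq x m ℚ.- seq x n ∣ ℚ.≤ By⁻¹ ℚ.* (½ ℚ.* ε)) →
      (∀ m n → Ny ℕ.≤ m → Ny ℕ.≤ n →
        ℚ.∣ seq y m ℚ.- seq y n ∣ ℚ.≤ Bx⁻¹ ℚ.* (½ ℚ.* ε)) →
      ∃[ N ] (∀ m n → N ℕ.≤ m → N ℕ.≤ n →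
        ℚ.∣ seq x m ℚ.* seq y m ℚ.- seq x n ℚ.* seq y n ∣ ℚ.≤ ε)
    combine ε {Bx} {By} {Bx⁻¹} {By⁻¹} 0<Bx 0<By invx invy Mx My Nx Ny bx by hx hy =
      (Mx ℕ.⊔ My) ℕ.⊔ (Nx ℕ.⊔ Ny) , λ m n N≤m N≤n →
        subst (ℚ.∣ seq x m ℚ.* seq y m ℚ.- seq x n ℚ.* seq y n ∣ ℚ.≤_) total
          (∣*-*∣≤ (seq x m) (seq x n) (seq y m) (seq y n) (ℚP.<⇒≤ 0<Bx) (ℚP.<⇒≤ 0<By)
            (bx m (ℕP.m⊔n≤o⇒m≤o Mx My (left N≤m)))
            (by n (ℕP.m⊔n≤o⇒n≤o Mx My (left N≤n)))
            (hy m n (ℕP.m⊔n≤o⇒n≤o Nx Ny (right N≤m)) (ℕP.m⊔n≤o⇒n≤o Nx Ny (right N≤n)))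
            (hx m n (ℕP.m⊔n≤o⇒m≤o Nx Ny (right N≤m)) (ℕP.m⊔n≤o⇒m≤o Nx Ny (right N≤n))))
      where
      left : ∀ {k} → (Mx ℕ.⊔ My) ℕ.⊔ (Nx ℕ.⊔ Ny) ℕ.≤ k → Mx ℕ.⊔ My ℕ.≤ k
      left = ℕP.m⊔n≤o⇒m≤o (Mx ℕ.⊔ My) (Nx ℕ.⊔ Ny)
      right : ∀ {k} → (Mx ℕ.⊔ My) ℕ.⊔ (Nx ℕ.⊔ Ny) ℕ.≤ k → Nx ℕ.⊔ Ny ℕ.≤ k
      right = ℕP.m⊔n≤o⇒n≤o (Mx ℕ.⊔ My) (Nx ℕ.⊔ Ny)
      total : Bx ℚ.* (Bx⁻¹ ℚ.* (½ ℚ.* ε)) ℚ.+ By ℚ.* (By⁻¹ ℚ.* (½ ℚ.* ε)) ≡ ε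
      total = trans (cong₂ ℚ._+_ (cancel-1/ Bx Bx⁻¹ _ invx) (cancel-1/ By By⁻¹ _ invy)) (½+½ ε)

_*_ : ℝ → ℝ → ℝ
x * y = mkℝ (λ n → seq x n ℚ.* seq y n) (*-cauchy x y)

opaque
  abs-cauchy : ∀ x → Cauchy (λ n → ℚ.∣ seq x n ∣)
  abs-cauchy x ε 0<ε =
    let N , h = cauchy x ε 0<ε
    in N , λ m n N≤m N≤n →
       ∣p-q∣≤r ℚ.∣ seq x m ∣ ℚ.∣ seq x n ∣
               (bound (seq x m) (seq x n) (h m n N≤m N≤n))
               (bound (seq x n) (seq x m) (h n m N≤n N≤m))
    where
    bound : ∀ p q {r} → ℚ.∣ p ℚ.- q ∣ ℚ.≤ r → ℚ.∣ p ∣ ℚ.≤ ℚ.∣ q ∣ ℚ.+ r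
    bound p q h = ℚP.≤-trans
      (subst (ℚ._≤ ℚ.∣ q ∣ ℚ.+ ℚ.∣ p ℚ.- q ∣)
        (cong ℚ.∣_∣ (solve 2 (λ p q → q :+ (p :- q) := p) refl p q))
        (ℚP.∣p+q∣≤∣p∣+∣q∣ q (p ℚ.- q)))
      (ℚP.+-monoʳ-≤ ℚ.∣ q ∣ h)
      where open ℚSolver.+-*-Solver

∣_∣ : ℝ → ℝ
∣ x ∣ = mkℝ (λ n → ℚ.∣ seq x n ∣) (abs-cauchy x)

∑ : ∀ {n} → Vector ℝ n → ℝ
∑ = foldr _+_ 0ℝ

/-mono : ∀ {a b c d} .{{_ : ℕ.NonZero b}} .{{_ : ℕ.NonZero d}} →
         a ℕ.* d ℕ.≤ c ℕ.* b → + a / b ℚ.≤ + c / d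
/-mono {a} {suc b} {c} {suc d} h = ℚP.toℚᵘ-cancel-≤
  (ℚᵘP.≤-respˡ-≃ (ℚᵘP.≃-sym (ℚP.toℚᵘ-fromℚᵘ (ℚᵘ.mkℚᵘ (+ a) b)))
  (ℚᵘP.≤-respʳ-≃ (ℚᵘP.≃-sym (ℚP.toℚᵘ-fromℚᵘ (ℚᵘ.mkℚᵘ (+ c) d)))
  (ℚᵘ.*≤* (subst₂ ℤ._≤_ (ℤP.pos-* a (suc d)) (ℤP.pos-* c (suc b)) (ℤ.+≤+ h)))))

/-* : ∀ a b c d → (+ a / suc b) ℚ.* (+ c / suc d) ≡ + (a ℕ.* c) / (suc b ℕ.* suc d)
/-* a b c d = ℚP.toℚᵘ-injective
  (ℚᵘP.≃-trans (ℚP.toℚᵘ-homo-* (+ a / suc b) (+ c / suc d))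
  (ℚᵘP.≃-trans (ℚᵘP.*-cong (ℚP.toℚᵘ-fromℚᵘ (ℚᵘ.mkℚᵘ (+ a) b)) (ℚP.toℚᵘ-fromℚᵘ (ℚᵘ.mkℚᵘ (+ c) d)))
  (ℚᵘP.≃-trans (ℚᵘ.*≡* (cong (ℤ._* + (suc b ℕ.* suc d)) (sym (ℤP.pos-* a c))))
  (ℚᵘP.≃-sym (ℚP.toℚᵘ-fromℚᵘ (ℚᵘ.mkℚᵘ (+ (a ℕ.* c)) (d ℕ.+ b ℕ.* suc d)))))))

/-+ : ∀ a c b → (+ a / suc b) ℚ.+ (+ c / suc b) ≡ + (a ℕ.+ c) / suc b
/-+ a c b = ℚP.toℚᵘ-injective
  (ℚᵘP.≃-trans (ℚP.toℚᵘ-homo-+ (+ a / suc b) (+ c / suc b))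
  (ℚᵘP.≃-trans (ℚᵘP.+-cong (ℚP.toℚᵘ-fromℚᵘ (ℚᵘ.mkℚᵘ (+ a) b)) (ℚP.toℚᵘ-fromℚᵘ (ℚᵘ.mkℚᵘ (+ c) b)))
  (ℚᵘP.≃-trans (ℚᵘ.*≡* eq)
  (ℚᵘP.≃-sym (ℚP.toℚᵘ-fromℚᵘ (ℚᵘ.mkℚᵘ (+ (a ℕ.+ c)) b))))))
  where
  D = + suc b
  eq : ((+ a) ℤ.* D ℤ.+ (+ c) ℤ.* D) ℤ.* D ≡ (+ (a ℕ.+ c)) ℤ.* + (suc b ℕ.* suc b)
  eq = trans (cong (ℤ._* D) (sym (ℤP.*-distribʳ-+ D (+ a) (+ c))))
       (trans (ℤP.*-assoc ((+ a) ℤ.+ (+ c)) D D)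
       (cong₂ ℤ._*_ (sym (ℤP.pos-+ a c)) (sym (ℤP.pos-* (suc b) (suc b)))))

0≤/ : ∀ a b → 0ℚ ℚ.≤ + a / suc b
0≤/ a b = ℚP.nonNegative⁻¹ (+ a / suc b) {{ℚP.normalize-nonNeg a (suc b)}}

0<1/ : ∀ b → 0ℚ ℚ.< + 1 / suc b
0<1/ b = ℚP.positive⁻¹ (+ 1 / suc b) {{ℚP.normalize-pos 1 (suc b)}}

archimedean : ∀ {ε} → 0ℚ ℚ.< ε → ∃[ M ] (∀ n → M ℕ.≤ n → + 1 / suc n ℚ.≤ ε)
archimedean {ε} 0<ε = go ε (ℚ.positive 0<ε)
  where
  go : ∀ ε → ℚ.Positive ε → ∃[ M ] (∀ n → M ℕ.≤ n → + 1 / suc n ℚ.≤ ε)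
  go (ℚ.mkℚ (+ zero) _ _) record { pos = () }
  go (ℚ.mkℚ -[1+ _ ] _ _) record { pos = () }
  go ε@(ℚ.mkℚ (+ suc k) d-1 _) _ = suc d-1 , λ n D≤n →
    subst (+ 1 / suc n ℚ.≤_) (ℚP.↥p/↧p≡p ε)
      (/-mono {1} {suc n} {suc k} {suc d-1}
        (ℕP.≤-trans (ℕP.≤-reflexive (ℕP.*-identityˡ (suc d-1)))
        (ℕP.≤-trans D≤n (ℕP.≤-trans (ℕP.n≤1+n n) (ℕP.m≤m+n (suc n) (k ℕ.* suc n))))))

-- The largest j ≤ b satisfying P, or 0 if there is none.
greatest : ∀ {P : ℕ → Set} → Decidable P → ℕ → ℕ
greatest P? zero = 0
greatest P? (suc b) with P? (suc b)
... | yes _ = suc b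
... | no  _ = greatest P? b

greatest-holds : ∀ {P : ℕ → Set} (P? : Decidable P) b → P 0 → P (greatest P? b)
greatest-holds P? zero p₀ = p₀
greatest-holds P? (suc b) p₀ with P? (suc b)
... | yes p = p
... | no  _ = greatest-holds P? b p₀

greatest-max : ∀ {P : ℕ → Set} (P? : Decidable P) b → ¬ P (suc b) →
               ¬ P (suc (greatest P? b))
greatest-max P? zero ¬p = ¬p
greatest-max P? (suc b) ¬p with P? (suc b)
... | yes _  = ¬p
... | no  ¬q = greatest-max P? b ¬q

^-cancelˡ-≤ : ∀ E .{{_ : ℕ.NonZero E}} {x y} → x ℕ.^ E ℕ.≤ y ℕ.^ E → x ℕ.≤ y
^-cancelˡ-≤ E {x} {y} h with x ℕ.≤? y
... | yes p = p
... | no  p = ⊥-elim (ℕP.<⇒≱ (ℕP.^-monoˡ-< E (ℕP.≰⇒> p)) h)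

^-cancelʳ-< : ∀ m .{{_ : ℕ.NonZero m}} {x y} → m ℕ.^ x ℕ.< m ℕ.^ y → x ℕ.< y
^-cancelʳ-< m {x} {y} h with y ℕ.≤? x
... | yes p = ⊥-elim (ℕP.<⇒≱ h (ℕP.^-monoʳ-≤ m p))
... | no  p = ℕP.≰⇒> p

n<2^n : ∀ n → n ℕ.< 2 ℕ.^ n
n<2^n zero = ℕ.s≤s ℕ.z≤n
n<2^n (suc n) = ℕP.≤-trans (ℕP.+-mono-≤ (ℕP.m^n>0 2 n) (n<2^n n))
  (ℕP.≤-reflexive (cong (2 ℕ.^ n ℕ.+_) (sym (ℕP.+-identityʳ (2 ℕ.^ n)))))

-- ⌊ N log₂ d ⌋
logFloor : ℕ → ℕ → ℕ
logFloor d N = greatest (λ j → 2 ℕ.^ j ℕ.≤? d ℕ.^ N) (d ℕ.^ N)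

logFloor-lower : ∀ d .{{_ : ℕ.NonZero d}} N → 2 ℕ.^ logFloor d N ℕ.≤ d ℕ.^ N
logFloor-lower d N =
  greatest-holds (λ j → 2 ℕ.^ j ℕ.≤? d ℕ.^ N) (d ℕ.^ N) (ℕP.m^n>0 d N)

logFloor-upper : ∀ d N → d ℕ.^ N ℕ.< 2 ℕ.^ suc (logFloor d N)
logFloor-upper d N = ℕP.≰⇒>
  (greatest-max (λ j → 2 ℕ.^ j ℕ.≤? d ℕ.^ N) (d ℕ.^ N)
    (ℕP.<⇒≱ (ℕP.<-trans (ℕP.n<1+n _) (n<2^n (suc (d ℕ.^ N))))))

logFloor-compare : ∀ d .{{_ : ℕ.NonZero d}} M N .{{_ : ℕ.NonZero M}} →
                   logFloor d M ℕ.* N ℕ.< suc (logFloor d N) ℕ.* M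
logFloor-compare d M N = ^-cancelʳ-< 2 (begin-strict
  2 ℕ.^ (logFloor d M ℕ.* N)       ≡⟨ ℕP.^-*-assoc 2 (logFloor d M) N ⟨
  (2 ℕ.^ logFloor d M) ℕ.^ N       ≤⟨ ℕP.^-monoˡ-≤ N (logFloor-lower d M) ⟩
  (d ℕ.^ M) ℕ.^ N                  ≡⟨ ℕP.^-*-assoc d M N ⟩
  d ℕ.^ (M ℕ.* N)                  ≡⟨ cong (d ℕ.^_) (ℕP.*-comm M N) ⟩
  d ℕ.^ (N ℕ.* M)                  ≡⟨ ℕP.^-*-assoc d N M ⟨
  (d ℕ.^ N) ℕ.^ M                  <⟨ ℕP.^-monoˡ-< M (logFloor-upper d N) ⟩
  (2 ℕ.^ suc (logFloor d N)) ℕ.^ M ≡⟨ ℕP.^-*-assoc 2 (suc (logFloor d N)) M ⟩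
  2 ℕ.^ (suc (logFloor d N) ℕ.* M) ∎)
  where open ℕP.≤-Reasoning

logSeq : ℕ → ℕ → ℚ
logSeq d n = + logFloor d (suc n) / suc n

logSeq-compare : ∀ d .{{_ : ℕ.NonZero d}} m n →
  logSeq d m ℚ.≤ logSeq d n ℚ.+ (+ 1 / suc n)
logSeq-compare d m n = subst (logSeq d m ℚ.≤_) (sym (/-+ (logFloor d (suc n)) 1 n))
  (/-mono {logFloor d (suc m)} {suc m} {logFloor d (suc n) ℕ.+ 1} {suc n}
    (subst (λ z → logFloor d (suc m) ℕ.* suc n ℕ.≤ z ℕ.* suc m)
      (ℕP.+-comm 1 (logFloor d (suc n)))
      (ℕP.<⇒≤ (logFloor-compare d (suc m) (suc n)))))

opaque
  log-cauchy : ∀ d .{{_ : ℕ.NonZero d}} → Cauchy (logSeq d)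
  log-cauchy d ε 0<ε =
    let N , h = archimedean 0<ε
    in N , λ m n N≤m N≤n → ∣p-q∣≤r (logSeq d m) (logSeq d n)
         (ℚP.≤-trans (logSeq-compare d m n) (ℚP.+-monoʳ-≤ (logSeq d n) (h n N≤n)))
         (ℚP.≤-trans (logSeq-compare d n m) (ℚP.+-monoʳ-≤ (logSeq d m) (h m N≤m)))

log₂ : (d : ℕ) .{{_ : ℕ.NonZero d}} → ℝ
log₂ d = mkℝ (logSeq d) (log-cauchy d)

infix 9 _⁺ _⁻

_⁺ _⁻ : ℤ → ℕ
(+ n)    ⁺ = n
-[1+ n ] ⁺ = 0
(+ n)    ⁻ = 0
-[1+ n ] ⁻ = suc n

⁺-⁻ : ∀ a → a ≡ + (a ⁺) ℤ.- + (a ⁻)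
⁺-⁻ (+ n)    = sym (ℤP.+-identityʳ (+ n))
⁺-⁻ -[1+ n ] = refl

-- ⌊ N d^(a/q) ⌋, the exponent being split as a = a⁺ - a⁻ to stay within ℕ
powFloor : ℕ → ℕ → ℤ → ℕ → ℕ
powFloor d N a q =
  greatest (λ j → j ℕ.^ q ℕ.* d ℕ.^ a ⁻ ℕ.≤? N ℕ.^ q ℕ.* d ℕ.^ a ⁺) (N ℕ.* d ℕ.^ a ⁺)

powFloor-lower : ∀ d N a q .{{_ : ℕ.NonZero q}} →
  powFloor d N a q ℕ.^ q ℕ.* d ℕ.^ a ⁻ ℕ.≤ N ℕ.^ q ℕ.* d ℕ.^ a ⁺
powFloor-lower d N a q@(suc _) = greatest-holds
  (λ j → j ℕ.^ q ℕ.* d ℕ.^ a ⁻ ℕ.≤? N ℕ.^ q ℕ.* d ℕ.^ a ⁺) (N ℕ.* d ℕ.^ a ⁺) ℕ.z≤n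

m≤m^n : ∀ m .{{_ : ℕ.NonZero m}} n .{{_ : ℕ.NonZero n}} → m ℕ.≤ m ℕ.^ n
m≤m^n m (suc n) = ℕP.m≤m*n m (m ℕ.^ n) {{ℕP.m^n≢0 m n}}

^-distrib-* : ∀ x y n → (x ℕ.* y) ℕ.^ n ≡ x ℕ.^ n ℕ.* y ℕ.^ n
^-distrib-* x y zero = refl
^-distrib-* x y (suc n) = trans (cong (x ℕ.* y ℕ.*_) (^-distrib-* x y n))
  (solve 4 (λ x y a b → x :* y :* (a :* b) := x :* a :* (y :* b)) refl
    x y (x ℕ.^ n) (y ℕ.^ n))
  where open ℕSolver.+-*-Solver

powFloor-upper : ∀ d .{{_ : ℕ.NonZero d}} N a q .{{_ : ℕ.NonZero q}} →
  N ℕ.^ q ℕ.* d ℕ.^ a ⁺ ℕ.< suc (powFloor d N a q) ℕ.^ q ℕ.* d ℕ.^ a ⁻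
powFloor-upper d N a q = ℕP.≰⇒> (greatest-max
  (λ j → j ℕ.^ q ℕ.* d ℕ.^ a ⁻ ℕ.≤? N ℕ.^ q ℕ.* d ℕ.^ a ⁺) (N ℕ.* d ℕ.^ a ⁺)
  (ℕP.<⇒≱ (begin-strict
    N ℕ.^ q ℕ.* d ℕ.^ a ⁺
      ≤⟨ ℕP.*-monoʳ-≤ (N ℕ.^ q) (m≤m^n (d ℕ.^ a ⁺) {{ℕP.m^n≢0 d (a ⁺)}} q) ⟩
    N ℕ.^ q ℕ.* (d ℕ.^ a ⁺) ℕ.^ q
      ≡⟨ ^-distrib-* N (d ℕ.^ a ⁺) q ⟨
    (N ℕ.* d ℕ.^ a ⁺) ℕ.^ q
      <⟨ ℕP.^-monoˡ-< q (ℕP.n<1+n _) ⟩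
    suc (N ℕ.* d ℕ.^ a ⁺) ℕ.^ q
      ≤⟨ ℕP.m≤m*n _ (d ℕ.^ a ⁻) {{ℕP.m^n≢0 d (a ⁻)}} ⟩
    suc (N ℕ.* d ℕ.^ a ⁺) ℕ.^ q ℕ.* d ℕ.^ a ⁻ ∎)))
  where open ℕP.≤-Reasoning

bernoulli : ∀ d M n → M ℕ.^ n ℕ.* (M ℕ.+ n ℕ.* d) ℕ.≤ M ℕ.* (M ℕ.+ d) ℕ.^ n
bernoulli d M zero = ℕP.≤-reflexive
  (solve 1 (λ M → con 1 :* (M :+ con 0) := M :* con 1) refl M)
  where open ℕSolver.+-*-Solver
bernoulli d M (suc n) = begin
  M ℕ.* P ℕ.* (M ℕ.+ (d ℕ.+ n ℕ.* d))
    ≤⟨ ℕP.m≤m+n _ (P ℕ.* (n ℕ.* d ℕ.* d)) ⟩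
  M ℕ.* P ℕ.* (M ℕ.+ (d ℕ.+ n ℕ.* d)) ℕ.+ P ℕ.* (n ℕ.* d ℕ.* d)
    ≡⟨ solve 4 (λ M P d k → M :* P :* (M :+ (d :+ k)) :+ P :* (k :* d)
                          := (M :+ d) :* (P :* (M :+ k))) refl M P d (n ℕ.* d) ⟩
  (M ℕ.+ d) ℕ.* (P ℕ.* (M ℕ.+ n ℕ.* d))
    ≤⟨ ℕP.*-monoʳ-≤ (M ℕ.+ d) (bernoulli d M n) ⟩
  (M ℕ.+ d) ℕ.* (M ℕ.* (M ℕ.+ d) ℕ.^ n)
    ≡⟨ solve 3 (λ x y z → x :* (y :* z) := y :* (x :* z)) refl
         (M ℕ.+ d) M ((M ℕ.+ d) ℕ.^ n) ⟩
  M ℕ.* ((M ℕ.+ d) ℕ.* (M ℕ.+ d) ℕ.^ n) ∎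
  where
  open ℕP.≤-Reasoning
  open ℕSolver.+-*-Solver
  P = M ℕ.^ n

-- d^(1/M) ≤ 1 + d/M
d≤[1+d/M]^M : ∀ d M .{{_ : ℕ.NonZero M}} → M ℕ.^ M ℕ.* d ℕ.≤ (M ℕ.+ d) ℕ.^ M
d≤[1+d/M]^M d M = ℕP.*-cancelˡ-≤ M (begin
  M ℕ.* (M ℕ.^ M ℕ.* d)           ≡⟨ solve 3 (λ M P d → M :* (P :* d) := P :* (M :* d)) refl M (M ℕ.^ M) d ⟩
  M ℕ.^ M ℕ.* (M ℕ.* d)           ≤⟨ ℕP.*-monoʳ-≤ (M ℕ.^ M) (ℕP.m≤n+m (M ℕ.* d) M) ⟩
  M ℕ.^ M ℕ.* (M ℕ.+ M ℕ.* d)     ≤⟨ bernoulli d M M ⟩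
  M ℕ.* (M ℕ.+ d) ℕ.^ M           ∎)
  where
  open ℕP.≤-Reasoning
  open ℕSolver.+-*-Solver

-- If a/q ≤ a′/q′ + 1/M then j/N ≤ ((j′ + 1)/N′) (1 + d/M), where j/N and j′/N′
-- are the approximations to d^(a/q) and d^(a′/q′).
powFloor-compare : ∀ d .{{_ : ℕ.NonZero d}} M .{{_ : ℕ.NonZero M}}
  N a q .{{_ : ℕ.NonZero q}} N′ a′ q′ .{{_ : ℕ.NonZero q′}} →
  a ⁺ ℕ.* (q′ ℕ.* M) ℕ.+ a′ ⁻ ℕ.* (q ℕ.* M) ℕ.≤
    (a ⁻ ℕ.* (q′ ℕ.* M) ℕ.+ a′ ⁺ ℕ.* (q ℕ.* M)) ℕ.+ q ℕ.* q′ →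
  powFloor d N a q ℕ.* (N′ ℕ.* M) ℕ.≤ suc (powFloor d N′ a′ q′) ℕ.* (N ℕ.* (M ℕ.+ d))
powFloor-compare d M N a q {{q≢0}} N′ a′ q′ H =
  ^-cancelˡ-≤ E {{E≢0}}
  (ℕP.*-cancelʳ-≤ _ _ (d ℕ.^ R) {{ℕP.m^n≢0 d R}} (begin
    (j ℕ.* (N′ ℕ.* M)) ℕ.^ E ℕ.* d ℕ.^ R
      ≤⟨ ℕP.*-monoʳ-≤ ((j ℕ.* (N′ ℕ.* M)) ℕ.^ E) (ℕP.^-monoʳ-≤ d H) ⟩
    (j ℕ.* (N′ ℕ.* M)) ℕ.^ E ℕ.* d ℕ.^ ((e₁ ℕ.+ e₂) ℕ.+ e₃)
      ≡⟨ cong₂ ℕ._*_ (^3 j N′ M) (d^3 e₁ e₂ e₃) ⟩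
    (j ℕ.^ E ℕ.* (N′ ℕ.^ E ℕ.* M ℕ.^ E)) ℕ.* ((d ℕ.^ e₁ ℕ.* d ℕ.^ e₂) ℕ.* d ℕ.^ e₃)
      ≡⟨ solve 6 (λ a b c x y z → (a :* (b :* c)) :* ((x :* y) :* z)
                               := (a :* x) :* ((b :* y) :* (c :* z))) refl
           (j ℕ.^ E) (N′ ℕ.^ E) (M ℕ.^ E) (d ℕ.^ e₁) (d ℕ.^ e₂) (d ℕ.^ e₃) ⟩
    (j ℕ.^ E ℕ.* d ℕ.^ e₁) ℕ.* ((N′ ℕ.^ E ℕ.* d ℕ.^ e₂) ℕ.* (M ℕ.^ E ℕ.* d ℕ.^ e₃))
      ≤⟨ ℕP.*-mono-≤ h₁ (ℕP.*-mono-≤ h₂ h₃) ⟩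
    (N ℕ.^ E ℕ.* d ℕ.^ r₁) ℕ.* ((J ℕ.^ E ℕ.* d ℕ.^ r₂) ℕ.* (M ℕ.+ d) ℕ.^ E)
      ≡⟨ solve 5 (λ n x J y m → (n :* x) :* ((J :* y) :* m)
                             := (J :* (n :* m)) :* (x :* y)) refl
           (N ℕ.^ E) (d ℕ.^ r₁) (J ℕ.^ E) (d ℕ.^ r₂) ((M ℕ.+ d) ℕ.^ E) ⟩
    (J ℕ.^ E ℕ.* (N ℕ.^ E ℕ.* (M ℕ.+ d) ℕ.^ E)) ℕ.* (d ℕ.^ r₁ ℕ.* d ℕ.^ r₂)
      ≡⟨ cong₂ ℕ._*_ (^3 J N (M ℕ.+ d)) (ℕP.^-distribˡ-+-* d r₁ r₂) ⟨
    (J ℕ.* (N ℕ.* (M ℕ.+ d))) ℕ.^ E ℕ.* d ℕ.^ R ∎))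
  where
  open ℕP.≤-Reasoning
  open ℕSolver.+-*-Solver
  j = powFloor d N a q
  J = suc (powFloor d N′ a′ q′)
  E = q ℕ.* (q′ ℕ.* M)
  e₁ = a ⁻ ℕ.* (q′ ℕ.* M)
  e₂ = a′ ⁺ ℕ.* (q ℕ.* M)
  e₃ = q ℕ.* q′
  r₁ = a ⁺ ℕ.* (q′ ℕ.* M)
  r₂ = a′ ⁻ ℕ.* (q ℕ.* M)
  R = r₁ ℕ.+ r₂

  E≢0 : ℕ.NonZero E
  E≢0 = ℕP.m*n≢0 q (q′ ℕ.* M) {{q≢0}} {{ℕP.m*n≢0 q′ M}}

  ^3 : ∀ x y z → (x ℕ.* (y ℕ.* z)) ℕ.^ E ≡ x ℕ.^ E ℕ.* (y ℕ.^ E ℕ.* z ℕ.^ E)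
  ^3 x y z = trans (^-distrib-* x (y ℕ.* z) E) (cong (x ℕ.^ E ℕ.*_) (^-distrib-* y z E))

  d^3 : ∀ x y z → d ℕ.^ ((x ℕ.+ y) ℕ.+ z) ≡ (d ℕ.^ x ℕ.* d ℕ.^ y) ℕ.* d ℕ.^ z
  d^3 x y z = trans (ℕP.^-distribˡ-+-* d (x ℕ.+ y) z)
                    (cong (ℕ._* d ℕ.^ z) (ℕP.^-distribˡ-+-* d x y))

  split : ∀ x y r s → (x ℕ.^ r ℕ.* d ℕ.^ y) ℕ.^ s ≡ x ℕ.^ (r ℕ.* s) ℕ.* d ℕ.^ (y ℕ.* s)
  split x y r s = trans (^-distrib-* (x ℕ.^ r) (d ℕ.^ y) s)
                        (cong₂ ℕ._*_ (ℕP.^-*-assoc x r s) (ℕP.^-*-assoc d y s))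

  h₁ : j ℕ.^ E ℕ.* d ℕ.^ e₁ ℕ.≤ N ℕ.^ E ℕ.* d ℕ.^ r₁
  h₁ = subst₂ ℕ._≤_ (split j (a ⁻) q (q′ ℕ.* M)) (split N (a ⁺) q (q′ ℕ.* M))
         (ℕP.^-monoˡ-≤ (q′ ℕ.* M) (powFloor-lower d N a q))

  E≡ : q′ ℕ.* (q ℕ.* M) ≡ E
  E≡ = solve 3 (λ q q′ M → q′ :* (q :* M) := q :* (q′ :* M)) refl q q′ M

  h₂ : N′ ℕ.^ E ℕ.* d ℕ.^ e₂ ℕ.≤ J ℕ.^ E ℕ.* d ℕ.^ r₂
  h₂ = subst (λ z → N′ ℕ.^ z ℕ.* d ℕ.^ e₂ ℕ.≤ J ℕ.^ z ℕ.* d ℕ.^ r₂) E≡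
         (subst₂ ℕ._≤_ (split N′ (a′ ⁺) q′ (q ℕ.* M)) (split J (a′ ⁻) q′ (q ℕ.* M))
           (ℕP.^-monoˡ-≤ (q ℕ.* M) (ℕP.<⇒≤ (powFloor-upper d N′ a′ q′))))

  E≡′ : M ℕ.* (q ℕ.* q′) ≡ E
  E≡′ = solve 3 (λ q q′ M → M :* (q :* q′) := q :* (q′ :* M)) refl q q′ M

  h₃ : M ℕ.^ E ℕ.* d ℕ.^ e₃ ℕ.≤ (M ℕ.+ d) ℕ.^ E
  h₃ = subst (λ z → M ℕ.^ z ℕ.* d ℕ.^ e₃ ℕ.≤ (M ℕ.+ d) ℕ.^ z) E≡′
         (subst₂ ℕ._≤_
           (trans (^-distrib-* (M ℕ.^ M) d e₃) (cong (ℕ._* d ℕ.^ e₃) (ℕP.^-*-assoc M M e₃)))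
           (ℕP.^-*-assoc (M ℕ.+ d) M e₃)
           (ℕP.^-monoˡ-≤ e₃ (d≤[1+d/M]^M d M)))

exponent-≤ : ∀ x y M → x ℚ.≤ y ℚ.+ (+ 1 / suc M) →
  (↥ x) ⁺ ℕ.* (↧ₙ y ℕ.* suc M) ℕ.+ (↥ y) ⁻ ℕ.* (↧ₙ x ℕ.* suc M) ℕ.≤
    ((↥ x) ⁻ ℕ.* (↧ₙ y ℕ.* suc M) ℕ.+ (↥ y) ⁺ ℕ.* (↧ₙ x ℕ.* suc M)) ℕ.+ ↧ₙ x ℕ.* ↧ₙ y
exponent-≤ x@record{} y@record{} M h = ℤP.drop‿+≤+ (begin
  + (a ⁺ ℕ.* (q′ ℕ.* M′) ℕ.+ a′ ⁻ ℕ.* (q ℕ.* M′))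
    ≡⟨ cast₂ (a ⁺) q′ (a′ ⁻) q ⟩
  + (a ⁺) ℤ.* (+ q′ ℤ.* + M′) ℤ.+ + (a′ ⁻) ℤ.* (+ q ℤ.* + M′)
    ≡⟨ solve 6 (λ p n Q M n′ q → p :* (Q :* M) :+ n′ :* (q :* M)
                := (p :- n) :* (Q :* M) :+ (n :* (Q :* M) :+ n′ :* (q :* M))) refl
         (+ (a ⁺)) (+ (a ⁻)) (+ q′) (+ M′) (+ (a′ ⁻)) (+ q) ⟩
  (+ (a ⁺) ℤ.- + (a ⁻)) ℤ.* (+ q′ ℤ.* + M′) ℤ.+ S
    ≡⟨ cong (λ z → z ℤ.* (+ q′ ℤ.* + M′) ℤ.+ S) (⁺-⁻ a) ⟨
  a ℤ.* (+ q′ ℤ.* + M′) ℤ.+ S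
    ≤⟨ ℤP.+-monoˡ-≤ S cross ⟩
  (a′ ℤ.* + M′ ℤ.+ + 1 ℤ.* + q′) ℤ.* + q ℤ.+ S
    ≡⟨ cong (λ z → (z ℤ.* + M′ ℤ.+ + 1 ℤ.* + q′) ℤ.* + q ℤ.+ S) (⁺-⁻ a′) ⟩
  ((+ (a′ ⁺) ℤ.- + (a′ ⁻)) ℤ.* + M′ ℤ.+ + 1 ℤ.* + q′) ℤ.* + q ℤ.+ S
    ≡⟨ solve 6 (λ p n Q M n′ q →
          ((p :- n′) :* M :+ con (+ 1) :* Q) :* q :+ (n :* (Q :* M) :+ n′ :* (q :* M))
          := (n :* (Q :* M) :+ p :* (q :* M)) :+ q :* Q) refl
         (+ (a′ ⁺)) (+ (a ⁻)) (+ q′) (+ M′) (+ (a′ ⁻)) (+ q) ⟩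
  (+ (a ⁻) ℤ.* (+ q′ ℤ.* + M′) ℤ.+ + (a′ ⁺) ℤ.* (+ q ℤ.* + M′)) ℤ.+ + q ℤ.* + q′
    ≡⟨ cong₂ ℤ._+_ (cast₂ (a ⁻) q′ (a′ ⁺) q) (ℤP.pos-* q q′) ⟨
  + (a ⁻ ℕ.* (q′ ℕ.* M′) ℕ.+ a′ ⁺ ℕ.* (q ℕ.* M′)) ℤ.+ + (q ℕ.* q′)
    ≡⟨ ℤP.pos-+ (a ⁻ ℕ.* (q′ ℕ.* M′) ℕ.+ a′ ⁺ ℕ.* (q ℕ.* M′)) (q ℕ.* q′) ⟨
  + ((a ⁻ ℕ.* (q′ ℕ.* M′) ℕ.+ a′ ⁺ ℕ.* (q ℕ.* M′)) ℕ.+ q ℕ.* q′) ∎)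
  where
  open ℤP.≤-Reasoning
  open ℤSolver.+-*-Solver
  a = ↥ x ; a′ = ↥ y ; q = ↧ₙ x ; q′ = ↧ₙ y ; M′ = suc M
  S = + (a ⁻) ℤ.* (+ q′ ℤ.* + M′) ℤ.+ + (a′ ⁻) ℤ.* (+ q ℤ.* + M′)

  cast₁ : ∀ u v → + (u ℕ.* (v ℕ.* M′)) ≡ + u ℤ.* (+ v ℤ.* + M′)
  cast₁ u v = trans (ℤP.pos-* u (v ℕ.* M′)) (cong (+ u ℤ.*_) (ℤP.pos-* v M′))

  cast₂ : ∀ u v u′ v′ → + (u ℕ.* (v ℕ.* M′) ℕ.+ u′ ℕ.* (v′ ℕ.* M′)) ≡
          + u ℤ.* (+ v ℤ.* + M′) ℤ.+ + u′ ℤ.* (+ v′ ℤ.* + M′)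
  cast₂ u v u′ v′ = trans (ℤP.pos-+ (u ℕ.* (v ℕ.* M′)) (u′ ℕ.* (v′ ℕ.* M′)))
                          (cong₂ ℤ._+_ (cast₁ u v) (cast₁ u′ v′))

  cross : a ℤ.* (+ q′ ℤ.* + M′) ℤ.≤ (a′ ℤ.* + M′ ℤ.+ + 1 ℤ.* + q′) ℤ.* + q
  cross = subst (λ z → a ℤ.* z ℤ.≤ (a′ ℤ.* + M′ ℤ.+ + 1 ℤ.* + q′) ℤ.* + q) (ℤP.pos-* q′ M′) (ℚᵘP.drop-*≤*
    (ℚᵘP.≤-respʳ-≃
      (ℚᵘP.≃-trans (ℚP.toℚᵘ-homo-+ y (+ 1 / suc M))
        (ℚᵘP.+-congʳ (ℚ.toℚᵘ y) (ℚP.toℚᵘ-fromℚᵘ (ℚᵘ.mkℚᵘ (+ 1) M))))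
      (ℚP.toℚᵘ-mono-≤ h)))

powSeq : ℕ → (ℕ → ℚ) → ℕ → ℚ
powSeq d x n = + powFloor d (suc n) (↥ x n) (↧ₙ x n) / suc n

powSeq-compare : ∀ d .{{_ : ℕ.NonZero d}} (x : ℕ → ℚ) M m n →
  x m ℚ.≤ x n ℚ.+ (+ 1 / suc M) →
  powSeq d x m ℚ.≤ (powSeq d x n ℚ.+ (+ 1 / suc n)) ℚ.* (1ℚ ℚ.+ (+ d / suc M))
powSeq-compare d x M m n h = subst (powSeq d x m ℚ.≤_) (sym rhs)
  (/-mono {j} {suc m} {(J ℕ.+ 1) ℕ.* (suc M ℕ.+ d)} {suc n ℕ.* suc M}
    (subst (j ℕ.* (suc n ℕ.* suc M) ℕ.≤_)
      (solve 3 (λ J m M → (con 1 :+ J) :* (m :* M) := (J :+ con 1) :* M :* m) refl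
        J (suc m) (suc M ℕ.+ d))
      (powFloor-compare d (suc M) (suc m) (↥ x m) (↧ₙ x m) (suc n) (↥ x n) (↧ₙ x n)
        (exponent-≤ (x m) (x n) M h))))
  where
  open ℕSolver.+-*-Solver
  j = powFloor d (suc m) (↥ x m) (↧ₙ x m)
  J = powFloor d (suc n) (↥ x n) (↧ₙ x n)

  1≡ : 1ℚ ≡ + suc M / suc M
  1≡ = ℚP.≤-antisym
    (/-mono {1} {1} {suc M} {suc M} (ℕP.≤-reflexive (ℕP.*-comm 1 (suc M))))
    (/-mono {suc M} {suc M} {1} {1} (ℕP.≤-reflexive (ℕP.*-comm (suc M) 1)))

  rhs : (powSeq d x n ℚ.+ (+ 1 / suc n)) ℚ.* (1ℚ ℚ.+ (+ d / suc M)) ≡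
        + ((J ℕ.+ 1) ℕ.* (suc M ℕ.+ d)) / (suc n ℕ.* suc M)
  rhs = trans (cong₂ ℚ._*_ (/-+ J 1 n)
                (trans (cong (ℚ._+ (+ d / suc M)) 1≡) (/-+ (suc M) d M)))
              (/-* (J ℕ.+ 1) n (suc M ℕ.+ d) M)

+-nonneg : ∀ {p q} → 0ℚ ℚ.≤ p → 0ℚ ℚ.≤ q → 0ℚ ℚ.≤ p ℚ.+ q
+-nonneg {p} {q} = ℚP.+-mono-≤ {0ℚ} {p} {0ℚ} {q}

*-nonneg : ∀ {p q} → 0ℚ ℚ.≤ p → 0ℚ ℚ.≤ q → 0ℚ ℚ.≤ p ℚ.* q
*-nonneg {p} {q} = λ 0≤p 0≤q → ≤-*-mono {0ℚ} {p} {0ℚ} {q} ℚP.≤-refl 0≤p 0≤p 0≤q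

/-split : ∀ d M → + d / suc M ≡ (+ d / 1) ℚ.* (+ 1 / suc M)
/-split d M = trans (/-cong′ (sym (ℕP.*-identityʳ d)) (sym (ℕP.*-identityˡ (suc M))))
                    (sym (/-* d 0 1 M))
  where
  /-cong′ : ∀ {a b c e} .{{_ : ℕ.NonZero c}} .{{_ : ℕ.NonZero e}} → a ≡ b → c ≡ e →
            + a / c ≡ + b / e
  /-cong′ refl refl = refl

1≤1+ : ∀ {t} → 0ℚ ℚ.≤ t → 1ℚ ℚ.≤ 1ℚ ℚ.+ t
1≤1+ {t} h = ℚP.≤-trans (ℚP.≤-reflexive (sym (ℚP.+-identityʳ 1ℚ)))
                        (ℚP.+-monoʳ-≤ 1ℚ h)

pow-estimate : ∀ u v e B D t {δ} → 0ℚ ℚ.≤ B → 0ℚ ℚ.≤ D → 0ℚ ℚ.≤ t →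
  u ℚ.≤ (v ℚ.+ e) ℚ.* (1ℚ ℚ.+ D ℚ.* t) → v ℚ.+ e ℚ.≤ B →
  e ℚ.≤ ½ ℚ.* δ → (B ℚ.* D ℚ.+ 1ℚ) ℚ.* t ℚ.≤ ½ ℚ.* δ → u ℚ.≤ v ℚ.+ δ
pow-estimate u v e B D t {δ} 0≤B 0≤D 0≤t hu hB he ht = begin
  u
    ≤⟨ hu ⟩
  (v ℚ.+ e) ℚ.* (1ℚ ℚ.+ D ℚ.* t)
    ≡⟨ solve 4 (λ v e D t → (v :+ e) :* (con 1ℚ :+ D :* t)
                         := v :+ (e :+ (v :+ e) :* (D :* t))) refl v e D t ⟩
  v ℚ.+ (e ℚ.+ (v ℚ.+ e) ℚ.* (D ℚ.* t))
    ≤⟨ ℚP.+-monoʳ-≤ v (ℚP.+-mono-≤ he h) ⟩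
  v ℚ.+ (½ ℚ.* δ ℚ.+ ½ ℚ.* δ)
    ≡⟨ cong (v ℚ.+_) (½+½ δ) ⟩
  v ℚ.+ δ ∎
  where
  open ℚP.≤-Reasoning
  open ℚSolver.+-*-Solver
  h : (v ℚ.+ e) ℚ.* (D ℚ.* t) ℚ.≤ ½ ℚ.* δ
  h = begin
    (v ℚ.+ e) ℚ.* (D ℚ.* t)
      ≤⟨ ≤-*-mono {v ℚ.+ e} {B} (*-nonneg 0≤D 0≤t) 0≤B hB ℚP.≤-refl ⟩
    B ℚ.* (D ℚ.* t)
      ≡⟨ ℚP.+-identityʳ (B ℚ.* (D ℚ.* t)) ⟨
    B ℚ.* (D ℚ.* t) ℚ.+ 0ℚ
      ≤⟨ ℚP.+-monoʳ-≤ (B ℚ.* (D ℚ.* t)) 0≤t ⟩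
    B ℚ.* (D ℚ.* t) ℚ.+ t
      ≡⟨ solve 3 (λ B D t → B :* (D :* t) :+ t := (B :* D :+ con 1ℚ) :* t) refl B D t ⟩
    (B ℚ.* D ℚ.+ 1ℚ) ℚ.* t
      ≤⟨ ht ⟩
    ½ ℚ.* δ ∎

powSeq-bounded : ∀ d .{{_ : ℕ.NonZero d}} (x : ℝ) → ∃[ B ] 0ℚ ℚ.≤ B × ∃[ N ]
  (∀ n → N ℕ.≤ n → powSeq d (seq x) n ℚ.+ (+ 1 / suc n) ℚ.≤ B)
powSeq-bounded d x =
  let N , h = cauchy x (+ 1 / 1) (0<1/ 0)
      C = (powSeq d (seq x) N ℚ.+ (+ 1 / suc N)) ℚ.* (1ℚ ℚ.+ (+ d / 1))
      0≤C = *-nonneg {powSeq d (seq x) N ℚ.+ (+ 1 / suc N)} {1ℚ ℚ.+ (+ d / 1)}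
              (+-nonneg {powSeq d (seq x) N}
                (0≤/ (powFloor d (suc N) (↥ seq x N) (↧ₙ seq x N)) N) (0≤/ 1 N))
              (+-nonneg {1ℚ} (0≤/ 1 0) (0≤/ d 0))
  in C ℚ.+ (+ 1 / 1) , +-nonneg {C} 0≤C (0≤/ 1 0) , N , λ n N≤n →
     ℚP.+-mono-≤ {powSeq d (seq x) n} {C} {+ 1 / suc n} {+ 1 / 1}
       (powSeq-compare d (seq x) 0 n N
         (∣p-q∣≤r⇒p≤q+r (seq x n) (seq x N) (h n N N≤n ℕP.≤-refl)))
       (/-mono {1} {suc n} {1} {1} (ℕ.s≤s ℕ.z≤n))

powSeq-close : ∀ d .{{_ : ℕ.NonZero d}} (x : ℝ) ε → 0ℚ ℚ.< ε →
  ∃[ N ] (∀ m n → N ℕ.≤ m → N ℕ.≤ n →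
          powSeq d (seq x) m ℚ.≤ powSeq d (seq x) n ℚ.+ ε)
powSeq-close d x ε 0<ε =
  let B , 0≤B , N₁ , bounds = powSeq-bounded d x
      K⁻¹ , 0<K⁻¹ , inv = 1/pos (0<K 0≤B)
      M , small = archimedean (*-pos 0<K⁻¹ (½-pos 0<ε))
      N₂ , close = cauchy x (+ 1 / suc M) (0<1/ M)
      N₃ , fine = archimedean (½-pos 0<ε)
  in N₁ ℕ.⊔ (N₂ ℕ.⊔ N₃) , λ m n N≤m N≤n →
     pow-estimate (powSeq d (seq x) m) (powSeq d (seq x) n) (+ 1 / suc n)
       B (+ d / 1) (+ 1 / suc M) 0≤B (0≤/ d 0) (0≤/ 1 M)
       (subst (λ t → powSeq d (seq x) m ℚ.≤
                     (powSeq d (seq x) n ℚ.+ (+ 1 / suc n)) ℚ.* (1ℚ ℚ.+ t))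
         (/-split d M)
         (powSeq-compare d (seq x) M m n
           (∣p-q∣≤r⇒p≤q+r (seq x m) (seq x n)
             (close m n (N₂≤ N₁ N₂ N₃ N≤m) (N₂≤ N₁ N₂ N₃ N≤n)))))
       (bounds n (ℕP.m⊔n≤o⇒m≤o N₁ _ N≤n))
       (fine n (ℕP.m⊔n≤o⇒n≤o N₂ N₃ (ℕP.m⊔n≤o⇒n≤o N₁ _ N≤n)))
       (subst ((B ℚ.* (+ d / 1) ℚ.+ 1ℚ) ℚ.* (+ 1 / suc M) ℚ.≤_)
         (cancel-1/ (B ℚ.* (+ d / 1) ℚ.+ 1ℚ) K⁻¹ (½ ℚ.* ε) inv)
         (ℚP.*-monoˡ-≤-nonNeg (B ℚ.* (+ d / 1) ℚ.+ 1ℚ)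
           {{ℚ.nonNegative (ℚP.<⇒≤ (0<K 0≤B))}} (small M ℕP.≤-refl)))
  where
  0<K : ∀ {B} → 0ℚ ℚ.≤ B → 0ℚ ℚ.< B ℚ.* (+ d / 1) ℚ.+ 1ℚ
  0<K {B} 0≤B = ℚP.+-mono-≤-< {0ℚ} {B ℚ.* (+ d / 1)} {0ℚ} {1ℚ}
    (*-nonneg 0≤B (0≤/ d 0)) (0<1/ 0)
  N₂≤ : ∀ N₁ N₂ N₃ {k} → N₁ ℕ.⊔ (N₂ ℕ.⊔ N₃) ℕ.≤ k → N₂ ℕ.≤ k
  N₂≤ N₁ N₂ N₃ h = ℕP.m⊔n≤o⇒m≤o N₂ N₃ (ℕP.m⊔n≤o⇒n≤o N₁ (N₂ ℕ.⊔ N₃) h)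

opaque
  pow-cauchy : ∀ d .{{_ : ℕ.NonZero d}} x → Cauchy (powSeq d (seq x))
  pow-cauchy d x ε 0<ε =
    let N , h = powSeq-close d x ε 0<ε
    in N , λ m n N≤m N≤n → ∣p-q∣≤r (powSeq d (seq x) m) (powSeq d (seq x) n)
         (h m n N≤m N≤n) (h n m N≤n N≤m)

infixr 9 _^_

_^_ : (d : ℕ) .{{_ : ℕ.NonZero d}} → ℝ → ℝ
d ^ x = mkℝ (powSeq d (seq x)) (pow-cauchy d x)

record Graph (n : ℕ) : Set where
  field
    adj         : Fin n → Fin n → Bool
    adj-sym     : ∀ u v → adj u v ≡ adj v u
    adj-irrefl  : ∀ v → adj v v ≡ false

open Graph public

Adj : ∀ {n} → Graph n → Fin n → Fin n → Set
Adj X u v = T (adj X u v)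

data Walk {n} (X : Graph n) : Fin n → Fin n → ℕ → Set where
  []  : ∀ {v} → Walk X v v 0
  _∷_ : ∀ {u v w ℓ} → Adj X u v → Walk X v w ℓ → Walk X u w (suc ℓ)

Connected : ∀ {n} → Graph n → Set
Connected X = ∀ v w → ∃[ ℓ ] Walk X v w ℓ

Dist : ∀ {n} → Graph n → Fin n → Fin n → ℕ → Set
Dist X v w i = Walk X v w i × (∀ ℓ → Walk X v w ℓ → i ℕ.≤ ℓ)

HasDiameter : ∀ {n} → Graph n → ℕ → Set
HasDiameter X d =
  (∃[ v ] ∃[ w ] Dist X v w d) × (∀ v w i → Dist X v w i → i ℕ.≤ d)

Exactly : ∀ {n} → ℕ → (Fin n → Set) → Set
Exactly {n} m P = ∃[ S ] (∀ (u : Fin n) → u ∈ S ⇔ P u) × card S ≡ m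

record IsDistanceRegular {n} (X : Graph n) (d : ℕ) (a b c : Fin (suc d) → ℕ) : Set where
  field
    connected : Connected X
    diameter  : HasDiameter X d
    c-count   : ∀ i v w → Dist X v w (toℕ i) →
                Exactly (c i) (λ u → Adj X w u × ∃[ j ] suc j ≡ toℕ i × Dist X v u j)
    a-count   : ∀ i v w → Dist X v w (toℕ i) →
                Exactly (a i) (λ u → Adj X w u × Dist X v u (toℕ i))
    b-count   : ∀ i v w → Dist X v w (toℕ i) →
                Exactly (b i) (λ u → Adj X w u × Dist X v u (suc (toℕ i)))

Matrix : ℕ → Set
Matrix n = Fin n → Fin n → ℝ

adjacencyMatrix : ∀ {n} → Graph n → Matrix n
adjacencyMatrix X u v = if adj X u v then 1ℝ else 0ℝ

_·ᵥ_ : ∀ {n} → Matrix n → Vector ℝ n → Vector ℝ n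
(A ·ᵥ x) u = ∑ λ v → A u v * x v

LinearlyIndependent : ∀ {m n} → (Fin m → Vector ℝ n) → Set
LinearlyIndependent {m} x = ∀ (s : Fin m → ℝ) →
  (∀ u → ∑ (λ i → s i * x i u) ≈ 0ℝ) → ∀ i → s i ≈ 0ℝ

-- ξ lists the eigenvalues of A, with multiplicity, in non-increasing order.  For
-- symmetric A the multiplicity of an eigenvalue is the dimension of its eigenspace,
-- and the eigenspaces have a basis of ℝⁿ as their joint basis.
record IsSpectrum {n} (A : Matrix n) (ξ : Fin n → ℝ) : Set where
  field
    sorted       : ∀ i j → i Fin.≤ j → ξ j ≤ ξ i
    vectors      : Fin n → Vector ℝ n
    independent  : LinearlyIndependent vectors
    eigenvectors : ∀ i u → (A ·ᵥ vectors i) u ≈ ξ i * vectors i u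

-- ρ = max { ∣ξᵢ∣ : 2 ≤ i ≤ n } (indices start at 0 here)
IsZeroWeightSpectralRadius : ∀ {n} → Graph n → ℝ → Set
IsZeroWeightSpectralRadius {n} X ρ = ∃[ ξ ] IsSpectrum (adjacencyMatrix X) ξ
  × (∃[ i ] 1 ℕ.≤ toℕ i × ρ ≈ ∣ ξ i ∣)
  × (∀ (i : Fin n) → 1 ℕ.≤ toℕ i → ∣ ξ i ∣ ≤ ρ)

LargeIntersectionNumbers : ∀ {d} → ℝ → (b c : Fin (suc d) → ℕ) → Set
LargeIntersectionNumbers {d} ε b c = ∃[ i ]
  ε * fromℕ (b zero) ≤ fromℕ (b (inject₁ i)) × ε * fromℕ (b zero) ≤ fromℕ (c (suc {d} i))

-- X determines ρ up to _≈_.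
SpectralGap : ∀ {n} → ℝ → Graph n → (k : ℕ) → Set
SpectralGap η X k = ∀ ρ → IsZeroWeightSpectralRadius X ρ → ρ ≤ fromℕ k * (1ℝ - η)

-- The degree of X is k = b₀.
Dichotomy : ℕ → (ε η : ℝ) → Set
Dichotomy d ε η = ∀ {n} (X : Graph n) (a b c : Fin (suc d) → ℕ) →
  IsDistanceRegular X d a b c →
  LargeIntersectionNumbers ε b c ⊎ SpectralGap η X (b zero)

η₀ : (d : ℕ) .{{_ : ℕ.NonZero d}} → ℝ
η₀ d = fromℚ (+ 1 / 4) * d ^ (- (1ℝ + log₂ d))

ε₀ : (d : ℕ) .{{_ : ℕ.NonZero d}} → ℝ
ε₀ d = 200 ^ (- fromℕ (suc d)) * d ^ (- (fromℕ (suc d) * (log₂ d + fromℕ 3)))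

{-# OPTIONS --safe #-}
-- Let V i (s) be the sum of (x u - sⁱ x v)² over the pairs u, v at distance i, and N i the
-- number of such pairs.  The intersection numbers p¹ᵢⱼ of a distance-regular graph being
-- constant, the triangle inequality along geodesics gives N 1 · V i (s) ≤ i² · N i · V 1 (s)
-- for s = ± 1.  Summing over i with s = 1 is a Poincaré inequality: every eigenvalue but the
-- first is at most k (1 - 1/d²).  If some a m ≠ 0 then, with s = -1, closing two geodesics
-- of length m by an edge to an odd cycle gives 4 k ‖x‖² ≤ (2m + 1)² · V 1 (-1), so every
-- eigenvalue is at least -k (1 - 2/(2d + 1)²).  Both bounds are within k (1 - 1/(4d²)), and
-- η₀ d ≤ 1/(4d²).  If all a m vanish then b m + c m = k, and as b falls from k to 0 some
-- b i and c (i + 1) are both at least k/2.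
module Submission where

open import Defs
open import Data.Nat using (ℕ)
import Data.Nat as ℕ
open import Data.Product using (∃-syntax; _×_)
open import Algebra.Bundles using (CommutativeRing)
import Algebra.Properties.Semiring.Sum as SemiringSum
open import Data.Bool using (true; false; T; if_then_else_)
open import Data.Bool.Properties using (T?)
open import Data.Empty using (⊥; ⊥-elim)
open import Data.Fin using (Fin; zero; suc; toℕ; fromℕ<; inject₁)
import Data.Fin as Fin
open import Data.Fin.Induction using (<-weakInduction)
import Data.Fin.Properties as FinP
open import Data.Fin.Subset using (Subset; inside; outside) renaming (∣_∣ to card)
open import Data.Fin.Subset.Properties using (_∈?_; drop-there)
open import Data.Integer using (+_)
import Data.Integer as ℤ
import Data.Integer.Properties as ℤP
import Data.Integer.Solver as ℤSolver
open import Data.Nat using (zero; suc; pred)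
import Data.Nat.Properties as ℕP
import Data.Nat.Solver as ℕSolver
open import Data.Product using (Σ-syntax; _,_; proj₁; proj₂)
open import Data.Rational using (ℚ; 0ℚ; 1ℚ; ½; _/_; ↥_; ↧_; ↧ₙ_)
import Data.Rational as ℚ
import Data.Rational.Properties as ℚP
import Data.Rational.Solver as ℚSolver
import Data.Rational.Unnormalised as ℚᵘ
import Data.Rational.Unnormalised.Properties as ℚᵘP
open import Data.Sum using (_⊎_; inj₁; inj₂)
open import Data.Vec using ([]; _∷_; here; there)
open import Function using (_∘_)
open import Function.Bundles using (Equivalence)
open import Relation.Binary.Bundles using (Preorder)
open import Relation.Binary.Definitions using (tri<; tri≈; tri>)
open import Relation.Binary.PropositionalEquality
  using (_≡_; _≢_; refl; sym; trans; cong; cong₂; subst; subst₂)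
open import Relation.Nullary using (¬_; Dec; yes; no; does; ¬?)
open import Relation.Nullary.Decidable
  using (_×-dec_; map′; dec-true; dec-false; decidable-stable; from-no)
open import Relation.Unary using (Decidable)

-- Finite sums of rationals

-- The eigenvectors are real vectors, reachable only through rational approximations that are
-- neither exact eigenvectors nor exactly orthogonal to the constants. Each eigenvalue bound is
-- therefore first an inequality of quadratic forms valid for every rational vector, and passes to ℝ
-- term by term; the Poincaré side carries a multiple of the squared coordinate sum as error term.
-- The spectrum does not present a constant first eigenvector either: an eigenvector y of later
-- index is combined with the first one into a vector of coordinate sum 0, whose Rayleigh quotient
-- is still at least the eigenvalue of y.
--
-- Going from distance i to i + 1 appends one edge, and the constancy of the intersection numbers
-- spreads these edges evenly over the graph; counting the same triples by each of their three pairs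
-- then removes all intersection numbers from the inequality.
--
-- The order of ℝ is undecidable but stable under double negation, so the eigenvalue bounds go by
-- contradiction, while the case distinction of the theorem concerns only natural numbers.

module ℚΣ = SemiringSum (CommutativeRing.semiring ℚP.+-*-commutativeRing)

Σℚ : ∀ {n} → (Fin n → ℚ) → ℚ
Σℚ = ℚΣ.sum

Σ-cong : ∀ {n} {f g : Fin n → ℚ} → (∀ u → f u ≡ g u) → Σℚ f ≡ Σℚ g
Σ-cong = ℚΣ.sum-cong-≗

Σ-mono : ∀ {n} {f g : Fin n → ℚ} → (∀ u → f u ℚ.≤ g u) → Σℚ f ℚ.≤ Σℚ g
Σ-mono {zero}  h = ℚP.≤-refl
Σ-mono {suc n} h = ℚP.+-mono-≤ (h zero) (Σ-mono (h ∘ suc))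

Σ-zero : ∀ n → Σℚ {n} (λ _ → 0ℚ) ≡ 0ℚ
Σ-zero = ℚΣ.sum-replicate-zero

Σ-nonneg : ∀ {n} {f : Fin n → ℚ} → (∀ u → 0ℚ ℚ.≤ f u) → 0ℚ ℚ.≤ Σℚ f
Σ-nonneg {n} {f} h = subst (ℚ._≤ Σℚ f) (Σ-zero n) (Σ-mono h)

term≤Σ : ∀ {n} {f : Fin n → ℚ} → (∀ u → 0ℚ ℚ.≤ f u) → ∀ u → f u ℚ.≤ Σℚ f
term≤Σ {suc n} {f} h zero = ℚP.≤-trans (ℚP.≤-reflexive (sym (ℚP.+-identityʳ _)))
  (ℚP.+-monoʳ-≤ (f zero) (Σ-nonneg (h ∘ suc)))
term≤Σ {suc n} {f} h (suc u) = ℚP.≤-trans (term≤Σ (h ∘ suc) u)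
  (ℚP.≤-trans (ℚP.≤-reflexive (sym (ℚP.+-identityˡ _)))
    (ℚP.+-monoˡ-≤ (Σℚ (f ∘ suc)) (h zero)))

Σ-+ : ∀ {n} (f g : Fin n → ℚ) → Σℚ (λ u → f u ℚ.+ g u) ≡ Σℚ f ℚ.+ Σℚ g
Σ-+ = ℚΣ.∑-distrib-+

Σ-*ˡ : ∀ {n} r (f : Fin n → ℚ) → Σℚ (λ u → r ℚ.* f u) ≡ r ℚ.* Σℚ f
Σ-*ˡ r f = sym (ℚΣ.*-distribˡ-sum r f)

Σ-*ʳ : ∀ {n} r (f : Fin n → ℚ) → Σℚ (λ u → f u ℚ.* r) ≡ Σℚ f ℚ.* r
Σ-*ʳ r f = sym (ℚΣ.*-distribʳ-sum r f)

Σ-swap : ∀ {m n} (f : Fin m → Fin n → ℚ) →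
         Σℚ (λ u → Σℚ λ v → f u v) ≡ Σℚ (λ v → Σℚ λ u → f u v)
Σ-swap = ℚΣ.∑-comm

ι : ℕ → ℚ
ι n = + n / 1

ι-+ : ∀ m n → ι (m ℕ.+ n) ≡ ι m ℚ.+ ι n
ι-+ m n = sym (/-+ m n 0)

ι-* : ∀ m n → ι (m ℕ.* n) ≡ ι m ℚ.* ι n
ι-* m n = sym (/-* m 0 n 0)

ι-mono : ∀ {m n} → m ℕ.≤ n → ι m ℚ.≤ ι n
ι-mono {m} {n} h = /-mono {m} {1} {n} {1} (ℕP.*-monoˡ-≤ 1 h)

0≤ι : ∀ n → 0ℚ ℚ.≤ ι n
0≤ι n = 0≤/ n 0

0<1ℚ : 0ℚ ℚ.< 1ℚ
0<1ℚ = ℚP.positive⁻¹ 1ℚ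

0<ι : ∀ {n} → 0 ℕ.< n → 0ℚ ℚ.< ι n
0<ι h = ℚP.<-≤-trans 0<1ℚ (ι-mono h)

Σ-const : ∀ n r → Σℚ {n} (λ _ → r) ≡ ι n ℚ.* r
Σ-const zero    r = sym (ℚP.*-zeroˡ r)
Σ-const (suc n) r = trans (cong (r ℚ.+_) (Σ-const n r))
  (trans (solve 2 (λ n r → r :+ n :* r := (con 1ℚ :+ n) :* r) refl (ι n) r)
         (cong (ℚ._* r) (sym (ι-+ 1 n))))
  where open ℚSolver.+-*-Solver

≤-by-diff : ∀ {p q} r → 0ℚ ℚ.≤ r → q ≡ p ℚ.+ r → p ℚ.≤ q
≤-by-diff {p} r 0≤r refl = ℚP.≤-trans (ℚP.≤-reflexive (sym (ℚP.+-identityʳ p)))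
  (ℚP.+-monoʳ-≤ p 0≤r)

p≤q⇒0≤q-p : ∀ {p q} → p ℚ.≤ q → 0ℚ ℚ.≤ q ℚ.- p
p≤q⇒0≤q-p {p} {q} h = subst (ℚ._≤ q ℚ.- p) (ℚP.+-inverseʳ p) (ℚP.+-monoˡ-≤ (ℚ.- p) h)

0≤p² : ∀ p → 0ℚ ℚ.≤ p ℚ.* p
0≤p² p = subst (0ℚ ℚ.≤_) (eq (ℚP.∣p∣≡p∨∣p∣≡-p p))
           (*-nonneg (ℚP.0≤∣p∣ p) (ℚP.0≤∣p∣ p))
  where
  open ℚSolver.+-*-Solver
  eq : ℚ.∣ p ∣ ≡ p ⊎ ℚ.∣ p ∣ ≡ ℚ.- p → ℚ.∣ p ∣ ℚ.* ℚ.∣ p ∣ ≡ p ℚ.* p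
  eq (inj₁ e) = cong₂ ℚ._*_ e e
  eq (inj₂ e) = trans (cong₂ ℚ._*_ e e) (solve 1 (λ p → :- p :* :- p := p :* p) refl p)

*-cancel-≤ : ∀ r {p q} → 0ℚ ℚ.< r → r ℚ.* p ℚ.≤ r ℚ.* q → p ℚ.≤ q
*-cancel-≤ r 0<r = ℚP.*-cancelˡ-≤-pos r {{ℚ.positive 0<r}}

*-mono-≤ : ∀ r {p q} → 0ℚ ℚ.≤ r → p ℚ.≤ q → r ℚ.* p ℚ.≤ r ℚ.* q
*-mono-≤ r 0≤r = ℚP.*-monoˡ-≤-nonNeg r {{ℚ.nonNegative 0≤r}}

-- Indicators and counting

𝟙 : {P : Set} → Dec P → ℚ
𝟙 p? = if does p? then 1ℚ else 0ℚ

𝟙-true : {P : Set} (p? : Dec P) → P → 𝟙 p? ≡ 1ℚ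
𝟙-true p? p = cong (if_then 1ℚ else 0ℚ) (dec-true p? p)

𝟙-false : {P : Set} (p? : Dec P) → ¬ P → 𝟙 p? ≡ 0ℚ
𝟙-false p? ¬p = cong (if_then 1ℚ else 0ℚ) (dec-false p? ¬p)

𝟙-cong : {P Q : Set} (p? : Dec P) (q? : Dec Q) → (P → Q) → (Q → P) → 𝟙 p? ≡ 𝟙 q?
𝟙-cong (yes p) q? f g = sym (𝟙-true q? (f p))
𝟙-cong (no ¬p) q? f g = sym (𝟙-false q? (¬p ∘ g))

0≤𝟙 : {P : Set} (p? : Dec P) → 0ℚ ℚ.≤ 𝟙 p?
0≤𝟙 (yes _) = ℚP.<⇒≤ 0<1ℚ
0≤𝟙 (no _)  = ℚP.≤-refl

Σ-𝟙-∈ : ∀ {n} (S : Subset n) → Σℚ (λ u → 𝟙 (u ∈? S)) ≡ ι (card S)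
Σ-𝟙-∈ [] = refl
Σ-𝟙-∈ (s ∷ S) = trans
  (cong (𝟙 (zero ∈? (s ∷ S)) ℚ.+_)
    (trans (Σ-cong λ u → 𝟙-cong (suc u ∈? (s ∷ S)) (u ∈? S) drop-there there) (Σ-𝟙-∈ S)))
  (head s)
  where
  head : ∀ s → 𝟙 (zero ∈? (s ∷ S)) ℚ.+ ι (card S) ≡ ι (card (s ∷ S))
  head inside  = sym (ι-+ 1 (card S))
  head outside = ℚP.+-identityˡ (ι (card S))

-- The counted predicate P speaks of walks; an indicator needs a decision procedure, so P is traded
-- for an equivalent Q phrased with the distance function.
Exactly⇒Σ : ∀ {n m} {P Q : Fin n → Set} → Exactly m P → (Q? : Decidable Q) →
  (∀ u → P u → Q u) → (∀ u → Q u → P u) → Σℚ (λ u → 𝟙 (Q? u)) ≡ ι m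
Exactly⇒Σ (S , S⇔P , refl) Q? f g = trans
  (Σ-cong λ u → 𝟙-cong (Q? u) (u ∈? S) (from (S⇔P u) ∘ g u) (f u ∘ to (S⇔P u)))
  (Σ-𝟙-∈ S)
  where open Equivalence

Exactly-∅ : ∀ {n m} {P : Fin n → Set} → Exactly m P → (∀ u → ¬ P u) → ι m ≡ 0ℚ
Exactly-∅ {n} E ¬P = trans
  (sym (Exactly⇒Σ {Q = λ _ → ⊥} E (λ _ → no λ ()) ¬P (λ _ ())))
  (Σ-zero n)

-- Distance-regular graphs

least : ∀ {P : ℕ → Set} → Decidable P → ∀ n → P n → ∃[ m ] P m × (∀ j → P j → m ℕ.≤ j)
least {P} P? n p with P? 0
... | yes p₀ = 0 , p₀ , λ _ _ → ℕ.z≤n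
least P? zero p | no ¬p₀ = ⊥-elim (¬p₀ p)
least {P} P? (suc n) p | no ¬p₀ =
  let m , pm , min = least (P? ∘ suc) n p
  in suc m , pm , λ { zero p₀ → ⊥-elim (¬p₀ p₀) ; (suc j) pj → ℕ.s≤s (min j pj) }

module _ {n} (X : Graph n) where

  walk? : ∀ u v ℓ → Dec (Walk X u v ℓ)
  walk? u v zero = map′ (λ { refl → [] }) (λ { [] → refl }) (u Fin.≟ v)
  walk? u v (suc ℓ) = map′ (λ { (w , e , p) → e ∷ p }) (λ { (e ∷ p) → _ , e , p })
    (FinP.any? λ w → T? (adj X u w) ×-dec walk? w v ℓ)

  Adj-sym : ∀ {u v} → Adj X u v → Adj X v u
  Adj-sym {u} {v} = subst T (adj-sym X u v)

  _∷ʳ_ : ∀ {u v w ℓ} → Walk X u v ℓ → Adj X v w → Walk X u w (suc ℓ)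
  []      ∷ʳ e = e ∷ []
  (f ∷ p) ∷ʳ e = f ∷ (p ∷ʳ e)

  reverse : ∀ {u v ℓ} → Walk X u v ℓ → Walk X v u ℓ
  reverse []      = []
  reverse (e ∷ p) = reverse p ∷ʳ Adj-sym e

  Dist-unique : ∀ {u v i j} → Dist X u v i → Dist X u v j → i ≡ j
  Dist-unique (p , min) (q , min′) = ℕP.≤-antisym (min _ q) (min′ _ p)

  Dist-step : ∀ {u w i} → Dist X u w (suc i) → ∃[ v ] Adj X u v × Dist X v w i
  Dist-step (e ∷ p , min) = _ , e , p , λ ℓ q → ℕP.≤-pred (min _ (e ∷ q))

module Distance {n} (X : Graph n) (connected : Connected X) where

  opaque
    distance : ∀ u v → ∃[ i ] Dist X u v i
    distance u v = let ℓ , p = connected u v in least (walk? X u v) ℓ p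

  dist : Fin n → Fin n → ℕ
  dist u v = proj₁ (distance u v)

  Dist-dist : ∀ u v → Dist X u v (dist u v)
  Dist-dist u v = proj₂ (distance u v)

  Dist⇒dist≡ : ∀ {u v i} → Dist X u v i → dist u v ≡ i
  Dist⇒dist≡ {u} {v} D = Dist-unique X (Dist-dist u v) D

  dist≡⇒Dist : ∀ {u v i} → dist u v ≡ i → Dist X u v i
  dist≡⇒Dist {u} {v} eq = subst (Dist X u v) eq (Dist-dist u v)

  walk⇒dist≤ : ∀ {u v ℓ} → Walk X u v ℓ → dist u v ℕ.≤ ℓ
  walk⇒dist≤ {u} {v} p = proj₂ (Dist-dist u v) _ p

  dist-refl : ∀ u → dist u u ≡ 0
  dist-refl u = ℕP.n≤0⇒n≡0 (walk⇒dist≤ [])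

  dist≡0⇒≡ : ∀ {u v} → dist u v ≡ 0 → u ≡ v
  dist≡0⇒≡ {u} {v} eq with dist≡⇒Dist {u} {v} eq
  ... | [] , _ = refl

  dist-sym : ∀ u v → dist u v ≡ dist v u
  dist-sym u v = ℕP.≤-antisym
    (walk⇒dist≤ (reverse X (proj₁ (Dist-dist v u))))
    (walk⇒dist≤ (reverse X (proj₁ (Dist-dist u v))))

  dist-stepʳ : ∀ u {v w} → Adj X v w → dist u w ℕ.≤ suc (dist u v)
  dist-stepʳ u {v} e = walk⇒dist≤ (_∷ʳ_ X (proj₁ (Dist-dist u v)) e)

  Adj⇒dist≡1 : ∀ {u v} → Adj X u v → dist u v ≡ 1
  Adj⇒dist≡1 {u} {v} e with dist u v in eq
  ... | 0 = ⊥-elim (subst T (trans (cong (adj X u) (sym (dist≡0⇒≡ eq))) (adj-irrefl X u)) e)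
  ... | 1 = refl
  ... | suc (suc i) = ⊥-elim (2+i≰1 (subst (ℕ._≤ 1) eq (walk⇒dist≤ (e ∷ []))))
    where
    2+i≰1 : ∀ {i} → ¬ (suc (suc i) ℕ.≤ 1)
    2+i≰1 (ℕ.s≤s ())

  dist≡1⇒Adj : ∀ {u v} → dist u v ≡ 1 → Adj X u v
  dist≡1⇒Adj {u} {v} eq with dist≡⇒Dist {u} {v} eq
  ... | e ∷ [] , _ = e

  -- The i-th distance matrix; `δ 1` is the adjacency matrix.
  δ : ℕ → Fin n → Fin n → ℚ
  δ i u v = 𝟙 (dist u v ℕ.≟ i)

  δ-sym : ∀ i u v → δ i u v ≡ δ i v u
  δ-sym i u v = cong (λ e → 𝟙 (e ℕ.≟ i)) (dist-sym u v)

  0≤δ : ∀ i u v → 0ℚ ℚ.≤ δ i u v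
  0≤δ i u v = 0≤𝟙 (dist u v ℕ.≟ i)

  δ-subst : ∀ (f : ℕ → ℚ) i u v → δ i u v ℚ.* f (dist u v) ≡ δ i u v ℚ.* f i
  δ-subst f i u v = case (dist u v ℕ.≟ i)
    where
    case : (p? : Dec (dist u v ≡ i)) → 𝟙 p? ℚ.* f (dist u v) ≡ 𝟙 p? ℚ.* f i
    case (yes eq) = cong (λ e → 1ℚ ℚ.* f e) eq
    case (no  _)  = trans (ℚP.*-zeroˡ (f (dist u v))) (sym (ℚP.*-zeroˡ (f i)))

module Regular {n d} (X : Graph n) {a b c : Fin (suc d) → ℕ}
               (reg : IsDistanceRegular X d a b c) where

  open IsDistanceRegular reg
  open Distance X connected public

  dist≤d : ∀ u v → dist u v ℕ.≤ d
  dist≤d u v = proj₂ diameter u v _ (Dist-dist u v)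

  -- Outside 0 ≤ i ≤ d the values are chosen so that the recurrence δ-recurrence holds
  -- and γ (suc i) stays positive.
  extend : ℚ → (Fin (suc d) → ℕ) → ℕ → ℚ
  extend r f h with h ℕ.<? suc d
  ... | yes h< = ι (f (fromℕ< h<))
  ... | no  _  = r

  α β γ : ℕ → ℚ
  α = extend 0ℚ a
  β = extend 0ℚ b
  γ = extend 1ℚ c

  extend-toℕ : ∀ r f i → extend r f (toℕ i) ≡ ι (f i)
  extend-toℕ r f i with toℕ i ℕ.<? suc d
  ... | yes i< = cong (ι ∘ f) (FinP.fromℕ<-toℕ i i<)
  ... | no  i≮ = ⊥-elim (i≮ (FinP.toℕ<n i))

  -- One argument for a, b and c: since `dist v w` is at most d, it is an index at which the
  -- counting hypothesis applies.
  count : ∀ r (f : Fin (suc d) → ℕ) (P : Fin (suc d) → Fin n → Fin n → Fin n → Set)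
    (Q : ℕ → Fin n → Fin n → Fin n → Set) (Q? : ∀ h v w → Decidable (Q h v w)) →
    (∀ i v w → Dist X v w (toℕ i) → Exactly (f i) (P i v w)) →
    (∀ i v w u → P i v w u → Q (toℕ i) v w u) → (∀ i v w u → Q (toℕ i) v w u → P i v w u) →
    ∀ v w → Σℚ (λ u → 𝟙 (Q? (dist v w) v w u)) ≡ extend r f (dist v w)
  count r f P Q Q? E to from v w =
    subst (λ h → Σℚ (λ u → 𝟙 (Q? h v w u)) ≡ extend r f h) toℕi
      (trans (Exactly⇒Σ (E i v w (dist≡⇒Dist (sym toℕi))) (Q? (toℕ i) v w) (to i v w) (from i v w))
             (sym (extend-toℕ r f i)))
    where
    i = fromℕ< (ℕ.s≤s (dist≤d v w))
    toℕi : toℕ i ≡ dist v w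
    toℕi = FinP.toℕ-fromℕ< (ℕ.s≤s (dist≤d v w))

  c? : ∀ h v w → Decidable (λ u → dist w u ≡ 1 × suc (dist v u) ≡ h)
  c? h v w u = (dist w u ℕ.≟ 1) ×-dec (suc (dist v u) ℕ.≟ h)

  a? : ∀ h v w → Decidable (λ u → dist w u ≡ 1 × dist v u ≡ h)
  a? h v w u = (dist w u ℕ.≟ 1) ×-dec (dist v u ℕ.≟ h)

  b? : ∀ h v w → Decidable (λ u → dist w u ≡ 1 × dist v u ≡ suc h)
  b? h v w u = (dist w u ℕ.≟ 1) ×-dec (dist v u ℕ.≟ suc h)

  γ-count : ∀ v w → Σℚ (λ u → 𝟙 (c? (dist v w) v w u)) ≡ γ (dist v w)
  γ-count = count 1ℚ c _ _ c? c-count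
    (λ { _ _ _ _ (e , j , eq , D) → Adj⇒dist≡1 e , trans (cong suc (Dist⇒dist≡ D)) eq })
    (λ _ v _ u (e , eq) → dist≡1⇒Adj e , dist v u , eq , Dist-dist v u)

  α-count : ∀ v w → Σℚ (λ u → 𝟙 (a? (dist v w) v w u)) ≡ α (dist v w)
  α-count = count 0ℚ a _ _ a? a-count
    (λ _ _ _ _ (e , D) → Adj⇒dist≡1 e , Dist⇒dist≡ D)
    (λ _ _ _ _ (e , eq) → dist≡1⇒Adj e , dist≡⇒Dist eq)

  β-count : ∀ v w → Σℚ (λ u → 𝟙 (b? (dist v w) v w u)) ≡ β (dist v w)
  β-count = count 0ℚ b _ _ b? b-count
    (λ _ _ _ _ (e , D) → Adj⇒dist≡1 e , Dist⇒dist≡ D)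
    (λ _ _ _ _ (e , eq) → dist≡1⇒Adj e , dist≡⇒Dist eq)

  -- The adjacency operator on functions of the distance, that is, the tridiagonal intersection
  -- matrix. At h = 0 the value `pred 0` is harmless because `γ 0` is 0.
  step : (ℕ → ℚ) → ℕ → ℚ
  step g h = (γ h ℚ.* g (pred h) ℚ.+ α h ℚ.* g h) ℚ.+ β h ℚ.* g (suc h)

  -- The distances from v to two adjacent vertices differ by at most 1, so for a neighbour u of w
  -- exactly one of the three indicators is 1. Otherwise both sides are 0.
  neighbour-split : ∀ (g : ℕ → ℚ) v w u → let h = dist v w in
    δ 1 w u ℚ.* g (dist v u) ≡
    (𝟙 (c? h v w u) ℚ.* g (pred h) ℚ.+ 𝟙 (a? h v w u) ℚ.* g h)
      ℚ.+ 𝟙 (b? h v w u) ℚ.* g (suc h)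
  neighbour-split g v w u = split (dist w u ℕ.≟ 1)
    where
    open ℚSolver.+-*-Solver
    h = dist v w
    j = dist v u
    split : (p? : Dec (dist w u ≡ 1)) → 𝟙 p? ℚ.* g j ≡
      (𝟙 (p? ×-dec (suc j ℕ.≟ h)) ℚ.* g (pred h) ℚ.+ 𝟙 (p? ×-dec (j ℕ.≟ h)) ℚ.* g h)
        ℚ.+ 𝟙 (p? ×-dec (j ℕ.≟ suc h)) ℚ.* g (suc h)
    split (no _) = solve 4 (λ x y z t → con 0ℚ :* x :=
      (con 0ℚ :* y :+ con 0ℚ :* z) :+ con 0ℚ :* t) refl
      (g j) (g (pred h)) (g h) (g (suc h))
    split (yes e) = cases h j
        (dist-stepʳ v (dist≡1⇒Adj e)) (dist-stepʳ v (Adj-sym X (dist≡1⇒Adj e)))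
      where
      cases : ∀ h j → j ℕ.≤ suc h → h ℕ.≤ suc j → 1ℚ ℚ.* g j ≡
        (𝟙 (suc j ℕ.≟ h) ℚ.* g (pred h) ℚ.+ 𝟙 (j ℕ.≟ h) ℚ.* g h) ℚ.+ 𝟙 (j ℕ.≟ suc h) ℚ.* g (suc h)
      cases h j j≤ h≤ with ℕP.<-cmp h j
      ... | tri< h<j ¬eq _ with ℕP.≤-antisym j≤ h<j
      ... | refl rewrite 𝟙-false (suc (suc h) ℕ.≟ h) (ℕP.<⇒≢ (ℕP.m<n⇒m<1+n (ℕP.n<1+n h)) ∘ sym)
                       | 𝟙-false (suc h ℕ.≟ h) (¬eq ∘ sym) | 𝟙-true (suc h ℕ.≟ suc h) refl =
        solve 3 (λ x y z → con 1ℚ :* z := (con 0ℚ :* x :+ con 0ℚ :* y) :+ con 1ℚ :* z) refl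
          (g (pred h)) (g h) (g (suc h))
      cases h j j≤ h≤ | tri≈ _ refl _
        rewrite 𝟙-false (suc h ℕ.≟ h) (ℕP.<⇒≢ (ℕP.n<1+n h) ∘ sym)
              | 𝟙-true (h ℕ.≟ h) refl | 𝟙-false (h ℕ.≟ suc h) (ℕP.<⇒≢ (ℕP.n<1+n h)) =
        solve 3 (λ x y z → con 1ℚ :* y := (con 0ℚ :* x :+ con 1ℚ :* y) :+ con 0ℚ :* z) refl
          (g (pred h)) (g h) (g (suc h))
      cases h j j≤ h≤ | tri> _ ¬eq j<h with ℕP.≤-antisym h≤ j<h
      ... | refl rewrite 𝟙-true (suc j ℕ.≟ suc j) refl | 𝟙-false (j ℕ.≟ suc j) (¬eq ∘ sym)
                       | 𝟙-false (j ℕ.≟ suc (suc j)) (ℕP.<⇒≢ (ℕP.m<n⇒m<1+n (ℕP.n<1+n j))) =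
        solve 3 (λ x y z → con 1ℚ :* x := (con 1ℚ :* x :+ con 0ℚ :* y) :+ con 0ℚ :* z) refl
          (g j) (g (suc j)) (g (suc (suc j)))

  Σ-neighbours : ∀ g v w → Σℚ (λ u → δ 1 w u ℚ.* g (dist v u)) ≡ step g (dist v w)
  Σ-neighbours g v w = trans (Σ-cong (neighbour-split g v w))
    (trans (Σ-+ (λ u → 𝟙 (c? h v w u) ℚ.* g (pred h) ℚ.+ 𝟙 (a? h v w u) ℚ.* g h)
                (λ u → 𝟙 (b? h v w u) ℚ.* g (suc h)))
    (cong₂ ℚ._+_
      (trans (Σ-+ (λ u → 𝟙 (c? h v w u) ℚ.* g (pred h)) (λ u → 𝟙 (a? h v w u) ℚ.* g h))
        (cong₂ ℚ._+_
          (trans (Σ-*ʳ (g (pred h)) (λ u → 𝟙 (c? h v w u))) (cong (ℚ._* g (pred h)) (γ-count v w)))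
          (trans (Σ-*ʳ (g h) (λ u → 𝟙 (a? h v w u))) (cong (ℚ._* g h) (α-count v w)))))
      (trans (Σ-*ʳ (g (suc h)) (λ u → 𝟙 (b? h v w u))) (cong (ℚ._* g (suc h)) (β-count v w)))))
    where h = dist v w

  vertex : Fin n
  vertex = proj₁ (proj₁ diameter)

  -- Moving one end of a diametral pair along a geodesic lowers the distance to the other end by 1
  -- at a time, so every distance up to d occurs.
  pair-at-distance : ∀ i → i ℕ.≤ d → ∃[ v ] ∃[ w ] dist v w ≡ i
  pair-at-distance i i≤d =
    let v , w , D = proj₁ diameter ; v′ , D′ = go d i≤d D in v′ , w , Dist⇒dist≡ D′
    where
    go : ∀ {v w} m → i ℕ.≤ m → Dist X v w m → ∃[ v′ ] Dist X v′ w i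
    go {v} m i≤m D with i ℕ.≟ m
    ... | yes refl = v , D
    go zero    i≤m D | no i≢m = ⊥-elim (i≢m (ℕP.n≤0⇒n≡0 i≤m))
    go (suc m) i≤m D | no i≢m = let _ , _ , D′ = Dist-step X D in go m (ℕP.≤-pred (ℕP.≤∧≢⇒< i≤m i≢m)) D′

Σ-single : ∀ {n} (f : Fin n → ℚ) i → (∀ j → j ≢ i → f j ≡ 0ℚ) → Σℚ f ≡ f i
Σ-single {suc n} f zero h = trans
  (cong (f zero ℚ.+_) (trans (Σ-cong λ j → h (suc j) λ ()) (Σ-zero n)))
  (ℚP.+-identityʳ (f zero))
Σ-single f (suc i) h = trans
  (cong₂ ℚ._+_ (h zero λ ()) (Σ-single (f ∘ suc) i λ j j≢i → h (suc j) (j≢i ∘ FinP.suc-injective)))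
  (ℚP.+-identityˡ (f (suc i)))

-- The profile of `δ i` as a function of the distance.
𝕀 : ℕ → ℕ → ℚ
𝕀 i h = 𝟙 (h ℕ.≟ i)

-- Radial matrices and the constancy of the intersection numbers

module Radial {n d} (X : Graph n) {a b c : Fin (suc d) → ℕ}
              (reg : IsDistanceRegular X d a b c) where

  open IsDistanceRegular reg
  open Regular X reg public

  γ₀ : γ 0 ≡ 0ℚ
  γ₀ = trans (extend-toℕ 1ℚ c zero)
    (Exactly-∅ (c-count zero vertex vertex (dist≡⇒Dist (dist-refl vertex)))
      λ { u (_ , _ , () , _) })

  α₀ : α 0 ≡ 0ℚ
  α₀ = trans (extend-toℕ 0ℚ a zero)
    (Exactly-∅ (a-count zero vertex vertex (dist≡⇒Dist (dist-refl vertex)))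
      λ u (e , D) → ℕP.1+n≢0 (trans (sym (Adj⇒dist≡1 e)) (Dist⇒dist≡ D)))

  k : ℚ
  k = ι (b zero)

  β₀ : β 0 ≡ k
  β₀ = extend-toℕ 0ℚ b zero

  -- Up to d, the first step of a geodesic from w to v is among the counted neighbours; beyond d the
  -- default value is 1. Positivity permits solving the recurrence of the distance matrices for its
  -- highest term.
  0<γ : ∀ i → 0ℚ ℚ.< γ (suc i)
  0<γ i = case (suc i ℕ.≤? d)
    where
    case : Dec (suc i ℕ.≤ d) → 0ℚ ℚ.< γ (suc i)
    case (yes i≤d) = ℚP.<-≤-trans 0<1ℚ (subst (1ℚ ℚ.≤_)
        (trans (γ-count v w) (cong γ eq))
        (subst (ℚ._≤ Σℚ λ u → 𝟙 (c? (dist v w) v w u)) (𝟙-true (c? (dist v w) v w u) (Adj⇒dist≡1 e , trans (cong suc vu) (sym eq)))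
          (term≤Σ (λ u → 0≤𝟙 (c? (dist v w) v w u)) u)))
      where
      pair = pair-at-distance (suc i) i≤d
      v = proj₁ pair
      w = proj₁ (proj₂ pair)
      eq : dist v w ≡ suc i
      eq = proj₂ (proj₂ pair)
      next = Dist-step X (dist≡⇒Dist (trans (dist-sym w v) eq))
      u = proj₁ next
      e = proj₁ (proj₂ next)
      vu : dist v u ≡ i
      vu = trans (dist-sym v u) (Dist⇒dist≡ (proj₂ (proj₂ next)))
    case (no i≰d) with suc i ℕ.<? suc d
    ... | yes i<  = ⊥-elim (i≰d (ℕP.≤-pred i<))
    ... | no  _   = 0<1ℚ

  extend-nonneg : ∀ {r} f → 0ℚ ℚ.≤ r → ∀ i → 0ℚ ℚ.≤ extend r f i
  extend-nonneg f 0≤r i with i ℕ.<? suc d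
  ... | yes i< = 0≤ι (f (fromℕ< i<))
  ... | no  _  = 0≤r

  step-nonneg : ∀ {g} → (∀ h → 0ℚ ℚ.≤ g h) → ∀ h → 0ℚ ℚ.≤ step g h
  step-nonneg {g} 0≤g h = +-nonneg {γ h ℚ.* g (pred h) ℚ.+ α h ℚ.* g h}
    (+-nonneg {γ h ℚ.* g (pred h)}
      (*-nonneg (extend-nonneg c (ℚP.<⇒≤ 0<1ℚ) h) (0≤g (pred h)))
      (*-nonneg (extend-nonneg a ℚP.≤-refl h) (0≤g h)))
    (*-nonneg (extend-nonneg b ℚP.≤-refl h) (0≤g (suc h)))

  -- The lowest term of the three-term recurrence, of index i - 1, read as 0 for i = 0.
  previous : ℕ → ℕ → ℚ
  previous zero    h = 0ℚ
  previous (suc i) h = β i ℚ.* 𝕀 i h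

  step-𝕀 : ∀ i h → step (𝕀 i) h ≡
    (γ (suc i) ℚ.* 𝕀 (suc i) h ℚ.+ α i ℚ.* 𝕀 i h) ℚ.+ previous i h
  step-𝕀 i h = cong₂ ℚ._+_ (cong₂ ℚ._+_ (lower h) (middle (h ℕ.≟ i))) (upper i)
    where
    lower : ∀ h → γ h ℚ.* 𝕀 i (pred h) ≡ γ (suc i) ℚ.* 𝕀 (suc i) h
    -- Since `pred 0` is 0, the indicator is 1 here when i = 0; it is `γ₀` that makes the term
    -- vanish.
    lower zero = trans (cong (ℚ._* 𝕀 i 0) γ₀)
      (trans (ℚP.*-zeroˡ (𝕀 i 0)) (sym (ℚP.*-zeroʳ (γ (suc i)))))
    lower (suc h) = trans (case (h ℕ.≟ i))
      (cong (γ (suc i) ℚ.*_) (𝟙-cong (h ℕ.≟ i) (suc h ℕ.≟ suc i) (cong suc) ℕP.suc-injective))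
      where
      case : (p? : Dec (h ≡ i)) → γ (suc h) ℚ.* 𝟙 p? ≡ γ (suc i) ℚ.* 𝟙 p?
      case (yes refl) = refl
      case (no _)     = trans (ℚP.*-zeroʳ (γ (suc h))) (sym (ℚP.*-zeroʳ (γ (suc i))))
    middle : (p? : Dec (h ≡ i)) → α h ℚ.* 𝟙 p? ≡ α i ℚ.* 𝟙 p?
    middle (yes refl) = refl
    middle (no _)     = trans (ℚP.*-zeroʳ (α h)) (sym (ℚP.*-zeroʳ (α i)))
    upper : ∀ i → β h ℚ.* 𝕀 i (suc h) ≡ previous i h
    upper zero = ℚP.*-zeroʳ (β h)
    upper (suc i) = trans
      (cong (β h ℚ.*_) (𝟙-cong (suc h ℕ.≟ suc i) (h ℕ.≟ i) ℕP.suc-injective (cong suc)))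
      (case (h ℕ.≟ i))
      where
      case : (p? : Dec (h ≡ i)) → β h ℚ.* 𝟙 p? ≡ β i ℚ.* 𝟙 p?
      case (yes refl) = refl
      case (no _)     = trans (ℚP.*-zeroʳ (β h)) (sym (ℚP.*-zeroʳ (β i)))

  infixl 7 _⊗_
  _⊗_ : (M N : Fin n → Fin n → ℚ) → Fin n → Fin n → ℚ
  (M ⊗ N) u v = Σℚ λ z → M u z ℚ.* N z v

  -- The span of the distance matrices, known as the Bose-Mesner algebra once it is closed under
  -- products. The profile g is kept as data because later constants are its values.
  Radial : (Fin n → Fin n → ℚ) → Set
  Radial M = Σ[ g ∈ (ℕ → ℚ) ] (∀ u v → M u v ≡ g (dist u v))

  Σ-neighbours′ : ∀ g u v → Σℚ (λ z → δ 1 u z ℚ.* g (dist z v)) ≡ step g (dist u v)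
  Σ-neighbours′ g u v = trans
    (Σ-cong λ z → cong (λ h → δ 1 u z ℚ.* g h) (dist-sym z v))
    (trans (Σ-neighbours g v u) (cong (step g) (dist-sym v u)))

  -- The three-term recurrence of the distance matrices; solved for the term of index i + 1 it makes
  -- each of them a polynomial in `δ 1`.
  δ-recurrence : ∀ i u v → (δ 1 ⊗ δ i) u v ≡
    (γ (suc i) ℚ.* δ (suc i) u v ℚ.+ α i ℚ.* δ i u v) ℚ.+ previous i (dist u v)
  δ-recurrence i u v = trans (Σ-neighbours′ (𝕀 i) u v) (step-𝕀 i (dist u v))

  radial-δ₁ : ∀ {M} → Radial M → Radial (δ 1 ⊗ M)
  radial-δ₁ {M} (g , M≡g) = step g , λ u v →
    trans (Σ-cong λ z → cong (δ 1 u z ℚ.*_) (M≡g z v)) (Σ-neighbours′ g u v)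

  ⊗-δ₀ : ∀ M u v → (δ 0 ⊗ M) u v ≡ M u v
  ⊗-δ₀ M u v = trans
    (Σ-single (λ z → δ 0 u z ℚ.* M z v) u λ z z≢u → trans
      (cong (ℚ._* M z v) (𝟙-false (dist u z ℕ.≟ 0) (z≢u ∘ sym ∘ dist≡0⇒≡)))
      (ℚP.*-zeroˡ (M z v)))
    (trans (cong (ℚ._* M u v) (𝟙-true (dist u u ℕ.≟ 0) (dist-refl u))) (ℚP.*-identityˡ (M u v)))

  ⊗-assoc : ∀ L M N u v → (L ⊗ (M ⊗ N)) u v ≡ ((L ⊗ M) ⊗ N) u v
  ⊗-assoc L M N u v = trans
    (Σ-cong λ z → trans (sym (Σ-*ˡ (L u z) (λ y → M z y ℚ.* N y v)))
      (Σ-cong λ y → sym (ℚP.*-assoc (L u z) (M z y) (N y v))))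
    (trans (Σ-swap λ z y → L u z ℚ.* M z y ℚ.* N y v)
      (Σ-cong λ y → Σ-*ʳ (N y v) (λ z → L u z ℚ.* M z y)))

  -- For M = δ j this is the constancy of the intersection numbers pʰᵢⱼ.
  mutual
    radial-δ : ∀ i {M} → Radial M → Radial (δ i ⊗ M)
    radial-δ zero    {M} (g , M≡g) = g , λ u v → trans (⊗-δ₀ M u v) (M≡g u v)
    radial-δ (suc i) {M} R =
      -- Multiplying the recurrence by M on the right expresses `γ (suc i)` times the wanted product
      -- through products that are radial by induction; r is the inverse of `γ (suc i)`.
      let g₁ , eq₁ = radial-δ₁ {δ i ⊗ M} (radial-δ i {M} R)
          g₂ , eq₂ = radial-δ i {M} R
          g₃ , eq₃ = radial-previous i {M} R
          r , _ , γr≡1 = 1/pos (0<γ i)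
      in (λ h → r ℚ.* (g₁ h ℚ.- α i ℚ.* g₂ h ℚ.- g₃ h)) , λ u v →
         solution r γr≡1 u v (eq₁ u v) (eq₂ u v) (eq₃ u v)
      where
      open ℚSolver.+-*-Solver
      expand : ∀ u v → (δ 1 ⊗ (δ i ⊗ M)) u v ≡
        (γ (suc i) ℚ.* (δ (suc i) ⊗ M) u v ℚ.+ α i ℚ.* (δ i ⊗ M) u v)
          ℚ.+ ((λ y z → previous i (dist y z)) ⊗ M) u v
      expand u v = trans (⊗-assoc (δ 1) (δ i) M u v)
        (trans (Σ-cong λ y → trans (cong (ℚ._* M y v) (δ-recurrence i u y))
          (solve 6 (λ c x a y p m → ((c :* x :+ a :* y) :+ p) :* m
                     := (c :* (x :* m) :+ a :* (y :* m)) :+ p :* m) refl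
            (γ (suc i)) (δ (suc i) u y) (α i) (δ i u y) (previous i (dist u y)) (M y v)))
        (trans (Σ-+ (λ y → γ (suc i) ℚ.* (δ (suc i) u y ℚ.* M y v) ℚ.+ α i ℚ.* (δ i u y ℚ.* M y v))
                    (λ y → previous i (dist u y) ℚ.* M y v))
        (cong (ℚ._+ Σℚ λ y → previous i (dist u y) ℚ.* M y v)
          (trans (Σ-+ (λ y → γ (suc i) ℚ.* (δ (suc i) u y ℚ.* M y v))
                      (λ y → α i ℚ.* (δ i u y ℚ.* M y v)))
            (cong₂ ℚ._+_ (Σ-*ˡ (γ (suc i)) (λ y → δ (suc i) u y ℚ.* M y v))
                         (Σ-*ˡ (α i) (λ y → δ i u y ℚ.* M y v)))))))

      solution : ∀ r → γ (suc i) ℚ.* r ≡ 1ℚ → ∀ u v {x y z} → (δ 1 ⊗ (δ i ⊗ M)) u v ≡ x →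
        (δ i ⊗ M) u v ≡ y → ((λ y z → previous i (dist y z)) ⊗ M) u v ≡ z →
        (δ (suc i) ⊗ M) u v ≡ r ℚ.* (x ℚ.- α i ℚ.* y ℚ.- z)
      solution r γr≡1 u v refl refl refl = sym (trans
        (cong (λ x → r ℚ.* (x ℚ.- α i ℚ.* (δ i ⊗ M) u v
                              ℚ.- ((λ y z → previous i (dist y z)) ⊗ M) u v)) (expand u v))
        (trans (solve 6 (λ r c m a y p → r :* ((c :* m :+ a :* y) :+ p :- a :* y :- p)
                          := (c :* r) :* m) refl
                 r (γ (suc i)) ((δ (suc i) ⊗ M) u v) (α i) ((δ i ⊗ M) u v)
                 (((λ y z → previous i (dist y z)) ⊗ M) u v))
        (trans (cong (ℚ._* (δ (suc i) ⊗ M) u v) γr≡1) (ℚP.*-identityˡ _))))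

    radial-previous : ∀ i {M} → Radial M → Radial ((λ y z → previous i (dist y z)) ⊗ M)
    radial-previous zero {M} R = (λ _ → 0ℚ) , λ u v →
      trans (Σ-cong λ z → ℚP.*-zeroˡ (M z v)) (Σ-zero n)
    radial-previous (suc i) {M} R = let g , eq = radial-δ i {M} R in
      (λ h → β i ℚ.* g h) , λ u v → trans
        (Σ-cong λ z → ℚP.*-assoc (β i) (δ i u z) (M z v))
        (trans (Σ-*ˡ (β i) (λ z → δ i u z ℚ.* M z v)) (cong (β i ℚ.*_) (eq u v)))

  -- Row sums are the entries of the product with the all-ones matrix, which is radial; on the
  -- diagonal the profile is read at 0.
  sphere-size : ∀ i → ∃[ κ ] ∀ u → Σℚ (λ v → δ i u v) ≡ κ
  sphere-size i = let g , eq = radial-δ i {λ _ _ → 1ℚ} ((λ _ → 1ℚ) , λ _ _ → refl) in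
    g 0 , λ u → trans (Σ-cong λ v → sym (ℚP.*-identityʳ (δ i u v)))
                (trans (eq u u) (cong g (dist-refl u)))

  -- Double counting: an edge v w seen from a third vertex u

  pairs : ℕ → (Fin n → Fin n → ℚ) → ℚ
  pairs i φ = Σℚ λ u → Σℚ λ v → δ i u v ℚ.* φ u v

  triple : ℕ → ℕ → Fin n → Fin n → Fin n → ℚ
  triple i j u v w = δ i u v ℚ.* (δ 1 v w ℚ.* δ j u w)

  triples : ℕ → ℕ → (Fin n → Fin n → Fin n → ℚ) → ℚ
  triples i j ψ = Σℚ λ u → Σℚ λ v → Σℚ λ w → triple i j u v w ℚ.* ψ u v w

  triples-mono : ∀ i j {ψ χ} → (∀ u v w → ψ u v w ℚ.≤ χ u v w) → triples i j ψ ℚ.≤ triples i j χ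
  triples-mono i j h = Σ-mono λ u → Σ-mono λ v → Σ-mono λ w →
    *-mono-≤ (triple i j u v w)
      (*-nonneg (0≤δ i u v) (*-nonneg (0≤δ 1 v w) (0≤δ j u w))) (h u v w)

  triples-+ : ∀ i j ψ χ → triples i j (λ u v w → ψ u v w ℚ.+ χ u v w) ≡
              triples i j ψ ℚ.+ triples i j χ
  triples-+ i j ψ χ = trans
    (Σ-cong λ u → trans
      (Σ-cong λ v → trans
        (Σ-cong λ w → ℚP.*-distribˡ-+ (triple i j u v w) (ψ u v w) (χ u v w))
        (Σ-+ (λ w → triple i j u v w ℚ.* ψ u v w) (λ w → triple i j u v w ℚ.* χ u v w)))
      (Σ-+ (λ v → Σℚ λ w → triple i j u v w ℚ.* ψ u v w) _))
    (Σ-+ (λ u → Σℚ λ v → Σℚ λ w → triple i j u v w ℚ.* ψ u v w) _)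

  triples-* : ∀ i j r ψ → triples i j (λ u v w → r ℚ.* ψ u v w) ≡ r ℚ.* triples i j ψ
  triples-* i j r ψ = trans
    (Σ-cong λ u → trans
      (Σ-cong λ v → trans
        (Σ-cong λ w → solve 3 (λ t r x → t :* (r :* x) := r :* (t :* x)) refl
          (triple i j u v w) r (ψ u v w))
        (Σ-*ˡ r (λ w → triple i j u v w ℚ.* ψ u v w)))
      (Σ-*ˡ r (λ v → Σℚ λ w → triple i j u v w ℚ.* ψ u v w)))
    (Σ-*ˡ r (λ u → Σℚ λ v → Σℚ λ w → triple i j u v w ℚ.* ψ u v w))
    where open ℚSolver.+-*-Solver

  -- For fixed u and v at distance i, the number of possible w is `step (𝕀 j) i`, which is c, a or b
  -- of index i when j is i - 1, i or i + 1.
  triples₁₂ : ∀ i j φ → triples i j (λ u v _ → φ u v) ≡ step (𝕀 j) i ℚ.* pairs i φ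
  triples₁₂ i j φ = trans
    (Σ-cong λ u → trans
      (Σ-cong λ v → inner u v)
      (Σ-*ˡ (step (𝕀 j) i) (λ v → δ i u v ℚ.* φ u v)))
    (Σ-*ˡ (step (𝕀 j) i) (λ u → Σℚ λ v → δ i u v ℚ.* φ u v))
    where
    open ℚSolver.+-*-Solver
    inner : ∀ u v → Σℚ (λ w → triple i j u v w ℚ.* φ u v) ≡
            step (𝕀 j) i ℚ.* (δ i u v ℚ.* φ u v)
    inner u v = trans (Σ-*ʳ (φ u v) (triple i j u v))
      (trans (cong (ℚ._* φ u v) (trans (Σ-*ˡ (δ i u v) (λ w → δ 1 v w ℚ.* δ j u w))
        (trans (cong (δ i u v ℚ.*_) (Σ-neighbours (𝕀 j) u v)) (δ-subst (step (𝕀 j)) i u v))))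
      (solve 3 (λ x y z → x :* y :* z := y :* (x :* z)) refl (δ i u v) (step (𝕀 j) i) (φ u v)))

  triples₁₃ : ∀ i j φ → triples i j (λ u _ w → φ u w) ≡ step (𝕀 i) j ℚ.* pairs j φ
  triples₁₃ i j φ = trans
    (Σ-cong λ u → trans
      (Σ-swap λ v w → triple i j u v w ℚ.* φ u w)
      (Σ-cong λ w → Σ-cong λ v → cong (ℚ._* φ u w) (trans
        (cong (λ e → δ i u v ℚ.* (e ℚ.* δ j u w)) (δ-sym 1 v w))
        (solve 3 (λ x y z → x :* (y :* z) := z :* (y :* x)) refl (δ i u v) (δ 1 w v) (δ j u w)))))
    (triples₁₂ j i φ)
    where open ℚSolver.+-*-Solver

  -- The number of vertices u seeing a given edge at distances i and j is the profile of `δ i ⊗ δ j`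
  -- at 1, hence the same for all edges. Its value π is eliminated later by taking φ = 1.
  triples₂₃ : ∀ i j → ∃[ π ] ∀ φ → triples i j (λ _ v w → φ v w) ≡ π ℚ.* pairs 1 φ
  triples₂₃ i j =
    let g , eq = radial-δ i {δ j} (𝕀 j , λ _ _ → refl) in g 1 , λ φ → trans
      (trans (Σ-swap λ u v → Σℚ λ w → triple i j u v w ℚ.* φ v w)
        (Σ-cong λ v → Σ-swap λ u w → triple i j u v w ℚ.* φ v w))
      (trans (Σ-cong λ v → trans (Σ-cong λ w → inner φ g eq v w)
        (Σ-*ˡ (g 1) (λ w → δ 1 v w ℚ.* φ v w)))
      (Σ-*ˡ (g 1) (λ v → Σℚ λ w → δ 1 v w ℚ.* φ v w)))
    where
    open ℚSolver.+-*-Solver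
    inner : ∀ φ g → (∀ u v → (δ i ⊗ δ j) u v ≡ g (dist u v)) → ∀ v w →
      Σℚ (λ u → triple i j u v w ℚ.* φ v w) ≡ g 1 ℚ.* (δ 1 v w ℚ.* φ v w)
    inner φ g eq v w = trans
      (Σ-cong λ u → trans
        (cong (λ e → e ℚ.* (δ 1 v w ℚ.* δ j u w) ℚ.* φ v w) (δ-sym i u v))
        (solve 4 (λ x y z t → x :* (y :* z) :* t := (y :* t) :* (x :* z)) refl
          (δ i v u) (δ 1 v w) (δ j u w) (φ v w)))
      (trans (Σ-*ˡ (δ 1 v w ℚ.* φ v w) (λ u → δ i v u ℚ.* δ j u w))
      (trans (cong (δ 1 v w ℚ.* φ v w ℚ.*_) (eq v w))
      (trans (solve 3 (λ x y z → x :* y :* z := (x :* z) :* y) refl (δ 1 v w) (φ v w) (g (dist v w)))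
      (trans (cong (ℚ._* φ v w) (δ-subst g 1 v w))
      (solve 3 (λ x y z → x :* z :* y := z :* (x :* y)) refl (δ 1 v w) (φ v w) (g 1))))))

-- The variation of a vector over the distance classes

-- Cauchy-Schwarz with weights m and 1, multiplied by m to avoid division; the two sides differ by
-- (p - m q)². Equality at p = m q is what turns the factor i² into exactly (i + 1)².
cauchy₂ : ∀ m p q → m ℚ.* ((p ℚ.+ q) ℚ.* (p ℚ.+ q)) ℚ.≤
  (1ℚ ℚ.+ m) ℚ.* (p ℚ.* p) ℚ.+ m ℚ.* (1ℚ ℚ.+ m) ℚ.* (q ℚ.* q)
cauchy₂ m p q = ≤-by-diff ((p ℚ.- m ℚ.* q) ℚ.* (p ℚ.- m ℚ.* q)) (0≤p² (p ℚ.- m ℚ.* q))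
  (solve 3 (λ m p q → (con 1ℚ :+ m) :* (p :* p) :+ m :* (con 1ℚ :+ m) :* (q :* q)
      := m :* ((p :+ q) :* (p :+ q)) :+ (p :- m :* q) :* (p :- m :* q)) refl m p q)
  where open ℚSolver.+-*-Solver

-- Cauchy-Schwarz with weights m, m and 1, for two arcs of m edges and one closing edge; hence the
-- factor 2m + 1.
cauchy₃ : ∀ m p q r → 0ℚ ℚ.≤ m →
  m ℚ.* ((p ℚ.+ q ℚ.+ r) ℚ.* (p ℚ.+ q ℚ.+ r)) ℚ.≤
  (1ℚ ℚ.+ m ℚ.+ m) ℚ.* (p ℚ.* p ℚ.+ q ℚ.* q ℚ.+ m ℚ.* (r ℚ.* r))
cauchy₃ m p q r 0≤m = ≤-by-diff
  (m ℚ.* ((p ℚ.- q) ℚ.* (p ℚ.- q)) ℚ.+ (p ℚ.- m ℚ.* r) ℚ.* (p ℚ.- m ℚ.* r)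
    ℚ.+ (q ℚ.- m ℚ.* r) ℚ.* (q ℚ.- m ℚ.* r))
  (+-nonneg {m ℚ.* ((p ℚ.- q) ℚ.* (p ℚ.- q)) ℚ.+ (p ℚ.- m ℚ.* r) ℚ.* (p ℚ.- m ℚ.* r)}
    (+-nonneg {m ℚ.* ((p ℚ.- q) ℚ.* (p ℚ.- q))}
      (*-nonneg 0≤m (0≤p² (p ℚ.- q))) (0≤p² (p ℚ.- m ℚ.* r)))
    (0≤p² (q ℚ.- m ℚ.* r)))
  (solve 4 (λ m p q r →
      (con 1ℚ :+ m :+ m) :* (p :* p :+ q :* q :+ m :* (r :* r))
      := m :* ((p :+ q :+ r) :* (p :+ q :+ r)) :+
         (m :* ((p :- q) :* (p :- q)) :+ (p :- m :* r) :* (p :- m :* r)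
          :+ (q :- m :* r) :* (q :- m :* r))) refl m p q r)
  where open ℚSolver.+-*-Solver

module Variation {n d} (X : Graph n) {a b c : Fin (suc d) → ℕ}
  (reg : IsDistanceRegular X d a b c)
  (s : ℚ) (s²≡1 : s ℚ.* s ≡ 1ℚ) (x : Fin n → ℚ) where

  open Radial X reg

  sign : ℕ → ℚ
  sign zero    = 1ℚ
  sign (suc i) = s ℚ.* sign i

  sign² : ∀ i → sign i ℚ.* sign i ≡ 1ℚ
  sign² zero = refl
  sign² (suc i) = trans
    (solve 2 (λ s p → (s :* p) :* (s :* p) := (s :* s) :* (p :* p)) refl s (sign i))
    (cong₂ ℚ._*_ s²≡1 (sign² i))
    where open ℚSolver.+-*-Solver

  sq : ℕ → Fin n → Fin n → ℚ
  sq i u v = (x u ℚ.- sign i ℚ.* x v) ℚ.* (x u ℚ.- sign i ℚ.* x v)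

  0≤sq : ∀ i u v → 0ℚ ℚ.≤ sq i u v
  0≤sq i u v = 0≤p² (x u ℚ.- sign i ℚ.* x v)

  V N : ℕ → ℚ
  V i = pairs i (sq i)
  N i = pairs i (λ _ _ → 1ℚ)

  0≤V : ∀ i → 0ℚ ℚ.≤ V i
  0≤V i = Σ-nonneg λ u → Σ-nonneg λ v → *-nonneg (0≤δ i u v) (0≤sq i u v)

  0≤N : ∀ i → 0ℚ ℚ.≤ N i
  0≤N i = Σ-nonneg λ u → Σ-nonneg λ v → *-nonneg (0≤δ i u v) (ℚP.<⇒≤ 0<1ℚ)

  V₀ : V 0 ≡ 0ℚ
  V₀ = trans (Σ-cong λ u → trans (Σ-cong λ v → zero-term u v (dist u v ℕ.≟ 0)) (Σ-zero n)) (Σ-zero n)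
    where
    open ℚSolver.+-*-Solver
    zero-term : ∀ u v (p? : Dec (dist u v ≡ 0)) → 𝟙 p? ℚ.* sq 0 u v ≡ 0ℚ
    zero-term u v (no _) = ℚP.*-zeroˡ (sq 0 u v)
    zero-term u v (yes eq) with refl ← dist≡0⇒≡ {u} {v} eq =
      solve 1 (λ x → con 1ℚ :* ((x :- con 1ℚ :* x) :* (x :- con 1ℚ :* x)) := con 0ℚ) refl (x u)

  sq-sign : ∀ p v w → p ℚ.* p ≡ 1ℚ →
    let e = x v ℚ.- sign 1 ℚ.* x w in (p ℚ.* e) ℚ.* (p ℚ.* e) ≡ sq 1 v w
  sq-sign p v w p²≡1 = trans
    (solve 2 (λ p e → (p :* e) :* (p :* e) := (p :* p) :* (e :* e)) refl
      p (x v ℚ.- sign 1 ℚ.* x w))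
    (trans (cong (ℚ._* sq 1 v w) p²≡1) (ℚP.*-identityˡ (sq 1 v w)))
    where open ℚSolver.+-*-Solver

  -- With p = sⁱ, the telescoping x u - s p x w = (x u - p x v) + p (x v - s x w) is put into
  -- `cauchy₂`, and p² = 1 clears the sign of the last edge.
  sq-step : ∀ i u v w → ι i ℚ.* sq (suc i) u w ℚ.≤
    (1ℚ ℚ.+ ι i) ℚ.* sq i u v ℚ.+ ι i ℚ.* (1ℚ ℚ.+ ι i) ℚ.* sq 1 v w
  sq-step i u v w = subst₂ ℚ._≤_
    (cong (ι i ℚ.*_) (solve 5 (λ xu xv xw p s →
      ((xu :- p :* xv) :+ p :* (xv :- (s :* con 1ℚ) :* xw)) :*
      ((xu :- p :* xv) :+ p :* (xv :- (s :* con 1ℚ) :* xw))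
      := (xu :- (s :* p) :* xw) :* (xu :- (s :* p) :* xw)) refl
      (x u) (x v) (x w) (sign i) s))
    (cong (λ e → (1ℚ ℚ.+ ι i) ℚ.* sq i u v ℚ.+ ι i ℚ.* (1ℚ ℚ.+ ι i) ℚ.* e)
      (sq-sign (sign i) v w (sign² i)))
    (cauchy₂ (ι i) (x u ℚ.- sign i ℚ.* x v) (sign i ℚ.* (x v ℚ.- sign 1 ℚ.* x w)))
    where open ℚSolver.+-*-Solver

  step-𝕀-self : ∀ i → step (𝕀 i) (suc i) ≡ γ (suc i)
  step-𝕀-self i
    rewrite 𝟙-true (i ℕ.≟ i) refl
          | 𝟙-false (suc i ℕ.≟ i) (ℕP.<⇒≢ (ℕP.n<1+n i) ∘ sym)
          | 𝟙-false (suc (suc i) ℕ.≟ i) (ℕP.<⇒≢ (ℕP.m<n⇒m<1+n (ℕP.n<1+n i)) ∘ sym) =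
    solve 3 (λ c a b → (c :* con 1ℚ :+ a :* con 0ℚ) :+ b :* con 0ℚ := c) refl
      (γ (suc i)) (α (suc i)) (β (suc i))
    where open ℚSolver.+-*-Solver

  0≤𝕀 : ∀ i h → 0ℚ ℚ.≤ 𝕀 i h
  0≤𝕀 i h = 0≤𝟙 (h ℕ.≟ i)

  -- The triangle inequality in L², over the triples with v and w adjacent, v at distance
  -- i and w at distance i + 1 from u.
  V-bound : ∀ i → N 1 ℚ.* V i ℚ.≤ ι i ℚ.* ι i ℚ.* (N i ℚ.* V 1)
  V-bound zero = ℚP.≤-reflexive (trans (cong (N 1 ℚ.*_) V₀) (trans (ℚP.*-zeroʳ (N 1))
    (sym (trans (cong (ℚ._* (N 0 ℚ.* V 1)) (ℚP.*-zeroˡ 0ℚ)) (ℚP.*-zeroˡ (N 0 ℚ.* V 1))))))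
  -- A second base case: passing from i to i + 1 cancels the weight i, which would be 0 here.
  V-bound (suc zero) = ℚP.≤-reflexive (sym (ℚP.*-identityˡ (N 1 ℚ.* V 1)))
  V-bound (suc i@(suc i′)) = *-cancel-≤ (m ℚ.* C) (*-pos (0<ι {suc i′} (ℕ.s≤s ℕ.z≤n)) 0<C) (begin
    m ℚ.* C ℚ.* (N 1 ℚ.* V (suc i))
      ≡⟨ solve 4 (λ m c n v → m :* c :* (n :* v) := n :* (m :* (c :* v))) refl m C (N 1) (V (suc i)) ⟩
    N 1 ℚ.* (m ℚ.* (C ℚ.* V (suc i)))
      ≤⟨ *-mono-≤ (N 1) (0≤N 1) summed ⟩
    N 1 ℚ.* ((1ℚ ℚ.+ m) ℚ.* (B ℚ.* V i) ℚ.+ m ℚ.* (1ℚ ℚ.+ m) ℚ.* (π ℚ.* V 1))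
      ≡⟨ solve 6 (λ n m b v p w → n :* ((con 1ℚ :+ m) :* (b :* v) :+ m :* (con 1ℚ :+ m) :* (p :* w))
           := ((con 1ℚ :+ m) :* b) :* (n :* v) :+ m :* (con 1ℚ :+ m) :* (p :* n :* w)) refl
           (N 1) m B (V i) π (V 1) ⟩
    (1ℚ ℚ.+ m) ℚ.* B ℚ.* (N 1 ℚ.* V i) ℚ.+ m ℚ.* (1ℚ ℚ.+ m) ℚ.* (π ℚ.* N 1 ℚ.* V 1)
      ≤⟨ ℚP.+-monoˡ-≤ (m ℚ.* (1ℚ ℚ.+ m) ℚ.* (π ℚ.* N 1 ℚ.* V 1))
           (*-mono-≤ ((1ℚ ℚ.+ m) ℚ.* B)
             (*-nonneg {1ℚ ℚ.+ m} (+-nonneg {1ℚ} (ℚP.<⇒≤ 0<1ℚ) (0≤ι i)) 0≤B) (V-bound i)) ⟩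
    (1ℚ ℚ.+ m) ℚ.* B ℚ.* (m ℚ.* m ℚ.* (N i ℚ.* V 1)) ℚ.+ m ℚ.* (1ℚ ℚ.+ m) ℚ.* (π ℚ.* N 1 ℚ.* V 1)
      ≡⟨ solve 5 (λ m b n w e → (con 1ℚ :+ m) :* b :* (m :* m :* (n :* w)) :+ m :* (con 1ℚ :+ m) :* (e :* w)
           := (con 1ℚ :+ m) :* (m :* m :* (b :* n :* w)) :+ m :* (con 1ℚ :+ m) :* (e :* w)) refl
           m B (N i) (V 1) (π ℚ.* N 1) ⟩
    (1ℚ ℚ.+ m) ℚ.* (m ℚ.* m ℚ.* (B ℚ.* N i ℚ.* V 1)) ℚ.+ m ℚ.* (1ℚ ℚ.+ m) ℚ.* (π ℚ.* N 1 ℚ.* V 1)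
      -- The three counts of the triples agree: B N i = π N 1 = C N (i + 1). Everything becomes a
      -- multiple of m C, and (1 + m) m² + m (1 + m) = m (1 + m)².
      ≡⟨ cong₂ (λ e f → (1ℚ ℚ.+ m) ℚ.* (m ℚ.* m ℚ.* (e ℚ.* V 1)) ℚ.+ m ℚ.* (1ℚ ℚ.+ m) ℚ.* (f ℚ.* V 1))
           (trans B≡π (sym C≡π)) (sym C≡π) ⟩
    (1ℚ ℚ.+ m) ℚ.* (m ℚ.* m ℚ.* (C ℚ.* N (suc i) ℚ.* V 1))
      ℚ.+ m ℚ.* (1ℚ ℚ.+ m) ℚ.* (C ℚ.* N (suc i) ℚ.* V 1)
      ≡⟨ solve 4 (λ m c n w → (con 1ℚ :+ m) :* (m :* m :* (c :* n :* w)) :+ m :* (con 1ℚ :+ m) :* (c :* n :* w)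
           := m :* c :* ((con 1ℚ :+ m) :* (con 1ℚ :+ m) :* (n :* w))) refl m C (N (suc i)) (V 1) ⟩
    m ℚ.* C ℚ.* ((1ℚ ℚ.+ m) ℚ.* (1ℚ ℚ.+ m) ℚ.* (N (suc i) ℚ.* V 1))
      ≡⟨ cong (λ e → m ℚ.* C ℚ.* (e ℚ.* e ℚ.* (N (suc i) ℚ.* V 1))) (ι-+ 1 i) ⟨
    m ℚ.* C ℚ.* (ι (suc i) ℚ.* ι (suc i) ℚ.* (N (suc i) ℚ.* V 1)) ∎)
    where
    open ℚP.≤-Reasoning
    open ℚSolver.+-*-Solver
    m = ι i
    B = step (𝕀 (suc i)) i
    C = step (𝕀 i) (suc i)
    edges = triples₂₃ i (suc i)
    π = proj₁ edges
    0<C : 0ℚ ℚ.< C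
    0<C = subst (0ℚ ℚ.<_) (sym (step-𝕀-self i)) (0<γ i)
    0≤B : 0ℚ ℚ.≤ B
    0≤B = step-nonneg (0≤𝕀 (suc i)) i
    B≡π : B ℚ.* N i ≡ π ℚ.* N 1
    B≡π = trans (sym (triples₁₂ i (suc i) (λ _ _ → 1ℚ))) (proj₂ edges (λ _ _ → 1ℚ))
    C≡π : C ℚ.* N (suc i) ≡ π ℚ.* N 1
    C≡π = trans (sym (triples₁₃ i (suc i) (λ _ _ → 1ℚ))) (proj₂ edges (λ _ _ → 1ℚ))
    summed : m ℚ.* (C ℚ.* V (suc i)) ℚ.≤
      (1ℚ ℚ.+ m) ℚ.* (B ℚ.* V i) ℚ.+ m ℚ.* (1ℚ ℚ.+ m) ℚ.* (π ℚ.* V 1)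
    summed = subst₂ ℚ._≤_
      (trans (triples-* i (suc i) m (λ u _ w → sq (suc i) u w))
        (cong (m ℚ.*_) (triples₁₃ i (suc i) (sq (suc i)))))
      (trans (triples-+ i (suc i) (λ u v _ → (1ℚ ℚ.+ m) ℚ.* sq i u v)
                                  (λ _ v w → m ℚ.* (1ℚ ℚ.+ m) ℚ.* sq 1 v w))
        (cong₂ ℚ._+_
          (trans (triples-* i (suc i) (1ℚ ℚ.+ m) (λ u v _ → sq i u v))
            (cong ((1ℚ ℚ.+ m) ℚ.*_) (triples₁₂ i (suc i) (sq i))))
          (trans (triples-* i (suc i) (m ℚ.* (1ℚ ℚ.+ m)) (λ _ v w → sq 1 v w))
            (cong (m ℚ.* (1ℚ ℚ.+ m) ℚ.*_) (proj₂ edges (sq 1))))))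
      (triples-mono i (suc i) {λ u _ w → m ℚ.* sq (suc i) u w} (sq-step i))

  degree : ∀ u → Σℚ (λ v → δ 1 u v) ≡ k
  degree u = trans (Σ-cong λ v → sym (ℚP.*-identityʳ (δ 1 u v)))
    (trans (Σ-neighbours (λ _ → 1ℚ) u u)
    (trans (cong (step (λ _ → 1ℚ)) (dist-refl u))
    (trans (cong₂ (λ y z → (y ℚ.* 1ℚ ℚ.+ z ℚ.* 1ℚ) ℚ.+ β 0 ℚ.* 1ℚ) γ₀ α₀)
    (trans (ℚP.+-identityˡ (β 0 ℚ.* 1ℚ)) (trans (ℚP.*-identityʳ (β 0)) β₀)))))

  ‖x‖² ⟨x,Ax⟩ : ℚ
  ‖x‖² = Σℚ λ u → x u ℚ.* x u
  ⟨x,Ax⟩ = Σℚ λ u → x u ℚ.* Σℚ λ v → δ 1 u v ℚ.* x v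

  pairs-constˡ : ∀ i κ → (∀ u → Σℚ (λ v → δ i u v) ≡ κ) → ∀ f →
    pairs i (λ u _ → f u) ≡ κ ℚ.* Σℚ f
  pairs-constˡ i κ eq f = trans
    (Σ-cong λ u → trans (Σ-*ʳ (f u) (λ v → δ i u v)) (cong (ℚ._* f u) (eq u)))
    (Σ-*ˡ κ f)

  N₁ : N 1 ≡ k ℚ.* ι n
  N₁ = trans (pairs-constˡ 1 k degree (λ _ → 1ℚ))
    (cong (k ℚ.*_) (trans (Σ-const n 1ℚ) (ℚP.*-identityʳ (ι n))))

  -- Expanding the square, both square terms have row sums k, and s² = 1. For s = 1 and s = -1 this
  -- is twice the form of the Laplacian and of the signless Laplacian, each edge being counted in
  -- both directions.
  V₁ : V 1 ≡ (k ℚ.* ‖x‖² ℚ.- s ℚ.* ⟨x,Ax⟩) ℚ.+ (k ℚ.* ‖x‖² ℚ.- s ℚ.* ⟨x,Ax⟩)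
  V₁ = trans
    (Σ-cong λ u → trans (Σ-cong λ v → expand u v)
      (trans (Σ-+ (λ v → δ 1 u v ℚ.* (x u ℚ.* x u) ℚ.+ δ 1 u v ℚ.* (x v ℚ.* x v))
                  (λ v → t ℚ.* (x u ℚ.* (δ 1 u v ℚ.* x v))))
        (cong₂ ℚ._+_
          (Σ-+ (λ v → δ 1 u v ℚ.* (x u ℚ.* x u)) (λ v → δ 1 u v ℚ.* (x v ℚ.* x v)))
          (trans (Σ-*ˡ t (λ v → x u ℚ.* (δ 1 u v ℚ.* x v)))
                 (cong (t ℚ.*_) (Σ-*ˡ (x u) (λ v → δ 1 u v ℚ.* x v)))))))
    (trans (Σ-+ (λ u → Σℚ (λ v → δ 1 u v ℚ.* (x u ℚ.* x u)) ℚ.+ Σℚ (λ v → δ 1 u v ℚ.* (x v ℚ.* x v)))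
                (λ u → t ℚ.* (x u ℚ.* Σℚ λ v → δ 1 u v ℚ.* x v)))
    (trans (cong₂ ℚ._+_
      (trans (Σ-+ (λ u → Σℚ (λ v → δ 1 u v ℚ.* (x u ℚ.* x u))) (λ u → Σℚ (λ v → δ 1 u v ℚ.* (x v ℚ.* x v))))
        (cong₂ ℚ._+_ (pairs-constˡ 1 k degree (λ u → x u ℚ.* x u))
          (trans (Σ-swap λ u v → δ 1 u v ℚ.* (x v ℚ.* x v))
            (trans (Σ-cong λ v → Σ-cong λ u → cong (ℚ._* (x v ℚ.* x v)) (δ-sym 1 u v))
              (pairs-constˡ 1 k degree (λ u → x u ℚ.* x u))))))
      (Σ-*ˡ t (λ u → x u ℚ.* Σℚ λ v → δ 1 u v ℚ.* x v)))
    (solve 3 (λ q s e → (q :+ q) :+ :- (s :+ s) :* e := (q :- s :* e) :+ (q :- s :* e)) refl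
      (k ℚ.* ‖x‖²) s ⟨x,Ax⟩)))
    where
    open ℚSolver.+-*-Solver
    t = ℚ.- (s ℚ.+ s)
    expand : ∀ u v → δ 1 u v ℚ.* sq 1 u v ≡
      (δ 1 u v ℚ.* (x u ℚ.* x u) ℚ.+ δ 1 u v ℚ.* (x v ℚ.* x v))
        ℚ.+ t ℚ.* (x u ℚ.* (δ 1 u v ℚ.* x v))
    expand u v = trans
      (solve 4 (λ e y z s → e :* ((y :- s :* con 1ℚ :* z) :* (y :- s :* con 1ℚ :* z)) :=
         (e :* (y :* y) :+ (s :* s) :* (e :* (z :* z))) :+ :- (s :+ s) :* (y :* (e :* z))) refl
         (δ 1 u v) (x u) (x v) s)
      (cong (λ r → (δ 1 u v ℚ.* (x u ℚ.* x u) ℚ.+ r) ℚ.+ t ℚ.* (x u ℚ.* (δ 1 u v ℚ.* x v)))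
        (trans (cong (ℚ._* (δ 1 u v ℚ.* (x v ℚ.* x v))) s²≡1)
               (ℚP.*-identityˡ (δ 1 u v ℚ.* (x v ℚ.* x v)))))

-- The Poincaré and odd-cycle inequalities for rational vectors

module QuadraticForm {n d} (X : Graph n) {a b c : Fin (suc d) → ℕ}
  (reg : IsDistanceRegular X d a b c) where

  open Radial X reg

  norm² form total : (Fin n → ℚ) → ℚ
  norm² x = Σℚ λ u → x u ℚ.* x u
  form  x = Σℚ λ u → x u ℚ.* Σℚ λ v → δ 1 u v ℚ.* x v
  total x = Σℚ x

  0<n : 0ℚ ℚ.< ι n
  0<n = 0<ι (ℕP.≤-<-trans ℕ.z≤n (FinP.toℕ<n vertex))

  0≤k : 0ℚ ℚ.≤ k
  0≤k = 0≤ι (b zero)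

  D : ℚ
  D = ι d

  -- The distance classes 0 to d partition the ordered pairs.
  Σ-pairs : ∀ φ → Σℚ (λ (i : Fin (suc d)) → pairs (toℕ i) φ) ≡ Σℚ λ u → Σℚ λ v → φ u v
  Σ-pairs φ = trans (Σ-swap λ (i : Fin (suc d)) u → Σℚ λ v → δ (toℕ i) u v ℚ.* φ u v)
    (Σ-cong λ u → trans (Σ-swap λ (i : Fin (suc d)) v → δ (toℕ i) u v ℚ.* φ u v)
      (Σ-cong λ v → trans
        (Σ-single (λ (i : Fin (suc d)) → δ (toℕ i) u v ℚ.* φ u v) (index u v) λ j j≢ → trans
          (cong (ℚ._* φ u v) (𝟙-false (dist u v ℕ.≟ toℕ j)
            λ eq → j≢ (FinP.toℕ-injective (trans (sym eq) (sym (toℕ-index u v))))))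
          (ℚP.*-zeroˡ (φ u v)))
        (trans (cong (ℚ._* φ u v) (𝟙-true (dist u v ℕ.≟ toℕ (index u v)) (sym (toℕ-index u v))))
               (ℚP.*-identityˡ (φ u v)))))
    where
    index : ∀ u v → Fin (suc d)
    index u v = fromℕ< (ℕ.s≤s (dist≤d u v))
    toℕ-index : ∀ u v → toℕ (index u v) ≡ dist u v
    toℕ-index u v = FinP.toℕ-fromℕ< (ℕ.s≤s (dist≤d u v))

  -- The variance identity. The factor `1ℚ` stands for `sign 0`, so that the summand is literally
  -- `sq 0`.
  Σ-differences : ∀ x → Σℚ (λ u → Σℚ λ v → (x u ℚ.- 1ℚ ℚ.* x v) ℚ.* (x u ℚ.- 1ℚ ℚ.* x v)) ≡
    (ι n ℚ.* norm² x ℚ.- total x ℚ.* total x) ℚ.+ (ι n ℚ.* norm² x ℚ.- total x ℚ.* total x)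
  Σ-differences x = trans
    (Σ-cong λ u → trans (Σ-cong λ v → expand u v)
      (trans (Σ-+ (λ v → x u ℚ.* x u ℚ.+ x v ℚ.* x v) (λ v → t ℚ.* x u ℚ.* x v))
        (cong₂ ℚ._+_
          (trans (Σ-+ (λ _ → x u ℚ.* x u) (λ v → x v ℚ.* x v))
                 (cong (ℚ._+ norm² x) (Σ-const n (x u ℚ.* x u))))
          (Σ-*ˡ (t ℚ.* x u) x))))
    (trans (Σ-+ (λ u → ι n ℚ.* (x u ℚ.* x u) ℚ.+ norm² x) (λ u → t ℚ.* x u ℚ.* total x))
    (trans (cong₂ ℚ._+_
      (trans (Σ-+ (λ u → ι n ℚ.* (x u ℚ.* x u)) (λ _ → norm² x))
        (cong₂ ℚ._+_ (Σ-*ˡ (ι n) (λ u → x u ℚ.* x u)) (Σ-const n (norm² x))))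
      (trans (Σ-*ʳ (total x) (λ u → t ℚ.* x u)) (cong (ℚ._* total x) (Σ-*ˡ t x))))
    (solve 3 (λ n q S → (n :* q :+ n :* q) :+ :- (con 1ℚ :+ con 1ℚ) :* S :* S
        := (n :* q :- S :* S) :+ (n :* q :- S :* S)) refl (ι n) (norm² x) (total x))))
    where
    open ℚSolver.+-*-Solver
    t = ℚ.- (1ℚ ℚ.+ 1ℚ)
    expand : ∀ u v → (x u ℚ.- 1ℚ ℚ.* x v) ℚ.* (x u ℚ.- 1ℚ ℚ.* x v) ≡
      (x u ℚ.* x u ℚ.+ x v ℚ.* x v) ℚ.+ t ℚ.* x u ℚ.* x v
    expand u v = solve 2 (λ y z → (y :- con 1ℚ :* z) :* (y :- con 1ℚ :* z)
      := (y :* y :+ z :* z) :+ :- (con 1ℚ :+ con 1ℚ) :* y :* z) refl (x u) (x v)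

  -- `V-bound` summed over all radii with i enlarged to D: the left side becomes the variance over
  -- all pairs, and the N i add up to n². For coordinate sum 0 it reads form x ≤ k (1 - 1/D²) ‖x‖².
  poincaré : ∀ x → k ℚ.* (ι n ℚ.* norm² x ℚ.- total x ℚ.* total x) ℚ.≤
    D ℚ.* D ℚ.* ι n ℚ.* (k ℚ.* norm² x ℚ.- form x)
  poincaré x = *-cancel-≤ (ι n ℚ.+ ι n) (ℚP.+-mono-< 0<n 0<n) (begin
    (ι n ℚ.+ ι n) ℚ.* (k ℚ.* W)
      ≡⟨ solve 3 (λ n k w → (n :+ n) :* (k :* w) := (k :* n) :* (w :+ w)) refl (ι n) k W ⟩
    (k ℚ.* ι n) ℚ.* (W ℚ.+ W)
      ≡⟨ cong₂ ℚ._*_ N₁ (trans (Σ-cong λ (i : Fin (suc d)) → pairs-sq (toℕ i)) (trans (Σ-pairs (sq 0)) (Σ-differences x))) ⟨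
    N 1 ℚ.* Σℚ (λ (i : Fin (suc d)) → V (toℕ i))
      ≡⟨ Σ-*ˡ (N 1) (λ (i : Fin (suc d)) → V (toℕ i)) ⟨
    Σℚ (λ (i : Fin (suc d)) → N 1 ℚ.* V (toℕ i))
      ≤⟨ Σ-mono bound ⟩
    Σℚ (λ (i : Fin (suc d)) → D ℚ.* D ℚ.* (N (toℕ i) ℚ.* V 1))
      ≡⟨ trans (Σ-*ˡ (D ℚ.* D) (λ (i : Fin (suc d)) → N (toℕ i) ℚ.* V 1))
           (cong (D ℚ.* D ℚ.*_) (Σ-*ʳ (V 1) (λ (i : Fin (suc d)) → N (toℕ i)))) ⟩
    D ℚ.* D ℚ.* (Σℚ (λ (i : Fin (suc d)) → N (toℕ i)) ℚ.* V 1)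
      ≡⟨ cong₂ (λ e f → D ℚ.* D ℚ.* (e ℚ.* f)) ΣN V₁ ⟩
    D ℚ.* D ℚ.* (ι n ℚ.* (ι n ℚ.* 1ℚ) ℚ.* ((k ℚ.* norm² x ℚ.- 1ℚ ℚ.* form x)
                                 ℚ.+ (k ℚ.* norm² x ℚ.- 1ℚ ℚ.* form x)))
      ≡⟨ solve 4 (λ D n q e → D :* D :* (n :* (n :* con 1ℚ) :* ((q :- con 1ℚ :* e) :+ (q :- con 1ℚ :* e)))
           := (n :+ n) :* (D :* D :* n :* (q :- e))) refl D (ι n) (k ℚ.* norm² x) (form x) ⟩
    (ι n ℚ.+ ι n) ℚ.* (D ℚ.* D ℚ.* ι n ℚ.* (k ℚ.* norm² x ℚ.- form x)) ∎)
    where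
    open ℚP.≤-Reasoning
    open ℚSolver.+-*-Solver
    open Variation X reg 1ℚ refl x
    W = ι n ℚ.* norm² x ℚ.- total x ℚ.* total x
    sign≡1 : ∀ i → sign i ≡ 1ℚ
    sign≡1 zero    = refl
    sign≡1 (suc i) = trans (ℚP.*-identityˡ (sign i)) (sign≡1 i)
    pairs-sq : ∀ i → V i ≡ pairs i (sq 0)
    pairs-sq i = Σ-cong λ u → Σ-cong λ v → cong (δ i u v ℚ.*_)
      (cong (λ p → (x u ℚ.- p ℚ.* x v) ℚ.* (x u ℚ.- p ℚ.* x v)) (sign≡1 i))
    bound : ∀ (i : Fin (suc d)) → N 1 ℚ.* V (toℕ i) ℚ.≤ D ℚ.* D ℚ.* (N (toℕ i) ℚ.* V 1)
    bound i = ℚP.≤-trans (V-bound (toℕ i))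
      (≤-*-mono (*-nonneg (0≤N (toℕ i)) (0≤V 1)) (*-nonneg (0≤ι d) (0≤ι d))
        (≤-*-mono (0≤ι (toℕ i)) (0≤ι d) i≤D i≤D) ℚP.≤-refl)
      where
      i≤D : ι (toℕ i) ℚ.≤ D
      i≤D = ι-mono (ℕP.≤-pred (FinP.toℕ<n i))
    ΣN : Σℚ (λ (i : Fin (suc d)) → N (toℕ i)) ≡ ι n ℚ.* (ι n ℚ.* 1ℚ)
    ΣN = trans (Σ-pairs (λ _ _ → 1ℚ)) (trans (Σ-cong λ (_ : Fin n) → Σ-const n 1ℚ) (Σ-const n (ι n ℚ.* 1ℚ)))

  step-𝕀-same : ∀ i → step (𝕀 (suc i)) (suc i) ≡ α (suc i)
  step-𝕀-same i
    rewrite 𝟙-true (suc i ℕ.≟ suc i) refl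
          | 𝟙-false (i ℕ.≟ suc i) (ℕP.<⇒≢ (ℕP.n<1+n i))
          | 𝟙-false (suc (suc i) ℕ.≟ suc i) (ℕP.<⇒≢ (ℕP.n<1+n (suc i)) ∘ sym) =
    solve 3 (λ c a b → (c :* con 0ℚ :+ a :* con 1ℚ) :+ b :* con 0ℚ := a) refl
      (γ (suc i)) (α (suc i)) (β (suc i))
    where open ℚSolver.+-*-Solver

  sphere-pos : ∀ i → i ℕ.≤ d → ∀ κ → (∀ u → Σℚ (λ v → δ i u v) ≡ κ) → 0ℚ ℚ.< κ
  sphere-pos i i≤d κ eq =
    let v , w , vw = pair-at-distance i i≤d in ℚP.<-≤-trans 0<1ℚ
      (subst₂ ℚ._≤_ (𝟙-true (dist v w ℕ.≟ i) vw) (eq v) (term≤Σ (λ w → 0≤δ i v w) w))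

  -- For v, w adjacent and both at distance m from u, the three summands
  -- x u - p x v, x u - p x w and p (x v + x w) with p = (-1)ᵐ add up to 2 x u.
  odd-cycle : ∀ m → m ℕ.≤ d → 0ℚ ℚ.< α m → ∀ x →
    ι 4 ℚ.* (k ℚ.* norm² x) ℚ.≤ (1ℚ ℚ.+ ι m ℚ.+ ι m) ℚ.* (1ℚ ℚ.+ ι m ℚ.+ ι m) ℚ.*
      ((k ℚ.* norm² x ℚ.+ form x) ℚ.+ (k ℚ.* norm² x ℚ.+ form x))
  odd-cycle zero    _ 0<α x = ⊥-elim (ℚP.<-irrefl (sym α₀) 0<α)
  odd-cycle i@(suc i′) i≤d 0<α x = *-cancel-≤ (m ℚ.* A ℚ.* (κ ℚ.* ι n))
    (*-pos (*-pos (0<ι {suc i′} (ℕ.s≤s ℕ.z≤n)) 0<A) (*-pos (sphere-pos i i≤d κ κ≡) 0<n)) (begin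
    m ℚ.* A ℚ.* (κ ℚ.* ι n) ℚ.* (ι 4 ℚ.* (k ℚ.* norm² x))
      ≡⟨ solve 6 (λ m a z n k q → m :* a :* (z :* n) :* (con (ι 4) :* (k :* q))
           := (k :* n) :* (m :* (con (ι 4) :* (a :* (z :* q))))) refl m A κ (ι n) k (norm² x) ⟩
    k ℚ.* ι n ℚ.* (m ℚ.* (ι 4 ℚ.* (A ℚ.* (κ ℚ.* norm² x))))
      ≡⟨ cong (ℚ._* (m ℚ.* (ι 4 ℚ.* (A ℚ.* (κ ℚ.* norm² x))))) N₁ ⟨
    N 1 ℚ.* (m ℚ.* (ι 4 ℚ.* (A ℚ.* (κ ℚ.* norm² x))))
      ≤⟨ *-mono-≤ (N 1) (0≤N 1) summed ⟩
    N 1 ℚ.* (L ℚ.* (A ℚ.* V i ℚ.+ A ℚ.* V i ℚ.+ m ℚ.* (π ℚ.* V 1)))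
      ≡⟨ solve 7 (λ n l a v m p w → n :* (l :* (a :* v :+ a :* v :+ m :* (p :* w)))
           := (l :* (a :+ a)) :* (n :* v) :+ l :* (m :* ((p :* n) :* w))) refl
           (N 1) L A (V i) m π (V 1) ⟩
    L ℚ.* (A ℚ.+ A) ℚ.* (N 1 ℚ.* V i) ℚ.+ L ℚ.* (m ℚ.* (π ℚ.* N 1 ℚ.* V 1))
      ≤⟨ ℚP.+-monoˡ-≤ (L ℚ.* (m ℚ.* (π ℚ.* N 1 ℚ.* V 1)))
           (*-mono-≤ (L ℚ.* (A ℚ.+ A)) (*-nonneg 0≤L (+-nonneg (ℚP.<⇒≤ 0<A) (ℚP.<⇒≤ 0<A))) (V-bound i)) ⟩
    L ℚ.* (A ℚ.+ A) ℚ.* (m ℚ.* m ℚ.* (N i ℚ.* V 1)) ℚ.+ L ℚ.* (m ℚ.* (π ℚ.* N 1 ℚ.* V 1))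
      ≡⟨ cong (λ e → L ℚ.* (A ℚ.+ A) ℚ.* (m ℚ.* m ℚ.* (N i ℚ.* V 1)) ℚ.+ L ℚ.* (m ℚ.* (e ℚ.* V 1))) A≡π ⟨
    L ℚ.* (A ℚ.+ A) ℚ.* (m ℚ.* m ℚ.* (N i ℚ.* V 1)) ℚ.+ L ℚ.* (m ℚ.* (A ℚ.* N i ℚ.* V 1))
      ≡⟨ cong₂ (λ e f → L ℚ.* (A ℚ.+ A) ℚ.* (m ℚ.* m ℚ.* (e ℚ.* f)) ℚ.+ L ℚ.* (m ℚ.* (A ℚ.* e ℚ.* f)))
           Nᵢ V₁ ⟩
    L ℚ.* (A ℚ.+ A) ℚ.* (m ℚ.* m ℚ.* (κ ℚ.* ι n ℚ.* W)) ℚ.+ L ℚ.* (m ℚ.* (A ℚ.* (κ ℚ.* ι n) ℚ.* W))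
      -- The second factor L arises from 2 m² + m = m (2m + 1): two arcs bounded by `V-bound` and
      -- one edge.
      ≡⟨ solve 5 (λ m a z q e → (con 1ℚ :+ m :+ m) :* (a :+ a) :*
             (m :* m :* (z :* ((q :- con (ℚ.- 1ℚ) :* e) :+ (q :- con (ℚ.- 1ℚ) :* e))))
             :+ (con 1ℚ :+ m :+ m) :* (m :* (a :* z :* ((q :- con (ℚ.- 1ℚ) :* e) :+ (q :- con (ℚ.- 1ℚ) :* e))))
           := m :* a :* z :* ((con 1ℚ :+ m :+ m) :* (con 1ℚ :+ m :+ m) :* ((q :+ e) :+ (q :+ e)))) refl
           m A (κ ℚ.* ι n) (k ℚ.* norm² x) (form x) ⟩
    m ℚ.* A ℚ.* (κ ℚ.* ι n) ℚ.* (L ℚ.* L ℚ.*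
      ((k ℚ.* norm² x ℚ.+ form x) ℚ.+ (k ℚ.* norm² x ℚ.+ form x))) ∎)
    where
    open ℚP.≤-Reasoning
    open ℚSolver.+-*-Solver
    open Variation X reg (ℚ.- 1ℚ) refl x
    m = ι i
    L = 1ℚ ℚ.+ m ℚ.+ m
    W = (k ℚ.* norm² x ℚ.- (ℚ.- 1ℚ) ℚ.* form x) ℚ.+ (k ℚ.* norm² x ℚ.- (ℚ.- 1ℚ) ℚ.* form x)
    A = step (𝕀 i) i
    edges = triples₂₃ i i
    π = proj₁ edges
    κ = proj₁ (sphere-size i)
    κ≡ = proj₂ (sphere-size i)
    0<A : 0ℚ ℚ.< A
    0<A = subst (0ℚ ℚ.<_) (sym (step-𝕀-same i′)) 0<α
    0≤L : 0ℚ ℚ.≤ L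
    0≤L = +-nonneg {1ℚ ℚ.+ m} (+-nonneg {1ℚ} (ℚP.<⇒≤ 0<1ℚ) (0≤ι i)) (0≤ι i)
    A≡π : A ℚ.* N i ≡ π ℚ.* N 1
    A≡π = trans (sym (triples₁₂ i i (λ _ _ → 1ℚ))) (proj₂ edges (λ _ _ → 1ℚ))
    Nᵢ : N i ≡ κ ℚ.* ι n
    Nᵢ = trans (pairs-constˡ i κ κ≡ (λ _ → 1ℚ))
      (cong (κ ℚ.*_) (trans (Σ-const n 1ℚ) (ℚP.*-identityʳ (ι n))))
    pointwise : ∀ u v w → m ℚ.* (ι 4 ℚ.* (x u ℚ.* x u)) ℚ.≤
      L ℚ.* (sq i u v ℚ.+ sq i u w ℚ.+ m ℚ.* sq 1 v w)
    pointwise u v w = subst₂ ℚ._≤_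
      (cong (m ℚ.*_) (solve 4 (λ p y z t →
        let r = (y :- p :* z) :+ (y :- p :* t) :+ p :* (z :- (con (ℚ.- 1ℚ) :* con 1ℚ) :* t) in
        r :* r := con (ι 4) :* (y :* y)) refl (sign i) (x u) (x v) (x w)))
      (cong (λ e → L ℚ.* (sq i u v ℚ.+ sq i u w ℚ.+ m ℚ.* e)) (sq-sign (sign i) v w (sign² i)))
      (cauchy₃ m (x u ℚ.- sign i ℚ.* x v) (x u ℚ.- sign i ℚ.* x w)
        (sign i ℚ.* (x v ℚ.- sign 1 ℚ.* x w)) (0≤ι i))
    summed : m ℚ.* (ι 4 ℚ.* (A ℚ.* (κ ℚ.* norm² x))) ℚ.≤
      L ℚ.* (A ℚ.* V i ℚ.+ A ℚ.* V i ℚ.+ m ℚ.* (π ℚ.* V 1))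
    summed = subst₂ ℚ._≤_
      (trans (triples-* i i m (λ u _ _ → ι 4 ℚ.* (x u ℚ.* x u))) (cong (m ℚ.*_)
        (trans (triples-* i i (ι 4) (λ u _ _ → x u ℚ.* x u)) (cong (ι 4 ℚ.*_)
          (trans (triples₁₂ i i (λ u _ → x u ℚ.* x u))
            (cong (A ℚ.*_) (pairs-constˡ i κ κ≡ (λ u → x u ℚ.* x u))))))))
      (trans (triples-* i i L (λ u v w → sq i u v ℚ.+ sq i u w ℚ.+ m ℚ.* sq 1 v w)) (cong (L ℚ.*_)
        (trans (triples-+ i i (λ u v w → sq i u v ℚ.+ sq i u w) (λ _ v w → m ℚ.* sq 1 v w)) (cong₂ ℚ._+_
          (trans (triples-+ i i (λ u v _ → sq i u v) (λ u _ w → sq i u w))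
            (cong₂ ℚ._+_ (triples₁₂ i i (sq i)) (triples₁₃ i i (sq i))))
          (trans (triples-* i i m (λ _ v w → sq 1 v w)) (cong (m ℚ.*_) (proj₂ edges (sq 1))))))))
      (triples-mono i i pointwise)

  -- Both inequalities brought to the common factor k (1 - c) with c = 1/(4d²)

  module _ (c : ℚ) (4d²c≡1 : ι 4 ℚ.* (D ℚ.* D) ℚ.* c ≡ 1ℚ) (2≤d : 2 ℕ.≤ d) where

    K : ℚ
    K = k ℚ.* (1ℚ ℚ.- c)

    M : ℚ
    M = ι 4 ℚ.* (D ℚ.* D)

    0<D : 0ℚ ℚ.< D
    0<D = 0<ι {d} (ℕP.≤-trans (ℕ.s≤s ℕ.z≤n) 2≤d)

    0<M : 0ℚ ℚ.< M
    0<M = *-pos {ι 4} (0<ι {4} (ℕ.s≤s ℕ.z≤n)) (*-pos 0<D 0<D)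

    M*K : ∀ q → M ℚ.* (K ℚ.* q) ≡ M ℚ.* (k ℚ.* q) ℚ.- k ℚ.* q
    M*K q = trans (solve 4 (λ m k c q → m :* (k :* (con 1ℚ :- c) :* q) := m :* (k :* q) :- (m :* c) :* (k :* q))
                    refl M k c q)
      (cong (λ e → M ℚ.* (k ℚ.* q) ℚ.- e) (trans (cong (ℚ._* (k ℚ.* q)) 4d²c≡1) (ℚP.*-identityˡ (k ℚ.* q))))
      where open ℚSolver.+-*-Solver

    -- `poincaré` gives the smaller factor 1 - 1/D² and the error k S²/(D² n), S being the
    -- coordinate sum. Four times its gap leaves 3 k n ‖x‖² to spare, and D² n ≥ 1 lets the error be
    -- rounded up to k S².
    form-upper : ∀ x → form x ℚ.≤ K ℚ.* norm² x ℚ.+ k ℚ.* (total x ℚ.* total x)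
    form-upper x = *-cancel-≤ (M ℚ.* ι n) (*-pos 0<M 0<n)
      (≤-by-diff (ι 4 ℚ.* gap ℚ.+ ι 3 ℚ.* (k ℚ.* ι n ℚ.* q) ℚ.+ ι 4 ℚ.* (k ℚ.* (S ℚ.* S)) ℚ.* e)
        (+-nonneg {ι 4 ℚ.* gap ℚ.+ ι 3 ℚ.* (k ℚ.* ι n ℚ.* q)}
          (+-nonneg {ι 4 ℚ.* gap} (*-nonneg (0≤ι 4) 0≤gap)
            (*-nonneg (0≤ι 3) (*-nonneg (*-nonneg 0≤k (0≤ι n)) (Σ-nonneg λ u → 0≤p² (x u)))))
          (*-nonneg (*-nonneg (0≤ι 4) (*-nonneg 0≤k (0≤p² S))) 0≤e))
        (trans
          (solve 6 (λ D n K k q S → con (ι 4) :* (D :* D) :* n :* (K :* q :+ k :* (S :* S))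
             := n :* (con (ι 4) :* (D :* D) :* (K :* q)) :+ con (ι 4) :* (D :* D) :* n :* (k :* (S :* S))) refl
             D (ι n) K k q S)
          (trans (cong (λ e → ι n ℚ.* e ℚ.+ M ℚ.* ι n ℚ.* (k ℚ.* (S ℚ.* S))) (M*K q))
            (solve 6 (λ D n f k q S →
               n :* (con (ι 4) :* (D :* D) :* (k :* q) :- k :* q) :+ con (ι 4) :* (D :* D) :* n :* (k :* (S :* S))
               := con (ι 4) :* (D :* D) :* n :* f :+
                  (con (ι 4) :* (D :* D :* n :* (k :* q :- f) :- k :* (n :* q :- S :* S))
                   :+ con (ι 3) :* (k :* n :* q)
                   :+ con (ι 4) :* (k :* (S :* S)) :* (D :* D :* n :- con 1ℚ))) refl
               D (ι n) (form x) k q S))))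
      where
      open ℚSolver.+-*-Solver
      q = norm² x
      S = total x
      gap = D ℚ.* D ℚ.* ι n ℚ.* (k ℚ.* q ℚ.- form x) ℚ.- k ℚ.* (ι n ℚ.* q ℚ.- S ℚ.* S)
      e = D ℚ.* D ℚ.* ι n ℚ.- 1ℚ
      0≤gap : 0ℚ ℚ.≤ gap
      0≤gap = p≤q⇒0≤q-p (poincaré x)
      0<d = ℕP.≤-trans (ℕ.s≤s ℕ.z≤n) 2≤d
      0≤e : 0ℚ ℚ.≤ e
      0≤e = p≤q⇒0≤q-p (subst (1ℚ ℚ.≤_)
        (trans (ι-* (d ℕ.* d) n) (cong (ℚ._* ι n) (ι-* d d)))
        (ι-mono {1} {d ℕ.* d ℕ.* n} (ℕP.*-mono-≤ (ℕP.*-mono-≤ 0<d 0<d) (ℕP.≤-<-trans ℕ.z≤n (FinP.toℕ<n vertex)))))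

    -- `odd-cycle` with (2m + 1)² ≤ (2D + 1)² ≤ 8 D² gives k ‖x‖² ≤ 4 D² (k ‖x‖² + form x), which is
    -- the claim multiplied by 4 D².
    form-lower : ∀ m → m ℕ.≤ d → 0ℚ ℚ.< α m → ∀ x → ℚ.- form x ℚ.≤ K ℚ.* norm² x
    form-lower m m≤d 0<α x = *-cancel-≤ M 0<M
      (≤-by-diff (M ℚ.* Y ℚ.- k ℚ.* q) (p≤q⇒0≤q-p (*-cancel-≤ (ι 4) {k ℚ.* q} {M ℚ.* Y} (0<ι {4} (ℕ.s≤s ℕ.z≤n)) kq≤))
        (trans (M*K q)
          (solve 3 (λ m q f → m :* q :- q := m :* (:- f) :+ (m :* (q :+ f) :- q)) refl
            M (k ℚ.* q) (form x))))
      where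
      open ℚSolver.+-*-Solver
      q = norm² x
      Y = k ℚ.* q ℚ.+ form x
      L = 1ℚ ℚ.+ ι m ℚ.+ ι m
      L′ = 1ℚ ℚ.+ D ℚ.+ D
      0≤L : 0ℚ ℚ.≤ L
      0≤L = +-nonneg {1ℚ ℚ.+ ι m} (+-nonneg {1ℚ} (ℚP.<⇒≤ 0<1ℚ) (0≤ι m)) (0≤ι m)
      L≤L′ : L ℚ.≤ L′
      L≤L′ = ℚP.+-mono-≤ {1ℚ ℚ.+ ι m} (ℚP.+-monoʳ-≤ 1ℚ (ι-mono m≤d)) (ι-mono m≤d)
      0<L : 0ℚ ℚ.< L
      0<L = ℚP.+-mono-<-≤ {0ℚ} {1ℚ ℚ.+ ι m} (ℚP.+-mono-<-≤ {0ℚ} {1ℚ} 0<1ℚ (0≤ι m)) (0≤ι m)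
      -- Enlarging L² requires a nonnegative cofactor; `odd-cycle` itself supplies this, its left
      -- side being nonnegative.
      0≤2Y : 0ℚ ℚ.≤ Y ℚ.+ Y
      0≤2Y = *-cancel-≤ (L ℚ.* L) (*-pos 0<L 0<L) (ℚP.≤-trans
        (ℚP.≤-reflexive (ℚP.*-zeroʳ (L ℚ.* L)))
        (ℚP.≤-trans
          (*-nonneg (0≤ι 4) (*-nonneg 0≤k (Σ-nonneg λ u → 0≤p² (x u))))
          (odd-cycle m m≤d 0<α x)))
      -- Expansion around D = 2: the inequality (2D + 1)² ≤ 8 D² fails at D = 1, and 8 D² - (2D +
      -- 1)² = 7 + 12 t + 4 t².
      t = D ℚ.- ι 2
      0≤t : 0ℚ ℚ.≤ t
      0≤t = p≤q⇒0≤q-p (ι-mono {2} {d} 2≤d)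
      L²≤8D² : L ℚ.* L ℚ.≤ ι 8 ℚ.* (D ℚ.* D)
      L²≤8D² = ℚP.≤-trans (≤-*-mono 0≤L (ℚP.≤-trans 0≤L L≤L′) L≤L′ L≤L′)
        (≤-by-diff (ι 7 ℚ.+ ι 12 ℚ.* t ℚ.+ ι 4 ℚ.* (t ℚ.* t))
          (+-nonneg {ι 7 ℚ.+ ι 12 ℚ.* t} (+-nonneg {ι 7} (0≤ι 7) (*-nonneg (0≤ι 12) 0≤t))
            (*-nonneg (0≤ι 4) (0≤p² t)))
          (solve 1 (λ D → con (ι 8) :* (D :* D) := (con 1ℚ :+ D :+ D) :* (con 1ℚ :+ D :+ D) :+
             (con (ι 7) :+ con (ι 12) :* (D :- con (ι 2))
              :+ con (ι 4) :* ((D :- con (ι 2)) :* (D :- con (ι 2))))) refl D))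
      kq≤ : ι 4 ℚ.* (k ℚ.* q) ℚ.≤ ι 4 ℚ.* (M ℚ.* Y)
      kq≤ = ℚP.≤-trans (odd-cycle m m≤d 0<α x) (ℚP.≤-trans
        (ℚP.*-monoʳ-≤-nonNeg (Y ℚ.+ Y) {{ℚ.nonNegative 0≤2Y}} L²≤8D²)
        (ℚP.≤-reflexive (solve 2 (λ D y → con (ι 8) :* (D :* D) :* (y :+ y)
            := con (ι 4) :* (con (ι 4) :* (D :* D) :* y)) refl D Y)))

-- Real numbers

p≤p+ε : ∀ p {ε} → 0ℚ ℚ.< ε → p ℚ.≤ p ℚ.+ ε
p≤p+ε p {ε} 0<ε = ≤-by-diff ε (ℚP.<⇒≤ 0<ε) refl

-- The bridge from ℚ to ℝ: the real operations act term by term, so a rational inequality valid for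
-- all arguments transfers at once.
pointwise-≤ : ∀ {x y} → (∀ n → seq x n ℚ.≤ seq y n) → x ≤ y
pointwise-≤ {x} {y} h = mk≤ λ ε 0<ε → 0 , λ n _ → ℚP.≤-trans (h n) (p≤p+ε (seq y n) 0<ε)

pointwise-≈ : ∀ {x y} → (∀ n → seq x n ≡ seq y n) → x ≈ y
pointwise-≈ {x} {y} h = pointwise-≤ {x} {y} (ℚP.≤-reflexive ∘ h) ,
                        pointwise-≤ {y} {x} (ℚP.≤-reflexive ∘ sym ∘ h)

≤-refl : ∀ {x} → x ≤ x
≤-refl {x} = pointwise-≤ {x} {x} λ _ → ℚP.≤-refl

≤-trans : ∀ {x y z} → x ≤ y → y ≤ z → x ≤ z
≤-trans {x} {y} {z} h h′ = mk≤ λ ε 0<ε →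
  let N  , f = eventually-≤ h  (½ ℚ.* ε) (½-pos 0<ε)
      N′ , g = eventually-≤ h′ (½ ℚ.* ε) (½-pos 0<ε)
  in N ℕ.⊔ N′ , λ n N≤n → ℚP.≤-trans (f n (ℕP.m⊔n≤o⇒m≤o N N′ N≤n))
       (ℚP.≤-trans (ℚP.+-monoˡ-≤ (½ ℚ.* ε) (g n (ℕP.m⊔n≤o⇒n≤o N N′ N≤n)))
         (ℚP.≤-reflexive (trans (ℚP.+-assoc (seq z n) (½ ℚ.* ε) (½ ℚ.* ε))
                                (cong (seq z n ℚ.+_) (½+½ ε)))))

≈-refl : ∀ {x} → x ≈ x
≈-refl {x} = ≤-refl {x} , ≤-refl {x}

≈-sym : ∀ {x y} → x ≈ y → y ≈ x
≈-sym (h , h′) = h′ , h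

≈-trans : ∀ {x y z} → x ≈ y → y ≈ z → x ≈ z
≈-trans (h , h′) (g , g′) = ≤-trans h g , ≤-trans g′ h′

+-mono : ∀ {x x′ y y′} → x ≤ x′ → y ≤ y′ → x + y ≤ x′ + y′
+-mono {x} {x′} {y} {y′} h h′ = mk≤ λ ε 0<ε →
  let N  , f = eventually-≤ h  (½ ℚ.* ε) (½-pos 0<ε)
      N′ , g = eventually-≤ h′ (½ ℚ.* ε) (½-pos 0<ε)
  in N ℕ.⊔ N′ , λ n N≤n → ℚP.≤-trans
       (ℚP.+-mono-≤ (f n (ℕP.m⊔n≤o⇒m≤o N N′ N≤n)) (g n (ℕP.m⊔n≤o⇒n≤o N N′ N≤n)))
       (ℚP.≤-reflexive (trans
         (solve 3 (λ a b e → (a :+ e) :+ (b :+ e) := (a :+ b) :+ (e :+ e)) refl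
           (seq x′ n) (seq y′ n) (½ ℚ.* ε))
         (cong (seq x′ n ℚ.+ seq y′ n ℚ.+_) (½+½ ε))))
  where open ℚSolver.+-*-Solver

neg-mono : ∀ {x y} → x ≤ y → - y ≤ - x
neg-mono {x} {y} h = mk≤ λ ε 0<ε → let N , f = eventually-≤ h ε 0<ε in N , λ n N≤n →
  subst₂ ℚ._≤_ (solve 2 (λ x y → x :+ (:- x :- y) := :- y) refl (seq x n) (seq y n))
               (solve 3 (λ x y e → (y :+ e) :+ (:- x :- y) := :- x :+ e) refl (seq x n) (seq y n) ε)
               (ℚP.+-monoˡ-≤ (ℚ.- seq x n ℚ.- seq y n) (f n N≤n))
  where open ℚSolver.+-*-Solver

+-cong : ∀ {x x′ y y′} → x ≈ x′ → y ≈ y′ → x + y ≈ x′ + y′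
+-cong (h , h′) (g , g′) = +-mono h g , +-mono h′ g′

neg-cong : ∀ {x y} → x ≈ y → - x ≈ - y
neg-cong (h , h′) = neg-mono h′ , neg-mono h

*-congˡ : ∀ x {y z} → y ≈ z → x * y ≈ x * z
*-congˡ x {y} {z} (h , h′) = half y z h h′ , half z y h′ h
  where
  open ℚSolver.+-*-Solver
  half : ∀ y z → y ≤ z → z ≤ y → x * y ≤ x * z
  half y z h h′ = mk≤ λ ε 0<ε →
    let B , 0<B , M , bx = bounded x
        B⁻¹ , 0<B⁻¹ , inv = 1/pos 0<B
        η = B⁻¹ ℚ.* ε
        N  , f = eventually-≤ h  η (*-pos 0<B⁻¹ 0<ε)
        N′ , g = eventually-≤ h′ η (*-pos 0<B⁻¹ 0<ε)
    in M ℕ.⊔ (N ℕ.⊔ N′) , λ n N≤n →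
      p≤q+r (seq x n ℚ.* seq y n) (seq x n ℚ.* seq z n) (begin
        seq x n ℚ.* seq y n ℚ.- seq x n ℚ.* seq z n
          ≡⟨ solve 3 (λ x y z → x :* y :- x :* z := x :* (y :- z)) refl (seq x n) (seq y n) (seq z n) ⟩
        seq x n ℚ.* (seq y n ℚ.- seq z n)
          ≤⟨ p≤∣p∣ _ ⟩
        ℚ.∣ seq x n ℚ.* (seq y n ℚ.- seq z n) ∣
          ≡⟨ ℚP.∣p*q∣≡∣p∣*∣q∣ (seq x n) (seq y n ℚ.- seq z n) ⟩
        ℚ.∣ seq x n ∣ ℚ.* ℚ.∣ seq y n ℚ.- seq z n ∣
          ≤⟨ ≤-*-mono (ℚP.0≤∣p∣ (seq y n ℚ.- seq z n)) (ℚP.<⇒≤ 0<B)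
               (bx n (ℕP.m⊔n≤o⇒m≤o M (N ℕ.⊔ N′) N≤n))
               (∣p-q∣≤r (seq y n) (seq z n)
                 (f n (ℕP.m⊔n≤o⇒m≤o N N′ (ℕP.m⊔n≤o⇒n≤o M (N ℕ.⊔ N′) N≤n)))
                 (g n (ℕP.m⊔n≤o⇒n≤o N N′ (ℕP.m⊔n≤o⇒n≤o M (N ℕ.⊔ N′) N≤n)))) ⟩
        B ℚ.* (B⁻¹ ℚ.* ε)
          ≡⟨ cancel-1/ B B⁻¹ ε inv ⟩
        ε ∎)
    where open ℚP.≤-Reasoning

*-comm : ∀ x y → x * y ≈ y * x
*-comm x y = pointwise-≈ {x * y} {y * x} λ n → ℚP.*-comm (seq x n) (seq y n)

*-zeroʳ : ∀ x → x * 0ℝ ≈ 0ℝ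
*-zeroʳ x = pointwise-≈ {x * 0ℝ} {0ℝ} λ n → ℚP.*-zeroʳ (seq x n)

-- Nonnegativity is asked of every approximant, as holds for sums of squares, so that rational
-- monotonicity applies in each term.
*-monoʳ-≤-pointwise : ∀ {x y} z → (∀ n → 0ℚ ℚ.≤ seq z n) → x ≤ y → x * z ≤ y * z
*-monoʳ-≤-pointwise {x} {y} z 0≤z h = mk≤ λ ε 0<ε →
  let B , 0<B , M , bz = bounded z
      B⁻¹ , 0<B⁻¹ , inv = 1/pos 0<B
      η = B⁻¹ ℚ.* ε
      0<η = *-pos 0<B⁻¹ 0<ε
      N , f = eventually-≤ h η 0<η
  in M ℕ.⊔ N , λ n N≤n → begin
    seq x n ℚ.* seq z n
      ≤⟨ ℚP.*-monoʳ-≤-nonNeg (seq z n) {{ℚ.nonNegative (0≤z n)}} (f n (ℕP.m⊔n≤o⇒n≤o M N N≤n)) ⟩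
    (seq y n ℚ.+ η) ℚ.* seq z n
      ≡⟨ ℚP.*-distribʳ-+ (seq z n) (seq y n) η ⟩
    seq y n ℚ.* seq z n ℚ.+ η ℚ.* seq z n
      ≤⟨ ℚP.+-monoʳ-≤ (seq y n ℚ.* seq z n) (*-mono-≤ η (ℚP.<⇒≤ 0<η)
           (ℚP.≤-trans (p≤∣p∣ (seq z n)) (bz n (ℕP.m⊔n≤o⇒m≤o M N N≤n)))) ⟩
    seq y n ℚ.* seq z n ℚ.+ η ℚ.* B
      ≡⟨ cong (seq y n ℚ.* seq z n ℚ.+_) (trans (ℚP.*-comm η B) (cancel-1/ B B⁻¹ ε inv)) ⟩
    seq y n ℚ.* seq z n ℚ.+ ε ∎
  where open ℚP.≤-Reasoning

-- Comparing the N-th approximations decides between the two sides up to ε, so _≤_ is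
-- stable although it is undecidable.
≮⇒≥ : ∀ {x y} → ¬ (y < x) → x ≤ y
≮⇒≥ {x} {y} ¬y<x = mk≤ λ ε 0<ε →
  let e = ½ ℚ.* (½ ℚ.* ε)
      0<e = ½-pos (½-pos 0<ε)
      Nx , fx = cauchy x e 0<e
      Ny , fy = cauchy y e 0<e
  in compare ε e (trans (cong₂ ℚ._+_ (½+½ (½ ℚ.* ε)) (½+½ (½ ℚ.* ε))) (½+½ ε))
       Nx Ny fx fy (seq x (Nx ℕ.⊔ Ny) ℚ.≤? seq y (Nx ℕ.⊔ Ny) ℚ.+ (e ℚ.+ e))
  where
  open ℚSolver.+-*-Solver
  open ℚP.≤-Reasoning
  compare : ∀ ε e → (e ℚ.+ e) ℚ.+ (e ℚ.+ e) ≡ ε → ∀ Nx Ny →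
    (∀ m n → Nx ℕ.≤ m → Nx ℕ.≤ n → ℚ.∣ seq x m ℚ.- seq x n ∣ ℚ.≤ e) →
    (∀ m n → Ny ℕ.≤ m → Ny ℕ.≤ n → ℚ.∣ seq y m ℚ.- seq y n ∣ ℚ.≤ e) →
    Dec (seq x (Nx ℕ.⊔ Ny) ℚ.≤ seq y (Nx ℕ.⊔ Ny) ℚ.+ (e ℚ.+ e)) →
    ∃[ N ] (∀ n → N ℕ.≤ n → seq x n ℚ.≤ seq y n ℚ.+ ε)
  compare ε e eq Nx Ny fx fy (yes h) = N , λ n N≤n → begin
    seq x n
      ≤⟨ ∣p-q∣≤r⇒p≤q+r (seq x n) (seq x N) (fx n N (ℕP.m⊔n≤o⇒m≤o Nx Ny N≤n) (ℕP.m≤m⊔n Nx Ny)) ⟩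
    seq x N ℚ.+ e
      ≤⟨ ℚP.+-monoˡ-≤ e h ⟩
    seq y N ℚ.+ (e ℚ.+ e) ℚ.+ e
      ≤⟨ ℚP.+-monoˡ-≤ e (ℚP.+-monoˡ-≤ (e ℚ.+ e) (∣p-q∣≤r⇒p≤q+r (seq y N) (seq y n)
           (fy N n (ℕP.m≤n⊔m Nx Ny) (ℕP.m⊔n≤o⇒n≤o Nx Ny N≤n)))) ⟩
    seq y n ℚ.+ e ℚ.+ (e ℚ.+ e) ℚ.+ e
      ≡⟨ solve 2 (λ y e → y :+ e :+ (e :+ e) :+ e := y :+ ((e :+ e) :+ (e :+ e))) refl (seq y n) e ⟩
    seq y n ℚ.+ ((e ℚ.+ e) ℚ.+ (e ℚ.+ e))
      ≡⟨ cong (seq y n ℚ.+_) eq ⟩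
    seq y n ℚ.+ ε ∎
    where N = Nx ℕ.⊔ Ny
  compare ε e eq Nx Ny fx fy (no ¬h) = ⊥-elim (¬y<x (mk< (gap , 0<gap , N , λ n N≤n → begin
    seq y n ℚ.+ gap
      ≤⟨ ℚP.+-monoˡ-≤ gap (∣p-q∣≤r⇒p≤q+r (seq y n) (seq y N)
           (fy n N (ℕP.m⊔n≤o⇒n≤o Nx Ny N≤n) (ℕP.m≤n⊔m Nx Ny))) ⟩
    seq y N ℚ.+ e ℚ.+ gap
      ≡⟨ solve 3 (λ x y e → y :+ e :+ (x :- (y :+ (e :+ e))) := x :- e) refl (seq x N) (seq y N) e ⟩
    seq x N ℚ.- e
      ≤⟨ p-q≤r (seq x N) e (ℚP.≤-trans (∣p-q∣≤r⇒p≤q+r (seq x N) (seq x n)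
           (fx N n (ℕP.m≤m⊔n Nx Ny) (ℕP.m⊔n≤o⇒m≤o Nx Ny N≤n)))
           (ℚP.≤-reflexive (ℚP.+-comm (seq x n) e))) ⟩
    seq x n ∎)))
    where
    N = Nx ℕ.⊔ Ny
    gap = seq x N ℚ.- (seq y N ℚ.+ (e ℚ.+ e))
    0<gap : 0ℚ ℚ.< gap
    0<gap = subst (ℚ._< gap) (ℚP.+-inverseʳ (seq y N ℚ.+ (e ℚ.+ e)))
      (ℚP.+-monoˡ-< (ℚ.- (seq y N ℚ.+ (e ℚ.+ e))) (ℚP.≰⇒> ¬h))

∣x∣≤y : ∀ {x y} → x ≤ y → - x ≤ y → ∣ x ∣ ≤ y
∣x∣≤y {x} {y} h h′ = mk≤ λ ε 0<ε →
  let N , f = eventually-≤ h ε 0<ε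
      N′ , g = eventually-≤ h′ ε 0<ε
  in N ℕ.⊔ N′ , λ n N≤n → abs-≤ (seq x n) (f n (ℕP.m⊔n≤o⇒m≤o N N′ N≤n)) (g n (ℕP.m⊔n≤o⇒n≤o N N′ N≤n))

1≰0 : ¬ (1ℝ ≤ 0ℝ)
1≰0 h with eventually-≤ h ½ (ℚP.positive⁻¹ ½)
... | N , f = from-no (1ℚ ℚ.≤? 0ℚ ℚ.+ ½) (f N ℕP.≤-refl)

seq-∑ : ∀ {n} (f : Fin n → ℝ) m → seq (∑ f) m ≡ Σℚ λ u → seq (f u) m
seq-∑ {zero}  f m = refl
seq-∑ {suc n} f m = cong (seq (f zero) m ℚ.+_) (seq-∑ (f ∘ suc) m)

∑-cong : ∀ {n} {f g : Fin n → ℝ} → (∀ u → f u ≈ g u) → ∑ f ≈ ∑ g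
∑-cong {zero}  h = ≈-refl {0ℝ}
∑-cong {suc n} h = +-cong (h zero) (∑-cong (h ∘ suc))

p²≤ε²⇒∣p∣≤ε : ∀ p {ε} → 0ℚ ℚ.< ε → p ℚ.* p ℚ.≤ ε ℚ.* ε → ℚ.∣ p ∣ ℚ.≤ ε
p²≤ε²⇒∣p∣≤ε p {ε} 0<ε h with ℚ.∣ p ∣ ℚ.≤? ε
... | yes g = g
... | no ¬g = ⊥-elim (ℚP.<-irrefl refl (ℚP.<-≤-trans (begin-strict
  ε ℚ.* ε                 <⟨ ℚP.*-monoʳ-<-pos ε {{ℚ.positive 0<ε}} (ℚP.≰⇒> ¬g) ⟩
  ε ℚ.* ℚ.∣ p ∣           ≤⟨ ℚP.*-monoʳ-≤-nonNeg ℚ.∣ p ∣ {{ℚ.nonNegative (ℚP.0≤∣p∣ p)}} (ℚP.<⇒≤ (ℚP.≰⇒> ¬g)) ⟩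
  ℚ.∣ p ∣ ℚ.* ℚ.∣ p ∣     ≡⟨ ℚP.∣p*q∣≡∣p∣*∣q∣ p p ⟨
  ℚ.∣ p ℚ.* p ∣           ≡⟨ ℚP.0≤p⇒∣p∣≡p (0≤p² p) ⟩
  p ℚ.* p ∎) h))
  where open ℚP.≤-Reasoning

⟨_,_⟩ : ∀ {n} → (Fin n → ℝ) → (Fin n → ℝ) → ℝ
⟨ x , y ⟩ = ∑ λ u → x u * y u

0≤⟨x,x⟩ : ∀ {n} (x : Fin n → ℝ) m → 0ℚ ℚ.≤ seq ⟨ x , x ⟩ m
0≤⟨x,x⟩ x m = subst (0ℚ ℚ.≤_) (sym (seq-∑ (λ u → x u * x u) m)) (Σ-nonneg λ u → 0≤p² (seq (x u) m))

-- One square is at most the whole sum, so the tolerance ε² for the sum yields ε for each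
-- coordinate.
⟨x,x⟩≤0⇒x≈0 : ∀ {n} (x : Fin n → ℝ) → ⟨ x , x ⟩ ≤ 0ℝ → ∀ u → x u ≈ 0ℝ
⟨x,x⟩≤0⇒x≈0 x h u = mk≤ (λ ε 0<ε → let N , f = small ε 0<ε in N , λ n N≤n →
    ℚP.≤-trans (p≤∣p∣ (seq (x u) n)) (ℚP.≤-trans (f n N≤n) (ℚP.≤-reflexive (sym (ℚP.+-identityˡ ε))))) ,
  mk≤ (λ ε 0<ε → let N , f = small ε 0<ε in N , λ n N≤n →
    p≤q+r 0ℚ (seq (x u) n) (ℚP.≤-trans (p≤∣p∣ (0ℚ ℚ.- seq (x u) n))
      (subst (ℚ._≤ ε) (sym (trans (cong ℚ.∣_∣ (ℚP.+-identityˡ (ℚ.- seq (x u) n))) (ℚP.∣-p∣≡∣p∣ (seq (x u) n))))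
        (f n N≤n))))
  where
  small : ∀ ε → 0ℚ ℚ.< ε → ∃[ N ] (∀ n → N ℕ.≤ n → ℚ.∣ seq (x u) n ∣ ℚ.≤ ε)
  small ε 0<ε = let N , f = eventually-≤ h (ε ℚ.* ε) (*-pos 0<ε 0<ε) in N , λ n N≤n →
    p²≤ε²⇒∣p∣≤ε (seq (x u) n) 0<ε (ℚP.≤-trans
      (subst (seq (x u) n ℚ.* seq (x u) n ℚ.≤_) (sym (seq-∑ (λ u → x u * x u) n))
        (term≤Σ (λ u → 0≤p² (seq (x u) n)) u))
      (ℚP.≤-trans (f n N≤n) (ℚP.≤-reflexive (ℚP.+-identityˡ (ε ℚ.* ε)))))

-- Strictness supplies a rational gap below y - x; eventually gap z ≤ (y - x) z ≤ gap ε, and the gap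
-- cancels.
x<y∧yz≤xz⇒z≤0 : ∀ {x y} z → (∀ n → 0ℚ ℚ.≤ seq z n) → x < y → y * z ≤ x * z → z ≤ 0ℝ
x<y∧yz≤xz⇒z≤0 {x} {y} z 0≤z x<y h = mk≤ λ ε 0<ε →
  let gap , 0<gap , N , f = eventually-< x<y
      M , g = eventually-≤ h (gap ℚ.* ε) (*-pos 0<gap 0<ε)
  in N ℕ.⊔ M , λ n N≤n → ℚP.≤-trans
      (*-cancel-≤ gap 0<gap (bound gap ε n
        (f n (ℕP.m⊔n≤o⇒m≤o N M N≤n)) (g n (ℕP.m⊔n≤o⇒n≤o N M N≤n))))
      (ℚP.≤-reflexive (sym (ℚP.+-identityˡ ε)))
  where
  open ℚSolver.+-*-Solver
  bound : ∀ gap ε n → seq x n ℚ.+ gap ℚ.≤ seq y n →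
    seq y n ℚ.* seq z n ℚ.≤ seq x n ℚ.* seq z n ℚ.+ gap ℚ.* ε → gap ℚ.* seq z n ℚ.≤ gap ℚ.* ε
  bound gap ε n h₁ h₂ = subst₂ ℚ._≤_
    (solve 3 (λ x z g → (x :+ g) :* z :+ :- (x :* z) := g :* z) refl (seq x n) (seq z n) gap)
    (solve 3 (λ x z e → x :* z :+ e :+ :- (x :* z) := e) refl (seq x n) (seq z n) (gap ℚ.* ε))
    (ℚP.+-monoˡ-≤ (ℚ.- (seq x n ℚ.* seq z n))
      (ℚP.≤-trans (ℚP.*-monoʳ-≤-nonNeg (seq z n) {{ℚ.nonNegative (0≤z n)}} h₁) h₂))

-- Bounds for ε₀ and η₀

toℚᵘ-negι : ∀ m → ℚ.toℚᵘ (ℚ.- ι m) ℚᵘ.≃ ℚᵘ.- ℚᵘ.mkℚᵘ (+ m) 0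
toℚᵘ-negι m = ℚᵘP.≃-trans (ℚP.toℚᵘ-homo‿- (ι m))
  (ℚᵘP.-‿cong (ℚP.toℚᵘ-fromℚᵘ (ℚᵘ.mkℚᵘ (+ m) 0)))

-- The bound on p cleared of its denominator and of negative terms, so that it compares exponents in
-- ℕ.
exponent-upper : ∀ p m → p ℚ.≤ ℚ.- ι m → (↥ p) ⁺ ℕ.+ m ℕ.* ↧ₙ p ℕ.≤ (↥ p) ⁻
exponent-upper p@record{} m h = ℤP.drop‿+≤+ (begin
  + ((↥ p) ⁺ ℕ.+ m ℕ.* ↧ₙ p)
    ≡⟨ trans (ℤP.pos-+ ((↥ p) ⁺) _) (cong (λ e → + ((↥ p) ⁺) ℤ.+ e) (ℤP.pos-* m (↧ₙ p))) ⟩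
  + ((↥ p) ⁺) ℤ.+ + m ℤ.* ↧ p
    ≡⟨ solve 3 (λ a b c → a :+ c := (a :- b) :+ (b :+ c)) refl
         (+ ((↥ p) ⁺)) (+ ((↥ p) ⁻)) (+ m ℤ.* ↧ p) ⟩
  (+ ((↥ p) ⁺) ℤ.- + ((↥ p) ⁻)) ℤ.+ (+ ((↥ p) ⁻) ℤ.+ + m ℤ.* ↧ p)
    ≡⟨ cong (ℤ._+ (+ ((↥ p) ⁻) ℤ.+ + m ℤ.* ↧ p)) (trans (ℤP.*-identityʳ (↥ p)) (⁺-⁻ (↥ p))) ⟨
  ↥ p ℤ.* + 1 ℤ.+ (+ ((↥ p) ⁻) ℤ.+ + m ℤ.* ↧ p)
    ≤⟨ ℤP.+-monoˡ-≤ (+ ((↥ p) ⁻) ℤ.+ + m ℤ.* ↧ p)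
         (ℚᵘP.drop-*≤* (ℚᵘP.≤-respʳ-≃ (toℚᵘ-negι m) (ℚP.toℚᵘ-mono-≤ h))) ⟩
  ℤ.- (+ m) ℤ.* ↧ p ℤ.+ (+ ((↥ p) ⁻) ℤ.+ + m ℤ.* ↧ p)
    ≡⟨ solve 3 (λ m q b → :- m :* q :+ (b :+ m :* q) := b) refl (+ m) (↧ p) (+ ((↥ p) ⁻)) ⟩
  + ((↥ p) ⁻) ∎)
  where
  open ℤP.≤-Reasoning
  open ℤSolver.+-*-Solver

exponent-lower : ∀ p m → ℚ.- ι m ℚ.≤ p → (↥ p) ⁻ ℕ.≤ (↥ p) ⁺ ℕ.+ m ℕ.* ↧ₙ p
exponent-lower p@record{} m h = ℤP.drop‿+≤+ (begin
  + ((↥ p) ⁻)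
    ≡⟨ solve 3 (λ m q b → :- m :* q :+ (b :+ m :* q) := b) refl (+ m) (↧ p) (+ ((↥ p) ⁻)) ⟨
  ℤ.- (+ m) ℤ.* ↧ p ℤ.+ (+ ((↥ p) ⁻) ℤ.+ + m ℤ.* ↧ p)
    ≤⟨ ℤP.+-monoˡ-≤ (+ ((↥ p) ⁻) ℤ.+ + m ℤ.* ↧ p)
         (ℚᵘP.drop-*≤* (ℚᵘP.≤-respˡ-≃ (toℚᵘ-negι m) (ℚP.toℚᵘ-mono-≤ h))) ⟩
  ↥ p ℤ.* + 1 ℤ.+ (+ ((↥ p) ⁻) ℤ.+ + m ℤ.* ↧ p)
    ≡⟨ cong (ℤ._+ (+ ((↥ p) ⁻) ℤ.+ + m ℤ.* ↧ p)) (trans (ℤP.*-identityʳ (↥ p)) (⁺-⁻ (↥ p))) ⟩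
  (+ ((↥ p) ⁺) ℤ.- + ((↥ p) ⁻)) ℤ.+ (+ ((↥ p) ⁻) ℤ.+ + m ℤ.* ↧ p)
    ≡⟨ solve 3 (λ a b c → a :+ c := (a :- b) :+ (b :+ c)) refl
         (+ ((↥ p) ⁺)) (+ ((↥ p) ⁻)) (+ m ℤ.* ↧ p) ⟨
  + ((↥ p) ⁺) ℤ.+ + m ℤ.* ↧ p
    ≡⟨ trans (ℤP.pos-+ ((↥ p) ⁺) _) (cong (λ e → + ((↥ p) ⁺) ℤ.+ e) (ℤP.pos-* m (↧ₙ p))) ⟨
  + ((↥ p) ⁺ ℕ.+ m ℕ.* ↧ₙ p) ∎)
  where
  open ℤP.≤-Reasoning
  open ℤSolver.+-*-Solver

^-regroup : ∀ d x m q r → x ℕ.^ q ℕ.* d ℕ.^ (r ℕ.+ m ℕ.* q) ≡ (x ℕ.* d ℕ.^ m) ℕ.^ q ℕ.* d ℕ.^ r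
^-regroup d x m q r = trans (cong (x ℕ.^ q ℕ.*_)
    (trans (ℕP.^-distribˡ-+-* d r (m ℕ.* q))
      (trans (ℕP.*-comm (d ℕ.^ r) _) (cong (ℕ._* d ℕ.^ r) (sym (ℕP.^-*-assoc d m q))))))
  (trans (sym (ℕP.*-assoc (x ℕ.^ q) _ (d ℕ.^ r)))
    (cong (ℕ._* d ℕ.^ r) (sym (^-distrib-* x (d ℕ.^ m) q))))

-- `powFloor` rounds down, so the bound by d to the power -m holds for every approximant and not
-- only in the limit.
powSeq-upper : ∀ d .{{_ : ℕ.NonZero d}} (x : ℕ → ℚ) m n → x n ℚ.≤ ℚ.- ι m →
  ι (d ℕ.^ m) ℚ.* powSeq d x n ℚ.≤ 1ℚ
powSeq-upper d x m n h = ℚP.≤-trans (ℚP.≤-reflexive (/-* (d ℕ.^ m) 0 j n))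
  (/-mono {d ℕ.^ m ℕ.* j} {1 ℕ.* suc n} {1} {1} (begin
    d ℕ.^ m ℕ.* j ℕ.* 1   ≡⟨ trans (ℕP.*-identityʳ _) (ℕP.*-comm (d ℕ.^ m) j) ⟩
    j ℕ.* d ℕ.^ m         ≤⟨ ^-cancelˡ-≤ q cancelled ⟩
    suc n                 ≡⟨ trans (ℕP.*-identityˡ (1 ℕ.* suc n)) (ℕP.*-identityˡ (suc n)) ⟨
    1 ℕ.* (1 ℕ.* suc n)   ∎))
  where
  open ℕP.≤-Reasoning
  a = ↥ x n
  q = ↧ₙ x n
  j = powFloor d (suc n) a q
  cancelled : (j ℕ.* d ℕ.^ m) ℕ.^ q ℕ.≤ suc n ℕ.^ q
  cancelled = ℕP.*-cancelʳ-≤ _ _ (d ℕ.^ a ⁺) {{ℕP.m^n≢0 d (a ⁺)}} (begin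
    (j ℕ.* d ℕ.^ m) ℕ.^ q ℕ.* d ℕ.^ a ⁺
      ≡⟨ ^-regroup d j m q (a ⁺) ⟨
    j ℕ.^ q ℕ.* d ℕ.^ (a ⁺ ℕ.+ m ℕ.* q)
      ≤⟨ ℕP.*-monoʳ-≤ (j ℕ.^ q) (ℕP.^-monoʳ-≤ d (exponent-upper (x n) m h)) ⟩
    j ℕ.^ q ℕ.* d ℕ.^ a ⁻
      ≤⟨ powFloor-lower d (suc n) a q ⟩
    suc n ℕ.^ q ℕ.* d ℕ.^ a ⁺ ∎)

powFloor≥ : ∀ d .{{_ : ℕ.NonZero d}} N p m → ℚ.- ι m ℚ.≤ p →
  N ℕ.≤ suc (powFloor d N (↥ p) (↧ₙ p)) ℕ.* d ℕ.^ m
powFloor≥ d N p m h = ^-cancelˡ-≤ q (ℕP.*-cancelʳ-≤ _ _ (d ℕ.^ a ⁺) {{ℕP.m^n≢0 d (a ⁺)}} (begin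
  N ℕ.^ q ℕ.* d ℕ.^ a ⁺
    ≤⟨ ℕP.<⇒≤ (powFloor-upper d N a q) ⟩
  J ℕ.^ q ℕ.* d ℕ.^ a ⁻
    ≤⟨ ℕP.*-monoʳ-≤ (J ℕ.^ q) (ℕP.^-monoʳ-≤ d (exponent-lower p m h)) ⟩
  J ℕ.^ q ℕ.* d ℕ.^ (a ⁺ ℕ.+ m ℕ.* q)
    ≡⟨ ^-regroup d J m q (a ⁺) ⟩
  (J ℕ.* d ℕ.^ m) ℕ.^ q ℕ.* d ℕ.^ a ⁺ ∎))
  where
  open ℕP.≤-Reasoning
  a = ↥ p
  q = ↧ₙ p
  J = suc (powFloor d N a q)

p≤ι∣↥p∣ : ∀ p → p ℚ.≤ ι ℤ.∣ ↥ p ∣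
p≤ι∣↥p∣ p@(ℚ.mkℚ (+ a) q _) = subst (ℚ._≤ ι a) (ℚP.↥p/↧p≡p p)
  (/-mono {a} {suc q} {a} {1} (ℕP.*-monoʳ-≤ a (ℕ.s≤s ℕ.z≤n)))
p≤ι∣↥p∣ p@(ℚ.mkℚ (ℤ.-[1+ a ]) q _) =
  ℚP.≤-trans (ℚP.<⇒≤ (ℚP.negative⁻¹ p)) (0≤ι (suc a))

-- An integer m bounds ∣x∣ eventually. Rounding down costs at most 1 in the numerator, which from N
-- = 2 dᵐ on is at most half of N / dᵐ; this leaves the gap 1/(2 dᵐ).
^-pos : ∀ d .{{_ : ℕ.NonZero d}} x → 0ℝ < d ^ x
^-pos d x =
  let B , _ , M , bx = bounded x
      m = ℤ.∣ ↥ B ∣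
      P = d ℕ.^ m
      2P≢0 = ℕP.m*n≢0 2 P {{_}} {{ℕP.m^n≢0 d m}}
  in mk< ((_/_ (+ 1) (2 ℕ.* P) {{2P≢0}}) ,
          ℚP.positive⁻¹ _ {{ℚP.normalize-pos 1 (2 ℕ.* P) {{2P≢0}}}} ,
          M ℕ.⊔ (2 ℕ.* P) , λ n N≤n → ℚP.≤-trans
            (ℚP.≤-reflexive (ℚP.+-identityˡ _))
            (/-mono {1} {2 ℕ.* P} {powFloor d (suc n) (↥ seq x n) (↧ₙ seq x n)} {suc n} {{2P≢0}}
              (half P (powFloor d (suc n) (↥ seq x n) (↧ₙ seq x n)) (suc n)
                (powFloor≥ d (suc n) (seq x n) m (lower {seq x n} (bx n (ℕP.m⊔n≤o⇒m≤o M (2 ℕ.* P) N≤n))))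
                (ℕP.≤-trans (ℕP.m⊔n≤o⇒n≤o M (2 ℕ.* P) N≤n) (ℕP.n≤1+n n)))))
  where
  open ℚSolver.+-*-Solver using (solve; _:=_; :-_)
  lower : ∀ {p B} → ℚ.∣ p ∣ ℚ.≤ B → ℚ.- ι ℤ.∣ ↥ B ∣ ℚ.≤ p
  lower {p} {B} h = subst (ℚ.- ι ℤ.∣ ↥ B ∣ ℚ.≤_) (solve 1 (λ p → :- (:- p) := p) refl p)
    (ℚP.neg-antimono-≤ (ℚP.≤-trans (p≤∣p∣ (ℚ.- p))
      (ℚP.≤-trans (ℚP.≤-reflexive (ℚP.∣-p∣≡∣p∣ p)) (ℚP.≤-trans h (p≤ι∣↥p∣ B)))))

  half : ∀ P j N → N ℕ.≤ suc j ℕ.* P → 2 ℕ.* P ℕ.≤ N → 1 ℕ.* N ℕ.≤ j ℕ.* (2 ℕ.* P)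
  half P j N h h′ = ℕP.+-cancelʳ-≤ N (1 ℕ.* N) (j ℕ.* (2 ℕ.* P)) (begin
    1 ℕ.* N ℕ.+ N             ≡⟨ ℕS.solve 1 (λ N → ℕS.con 1 ℕS.:* N ℕS.:+ N ℕS.:= ℕS.con 2 ℕS.:* N) refl N ⟩
    2 ℕ.* N                   ≤⟨ ℕP.*-monoʳ-≤ 2 h ⟩
    2 ℕ.* (suc j ℕ.* P)       ≡⟨ ℕS.solve 2 (λ j P → ℕS.con 2 ℕS.:* ((ℕS.con 1 ℕS.:+ j) ℕS.:* P)
                                   ℕS.:= j ℕS.:* (ℕS.con 2 ℕS.:* P) ℕS.:+ ℕS.con 2 ℕS.:* P) refl j P ⟩
    j ℕ.* (2 ℕ.* P) ℕ.+ 2 ℕ.* P ≤⟨ ℕP.+-monoʳ-≤ (j ℕ.* (2 ℕ.* P)) h′ ⟩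
    j ℕ.* (2 ℕ.* P) ℕ.+ N     ∎)
    where
    open ℕP.≤-Reasoning
    module ℕS = ℕSolver.+-*-Solver

0<fromℚ : ∀ {p} → 0ℚ ℚ.< p → 0ℝ < fromℚ p
0<fromℚ {p} 0<p = mk< (p , 0<p , 0 , λ _ _ → ℚP.≤-reflexive (ℚP.+-identityˡ p))

0<* : ∀ {x y} → 0ℝ < x → 0ℝ < y → 0ℝ < x * y
0<* {x} {y} h h′ =
  let p , 0<p , M , f = eventually-< h
      q , 0<q , N , g = eventually-< h′
  in mk< (p ℚ.* q , *-pos 0<p 0<q , M ℕ.⊔ N , λ n M≤n →
       let p≤x = subst (ℚ._≤ seq x n) (ℚP.+-identityˡ p) (f n (ℕP.m⊔n≤o⇒m≤o M N M≤n))
           q≤y = subst (ℚ._≤ seq y n) (ℚP.+-identityˡ q) (g n (ℕP.m⊔n≤o⇒n≤o M N M≤n))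
       in ℚP.≤-trans (ℚP.≤-reflexive (ℚP.+-identityˡ (p ℚ.* q)))
            (≤-*-mono (ℚP.<⇒≤ 0<q) (ℚP.≤-trans (ℚP.<⇒≤ 0<p) p≤x) p≤x q≤y))

0<η₀ : ∀ d .{{_ : ℕ.NonZero d}} → 0ℝ < η₀ d
0<η₀ d = 0<* (0<fromℚ (0<1/ 3)) (^-pos d (- (1ℝ + log₂ d)))

0<ε₀ : ∀ d .{{_ : ℕ.NonZero d}} → 0ℝ < ε₀ d
0<ε₀ d = 0<* (^-pos 200 (- fromℕ (suc d))) (^-pos d (- (fromℕ (suc d) * (log₂ d + fromℕ 3))))

-- From 2ᴺ ≤ dᴺ the floor of N log₂ d is at least N, so every approximant respects log₂ d ≥ 1. This
-- pushes the exponent of `η₀` down to -2 or below.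
1≤logSeq : ∀ d → 2 ℕ.≤ d → ∀ n → 1ℚ ℚ.≤ logSeq d n
1≤logSeq d 2≤d n = /-mono {1} {1} {logFloor d (suc n)} {suc n}
  (subst₂ ℕ._≤_ (sym (ℕP.*-identityˡ (suc n))) (sym (ℕP.*-identityʳ (logFloor d (suc n))))
    (ℕP.≤-pred (^-cancelʳ-< 2
      (ℕP.≤-<-trans (ℕP.^-monoˡ-≤ (suc n) 2≤d) (logFloor-upper d (suc n))))))

η₀-upper : ∀ d .{{_ : ℕ.NonZero d}} → 2 ℕ.≤ d → ∀ c → ι 4 ℚ.* (ι d ℚ.* ι d) ℚ.* c ≡ 1ℚ →
  ∀ n → seq (η₀ d) n ℚ.≤ c
η₀-upper d 2≤d c eq n = *-cancel-≤ M 0<M (begin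
  M ℚ.* ((+ 1 / 4) ℚ.* p)
    ≡⟨ solve 2 (λ D p → con (ι 4) :* (D :* D) :* (con (+ 1 / 4) :* p) := D :* D :* p) refl (ι d) p ⟩
  ι d ℚ.* ι d ℚ.* p
    ≡⟨ cong (ℚ._* p) (trans (ι-* d (d ℕ.* 1)) (cong (λ e → ι d ℚ.* ι e) (ℕP.*-identityʳ d))) ⟨
  ι (d ℕ.^ 2) ℚ.* p
    ≤⟨ powSeq-upper d (seq (- (1ℝ + log₂ d))) 2 n
         (ℚP.neg-antimono-≤ (ℚP.+-monoʳ-≤ 1ℚ (1≤logSeq d 2≤d n))) ⟩
  1ℚ
    ≡⟨ eq ⟨
  M ℚ.* c ∎)
  where
  open ℚP.≤-Reasoning
  open ℚSolver.+-*-Solver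
  M = ι 4 ℚ.* (ι d ℚ.* ι d)
  p = powSeq d (seq (- (1ℝ + log₂ d))) n
  0<ιd : 0ℚ ℚ.< ι d
  0<ιd = 0<ι {d} (ℕP.≤-trans (ℕ.s≤s ℕ.z≤n) 2≤d)
  0<M : 0ℚ ℚ.< M
  0<M = *-pos {ι 4} (0<ι {4} (ℕ.s≤s ℕ.z≤n)) (*-pos 0<ιd 0<ιd)

0≤powSeq : ∀ d x n → 0ℚ ℚ.≤ powSeq d x n
0≤powSeq d x n = 0≤/ (powFloor d (suc n) (↥ x n) (↧ₙ x n)) n

-- The exponent of 200 is at most -1 and that of d at most 0. The target ½ is the constant of the
-- case where all a i vanish.
ε₀-upper : ∀ d .{{_ : ℕ.NonZero d}} n → seq (ε₀ d) n ℚ.≤ ½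
ε₀-upper d n = begin
  p ℚ.* q           ≤⟨ *-mono-≤ p (0≤powSeq 200 (seq (- fromℕ (suc d))) n) q≤1 ⟩
  p ℚ.* 1ℚ          ≡⟨ ℚP.*-identityʳ p ⟩
  p                 ≤⟨ *-cancel-≤ (ι 2) (0<ι {2} (ℕ.s≤s ℕ.z≤n)) 2p≤1 ⟩
  ½                 ∎
  where
  open ℚP.≤-Reasoning
  e = - (fromℕ (suc d) * (log₂ d + fromℕ 3))
  p = powSeq 200 (seq (- fromℕ (suc d))) n
  q = powSeq d (seq e) n
  2p≤1 : ι 2 ℚ.* p ℚ.≤ ι 2 ℚ.* ½
  2p≤1 = ℚP.≤-trans
    (ℚP.*-monoʳ-≤-nonNeg p {{ℚ.nonNegative (0≤powSeq 200 (seq (- fromℕ (suc d))) n)}} (ι-mono {2} {200} (ℕ.s≤s (ℕ.s≤s ℕ.z≤n))))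
    (powSeq-upper 200 (seq (- fromℕ (suc d))) 1 n
      (ℚP.neg-antimono-≤ (ι-mono {1} {suc d} (ℕ.s≤s ℕ.z≤n))))
  q≤1 : q ℚ.≤ 1ℚ
  q≤1 = ℚP.≤-trans (ℚP.≤-reflexive (sym (ℚP.*-identityˡ q)))
    (powSeq-upper d (seq e) 0 n (ℚP.neg-antimono-≤
      (*-nonneg (0≤ι (suc d)) (+-nonneg {logSeq d n} (0≤/ (logFloor d (suc n)) n) (0≤ι 3)))))

-- Eigenvalues

ℝ-preorder : Preorder _ _ _
ℝ-preorder = record
  { Carrier = ℝ ; _≈_ = _≈_ ; _≲_ = _≤_
  ; isPreorder = record
    { isEquivalence = record { refl = λ {x} → ≈-refl {x} ; sym = ≈-sym ; trans = ≈-trans }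
    ; reflexive = proj₁
    ; trans = ≤-trans } }

module ≤-Reasoning where
  open import Relation.Binary.Reasoning.Preorder ℝ-preorder public

Σ-lin : ∀ {n} r s (f g : Fin n → ℚ) →
  Σℚ (λ u → r ℚ.* f u ℚ.- s ℚ.* g u) ≡ r ℚ.* Σℚ f ℚ.- s ℚ.* Σℚ g
Σ-lin r s f g = trans
  (Σ-cong λ u → cong (r ℚ.* f u ℚ.+_) (ℚP.neg-distribˡ-* s (g u)))
  (trans (Σ-+ (λ u → r ℚ.* f u) (λ u → (ℚ.- s) ℚ.* g u))
    (cong₂ ℚ._+_ (Σ-*ˡ r f) (trans (Σ-*ˡ (ℚ.- s) g) (sym (ℚP.neg-distribˡ-* s (Σℚ g))))))

∑-lin : ∀ {n} α β (f g : Fin n → ℝ) → ∑ (λ u → α * f u - β * g u) ≈ α * ∑ f - β * ∑ g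
∑-lin α β f g = pointwise-≈ {∑ λ u → α * f u - β * g u} {α * ∑ f - β * ∑ g} λ m → trans
  (seq-∑ (λ u → α * f u - β * g u) m)
  (trans (Σ-lin (seq α m) (seq β m) (λ u → seq (f u) m) (λ u → seq (g u) m))
    (cong₂ (λ e e′ → seq α m ℚ.* e ℚ.- seq β m ℚ.* e′) (sym (seq-∑ f m)) (sym (seq-∑ g m))))

⟨,⟩-cong : ∀ {n} (w : Fin n → ℝ) {f g} → (∀ u → f u ≈ g u) → ⟨ w , f ⟩ ≈ ⟨ w , g ⟩
⟨,⟩-cong w h = ∑-cong λ u → *-congˡ (w u) (h u)

⟨,⟩-lin : ∀ {n} α β (w f g : Fin n → ℝ) →
  ⟨ w , (λ u → α * f u - β * g u) ⟩ ≈ α * ⟨ w , f ⟩ - β * ⟨ w , g ⟩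
⟨,⟩-lin α β w f g = ≈-trans
  (∑-cong λ u → pointwise-≈ {w u * (α * f u - β * g u)} {α * (w u * f u) - β * (w u * g u)} λ m →
    solve 5 (λ w a f b g → w :* (a :* f :- b :* g) := a :* (w :* f) :- b :* (w :* g)) refl
      (seq (w u) m) (seq α m) (seq (f u) m) (seq β m) (seq (g u) m))
  (∑-lin α β (λ u → w u * f u) (λ u → w u * g u))
  where open ℚSolver.+-*-Solver

⟨,⟩-scale : ∀ {n} θ (w f : Fin n → ℝ) → ⟨ w , (λ u → θ * f u) ⟩ ≈ θ * ⟨ w , f ⟩
⟨,⟩-scale θ w f = pointwise-≈ {⟨ w , (λ u → θ * f u) ⟩} {θ * ⟨ w , f ⟩} λ m → trans
  (seq-∑ (λ u → w u * (θ * f u)) m)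
  (trans (Σ-cong λ u → solve 3 (λ w t f → w :* (t :* f) := t :* (w :* f)) refl
           (seq (w u) m) (seq θ m) (seq (f u) m))
    (trans (Σ-*ˡ (seq θ m) (λ u → seq (w u) m ℚ.* seq (f u) m))
      (cong (seq θ m ℚ.*_) (sym (seq-∑ (λ u → w u * f u) m)))))
  where open ℚSolver.+-*-Solver

⟨,⟩-comm : ∀ {n} (f g : Fin n → ℝ) → ⟨ f , g ⟩ ≈ ⟨ g , f ⟩
⟨,⟩-comm f g = ∑-cong λ u → *-comm (f u) (g u)

unit : ∀ {n} → Fin n → Fin n → ℝ
unit i j = fromℚ (𝟙 (i Fin.≟ j))

⟨,unit⟩ : ∀ {n} (f : Fin n → ℝ) i → ⟨ f , unit i ⟩ ≈ f i
⟨,unit⟩ f i = pointwise-≈ {⟨ f , unit i ⟩} {f i} λ m → trans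
  (seq-∑ (λ j → f j * unit i j) m)
  (trans (Σ-single (λ j → seq (f j) m ℚ.* 𝟙 (i Fin.≟ j)) i λ j j≢i →
      trans (cong (seq (f j) m ℚ.*_) (𝟙-false (i Fin.≟ j) (j≢i ∘ sym))) (ℚP.*-zeroʳ (seq (f j) m)))
    (trans (cong (seq (f i) m ℚ.*_) (𝟙-true (i Fin.≟ i) refl)) (ℚP.*-identityʳ (seq (f i) m))))

-- A zero member would make the coefficients `unit i` a vanishing combination, forcing 1 ≈ 0.
independent⇒≉0 : ∀ {m n} {x : Fin m → Fin n → ℝ} → LinearlyIndependent x →
  ∀ i → ¬ (∀ u → x i u ≈ 0ℝ)
independent⇒≉0 {x = x} indep i xᵢ≈0 = 1≰0 (≤-trans
  (pointwise-≤ {1ℝ} {unit i i} (λ _ → ℚP.≤-reflexive (sym (𝟙-true (i Fin.≟ i) refl))))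
  (proj₁ (indep (unit i) (λ u → ≈-trans (⟨,⟩-comm (unit i) (λ j → x j u))
    (≈-trans (⟨,unit⟩ (λ j → x j u) i) (xᵢ≈0 u))) i)))

-- Independence is tested on α times the i-th unit family minus β times the j-th; as i ≠ j, its i-th
-- entry is α.
independent⇒coefficient≈0 : ∀ {m n} {x : Fin m → Fin n → ℝ} → LinearlyIndependent x →
  ∀ {i j} → i ≢ j → ∀ α β → (∀ u → α * x i u - β * x j u ≈ 0ℝ) → α ≈ 0ℝ
independent⇒coefficient≈0 {x = x} indep {i} {j} i≢j α β h = ≈-trans
  (pointwise-≈ {α} {s i} λ m → sym (trans
    (cong₂ (λ e e′ → seq α m ℚ.* e ℚ.- seq β m ℚ.* e′)
      (𝟙-true (i Fin.≟ i) refl) (𝟙-false (j Fin.≟ i) (i≢j ∘ sym)))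
    (solve 2 (λ a b → a :* con 1ℚ :- b :* con 0ℚ := a) refl (seq α m) (seq β m))))
  (indep s (λ u → ≈-trans (⟨,⟩-comm s (λ l → x l u))
    (≈-trans (⟨,⟩-lin α β (λ l → x l u) (unit i) (unit j))
      (≈-trans (+-cong (*-congˡ α (⟨,unit⟩ (λ l → x l u) i))
                       (neg-cong (*-congˡ β (⟨,unit⟩ (λ l → x l u) j))))
        (h u)))) i)
  where
  open ℚSolver.+-*-Solver
  s = λ l → α * unit i l - β * unit j l

x-y≈0 : ∀ {x y} → x ≈ y → x - y ≈ 0ℝ
x-y≈0 {x} {y} h = ≈-trans (+-cong h (≈-refl { - y}))
  (pointwise-≈ {y - y} {0ℝ} λ m → ℚP.+-inverseʳ (seq y m))

-- The vector z = α x - β y need not be an eigenvector, but ⟨ x , y ⟩ ≈ 0 unless the two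
-- eigenvalues agree, so its Rayleigh quotient is at least the smaller eigenvalue θ.
rayleigh : ∀ {n} (A : Matrix n) → (∀ u v → A u v ≡ A v u) → ∀ {θ θ′} (x y : Fin n → ℝ) →
  (∀ u → (A ·ᵥ x) u ≈ θ′ * x u) → (∀ u → (A ·ᵥ y) u ≈ θ * y u) → θ ≤ θ′ → ∀ α β →
  let z = λ u → α * x u - β * y u in θ * ⟨ z , z ⟩ ≤ ⟨ z , A ·ᵥ z ⟩
rayleigh {n} A A-sym {θ} {θ′} x y Ax Ay θ≤θ′ α β = begin
  θ * ⟨ z , z ⟩
    -- ⟨z, A z⟩ exceeds θ ⟨z, z⟩ by α (θ′ - θ) ⟨z, x⟩, which equals (θ′ - θ) w with w = α² ⟨x, x⟩ up
    -- to a multiple of (θ′ - θ) ⟨x, y⟩ ≈ 0. So it suffices to add θ w - θ w and raise one θ to θ′.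
    ≈⟨ pointwise-≈ {θ * ⟨ z , z ⟩} {θ * ⟨ z , z ⟩ + (θ * w - θ * w)} (λ m →
         solve 2 (λ a b → a := a :+ (b :- b)) refl (seq (θ * ⟨ z , z ⟩) m) (seq (θ * w) m)) ⟩
  θ * ⟨ z , z ⟩ + (θ * w - θ * w)
    ≲⟨ +-mono (≤-refl {θ * ⟨ z , z ⟩}) (+-mono (*-monoʳ-≤-pointwise w 0≤w θ≤θ′) (≤-refl { - (θ * w)})) ⟩
  θ * ⟨ z , z ⟩ + (θ′ * w - θ * w)
    ≈⟨ +-cong (*-congˡ θ (⟨,⟩-lin α β z x y)) (≈-refl {θ′ * w - θ * w}) ⟩
  θ * (α * Zx - β * Zy) + (θ′ * w - θ * w)
    ≈⟨ pointwise-≈ {θ * (α * Zx - β * Zy) + (θ′ * w - θ * w)}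
         {θ * (α * Zx - β * Zy) + (α * ((θ′ - θ) * (α * P - β * R)) + (α * β) * (θ′ * R - θ * R))} (λ m →
         solve 8 (λ t t′ a b zx zy p r → t :* (a :* zx :- b :* zy) :+ (t′ :* (a :* a :* p) :- t :* (a :* a :* p))
             := t :* (a :* zx :- b :* zy) :+
                (a :* ((t′ :- t) :* (a :* p :- b :* r)) :+ (a :* b) :* (t′ :* r :- t :* r))) refl
           (seq θ m) (seq θ′ m) (seq α m) (seq β m) (seq Zx m) (seq Zy m) (seq P m) (seq R m)) ⟩
  θ * (α * Zx - β * Zy) + (α * ((θ′ - θ) * (α * P - β * R)) + (α * β) * (θ′ * R - θ * R))
    ≈⟨ +-cong (≈-refl {θ * (α * Zx - β * Zy)}) (+-cong
         (*-congˡ α (*-congˡ (θ′ - θ) (≈-sym Zx≈)))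
         (≈-trans (*-congˡ (α * β) (x-y≈0 orthogonal)) (*-zeroʳ (α * β)))) ⟩
  θ * (α * Zx - β * Zy) + (α * ((θ′ - θ) * Zx) + 0ℝ)
    ≈⟨ pointwise-≈ {θ * (α * Zx - β * Zy) + (α * ((θ′ - θ) * Zx) + 0ℝ)} {α * (θ′ * Zx) - β * (θ * Zy)} (λ m →
         solve 6 (λ t t′ a b zx zy → t :* (a :* zx :- b :* zy) :+ (a :* ((t′ :- t) :* zx) :+ con 0ℚ)
             := a :* (t′ :* zx) :- b :* (t :* zy)) refl
           (seq θ m) (seq θ′ m) (seq α m) (seq β m) (seq Zx m) (seq Zy m)) ⟩
  α * (θ′ * Zx) - β * (θ * Zy)
    ≈⟨ +-cong (*-congˡ α (⟨,⟩-scale θ′ z x)) (neg-cong (*-congˡ β (⟨,⟩-scale θ z y))) ⟨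
  α * ⟨ z , (λ u → θ′ * x u) ⟩ - β * ⟨ z , (λ u → θ * y u) ⟩
    ≈⟨ ⟨,⟩-lin α β z (λ u → θ′ * x u) (λ u → θ * y u) ⟨
  ⟨ z , (λ u → α * (θ′ * x u) - β * (θ * y u)) ⟩
    ≈⟨ ⟨,⟩-cong z (λ u → ≈-trans (⟨,⟩-lin α β (A u) x y)
         (+-cong (*-congˡ α (Ax u)) (neg-cong (*-congˡ β (Ay u))))) ⟨
  ⟨ z , A ·ᵥ z ⟩ ∎
  where
  open ≤-Reasoning
  open ℚSolver.+-*-Solver
  z = λ u → α * x u - β * y u
  Zx = ⟨ z , x ⟩
  Zy = ⟨ z , y ⟩
  P = ⟨ x , x ⟩
  R = ⟨ x , y ⟩
  w = α * α * P
  0≤w : ∀ m → 0ℚ ℚ.≤ seq w m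
  0≤w m = *-nonneg (0≤p² (seq α m)) (0≤⟨x,x⟩ x m)
  Zx≈ : Zx ≈ α * P - β * R
  Zx≈ = ≈-trans (⟨,⟩-comm z x) (⟨,⟩-lin α β x x y)
  selfadjoint : ⟨ y , A ·ᵥ x ⟩ ≈ ⟨ x , A ·ᵥ y ⟩
  selfadjoint = pointwise-≈ {⟨ y , A ·ᵥ x ⟩} {⟨ x , A ·ᵥ y ⟩} λ m → trans (double y x m)
    (trans (Σ-swap λ u v → seq (y u) m ℚ.* (seq (A u v) m ℚ.* seq (x v) m))
    (trans (Σ-cong λ v → Σ-cong λ u → trans
        (cong (λ e → seq (y u) m ℚ.* (seq e m ℚ.* seq (x v) m)) (A-sym u v))
        (solve 3 (λ y a x → y :* (a :* x) := x :* (a :* y)) refl (seq (y u) m) (seq (A v u) m) (seq (x v) m)))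
      (sym (double x y m))))
    where
    double : ∀ f g m → seq ⟨ f , A ·ᵥ g ⟩ m ≡
      Σℚ λ u → Σℚ λ v → seq (f u) m ℚ.* (seq (A u v) m ℚ.* seq (g v) m)
    double f g m = trans (seq-∑ (λ u → f u * (A ·ᵥ g) u) m)
      (Σ-cong λ u → trans (cong (seq (f u) m ℚ.*_) (seq-∑ (λ v → A u v * g v) m))
        (sym (Σ-*ˡ (seq (f u) m) (λ v → seq (A u v) m ℚ.* seq (g v) m))))
  -- Orthogonality in a form without division: whether the two eigenvalues agree cannot be decided.
  orthogonal : θ′ * R ≈ θ * R
  orthogonal = begin-equality
    θ′ * R                          ≈⟨ *-congˡ θ′ (⟨,⟩-comm x y) ⟩
    θ′ * ⟨ y , x ⟩                  ≈⟨ ⟨,⟩-scale θ′ y x ⟨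
    ⟨ y , (λ u → θ′ * x u) ⟩        ≈⟨ ⟨,⟩-cong y Ax ⟨
    ⟨ y , A ·ᵥ x ⟩                  ≈⟨ selfadjoint ⟩
    ⟨ x , A ·ᵥ y ⟩                  ≈⟨ ⟨,⟩-cong x Ay ⟩
    ⟨ x , (λ u → θ * y u) ⟩         ≈⟨ ⟨,⟩-scale θ x y ⟩
    θ * R                           ∎

first : ∀ {n} → Fin n → Fin n
first {suc n} _ = zero

first≤ : ∀ {n} (i : Fin n) → first i Fin.≤ i
first≤ {suc n} i = ℕ.z≤n

first≢ : ∀ {n} (i : Fin n) → 1 ℕ.≤ toℕ i → first i ≢ i
first≢ (suc i) _ ()

-- The two alternatives for a given graph

module Spectral {n d} (X : Graph n) {a b c : Fin (suc d) → ℕ}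
  (reg : IsDistanceRegular X d a b c) (2≤d : 2 ℕ.≤ d)
  (e : ℚ) (4d²e≡1 : ι 4 ℚ.* (ι d ℚ.* ι d) ℚ.* e ≡ 1ℚ) where

  open Radial X reg
  open QuadraticForm X reg

  A : Matrix n
  A = adjacencyMatrix X

  A-sym : ∀ u v → A u v ≡ A v u
  A-sym u v = cong (if_then 1ℝ else 0ℝ) (adj-sym X u v)

  κ : ℚ
  κ = K e 4d²e≡1 2≤d

  seq-A : ∀ u v m → seq (A u v) m ≡ δ 1 u v
  seq-A u v m with adj X u v in eq
  ... | true  = sym (𝟙-true (dist u v ℕ.≟ 1) (Adj⇒dist≡1 (subst T (sym eq) _)))
  ... | false = sym (𝟙-false (dist u v ℕ.≟ 1) λ h → subst T eq (dist≡1⇒Adj h))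

  -- The entries of A are constant sequences, so approximants of the real form are the rational form
  -- at the approximants of z.
  seq-form : ∀ (z : Fin n → ℝ) m → seq ⟨ z , A ·ᵥ z ⟩ m ≡ form (λ u → seq (z u) m)
  seq-form z m = trans (seq-∑ (λ u → z u * (A ·ᵥ z) u) m)
    (Σ-cong λ u → cong (seq (z u) m ℚ.*_) (trans (seq-∑ (λ v → A u v * z v) m)
      (Σ-cong λ v → cong (ℚ._* seq (z v) m) (seq-A u v m))))

  -- The approximants of z have sums that only tend to 0; the error term of `form-upper` becomes k
  -- (∑ z)², which is 0 in ℝ.
  upper : ∀ (z : Fin n → ℝ) → ∑ z ≈ 0ℝ → ⟨ z , A ·ᵥ z ⟩ ≤ fromℚ κ * ⟨ z , z ⟩
  upper z Σz≈0 = begin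
    ⟨ z , A ·ᵥ z ⟩
      ≲⟨ pointwise-≤ {⟨ z , A ·ᵥ z ⟩} {fromℚ κ * ⟨ z , z ⟩ + fromℚ k * (∑ z * ∑ z)} (λ m →
           subst₂ ℚ._≤_ (sym (seq-form z m))
             (cong₂ (λ q s → κ ℚ.* q ℚ.+ k ℚ.* (s ℚ.* s))
               (sym (seq-∑ (λ u → z u * z u) m)) (sym (seq-∑ z m)))
             (form-upper e 4d²e≡1 2≤d (λ u → seq (z u) m))) ⟩
    fromℚ κ * ⟨ z , z ⟩ + fromℚ k * (∑ z * ∑ z)
      ≈⟨ +-cong (≈-refl {fromℚ κ * ⟨ z , z ⟩}) (≈-trans
           (*-congˡ (fromℚ k) (≈-trans (*-congˡ (∑ z) Σz≈0) (*-zeroʳ (∑ z)))) (*-zeroʳ (fromℚ k))) ⟩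
    fromℚ κ * ⟨ z , z ⟩ + 0ℝ
      ≈⟨ pointwise-≈ {fromℚ κ * ⟨ z , z ⟩ + 0ℝ} {fromℚ κ * ⟨ z , z ⟩}
           (λ m → ℚP.+-identityʳ (seq (fromℚ κ * ⟨ z , z ⟩) m)) ⟩
    fromℚ κ * ⟨ z , z ⟩ ∎
    where open ≤-Reasoning

  lower : ∀ m → m ℕ.≤ d → 0ℚ ℚ.< α m → ∀ (z : Fin n → ℝ) → - ⟨ z , A ·ᵥ z ⟩ ≤ fromℚ κ * ⟨ z , z ⟩
  lower m m≤d 0<α z = pointwise-≤ { - ⟨ z , A ·ᵥ z ⟩} {fromℚ κ * ⟨ z , z ⟩} λ l →
    subst₂ ℚ._≤_ (cong ℚ.-_ (sym (seq-form z l))) (cong (κ ℚ.*_) (sym (seq-∑ (λ u → z u * z u) l)))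
      (form-lower e 4d²e≡1 2≤d m m≤d 0<α (λ u → seq (z u) l))

  vanish : ∀ {θ} (z : Fin n → ℝ) → fromℚ κ < θ → θ * ⟨ z , z ⟩ ≤ fromℚ κ * ⟨ z , z ⟩ → ∀ u → z u ≈ 0ℝ
  vanish z κ<θ h = ⟨x,x⟩≤0⇒x≈0 z (x<y∧yz≤xz⇒z≤0 ⟨ z , z ⟩ (0≤⟨x,x⟩ z) κ<θ h)

  module _ {ξ : Fin n → ℝ} (spectrum : IsSpectrum A ξ) where
    open IsSpectrum spectrum

    -- Suppose κ < ξ i. The combination z of the first eigenvector x and of y has sum 0 and Rayleigh
    -- quotient at least ξ i, so z ≈ 0. By independence its coefficient ∑ y is 0; hence y has sum 0
    -- itself, and the same bound makes y vanish.
    eigenvalue-upper : ∀ i → 1 ℕ.≤ toℕ i → ξ i ≤ fromℚ κ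
    eigenvalue-upper i 1≤i = ≮⇒≥ λ κ<ξ →
      let z≈0 = vanish z κ<ξ (≤-trans
            (rayleigh A A-sym x y (eigenvectors o) (eigenvectors i) (sorted o i (first≤ i)) (∑ y) (∑ x))
            (upper z Σz≈0))
          Σy≈0 = independent⇒coefficient≈0 {x = vectors} independent (first≢ i 1≤i) (∑ y) (∑ x) z≈0
          y≈0 = vanish y κ<ξ (≤-trans
            (proj₁ (≈-sym (≈-trans (⟨,⟩-cong y (eigenvectors i)) (⟨,⟩-scale (ξ i) y y))))
            (upper y Σy≈0))
      in independent⇒≉0 {x = vectors} independent i y≈0
      where
      o = first i
      x = vectors o
      y = vectors i
      z = λ u → ∑ y * x u - ∑ x * y u
      Σz≈0 : ∑ z ≈ 0ℝ
      Σz≈0 = ≈-trans (∑-lin (∑ y) (∑ x) x y) (x-y≈0 (*-comm (∑ y) (∑ x)))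

    -- The lower form bound holds for all vectors, so the eigenvector is inserted directly, the
    -- first one included.
    eigenvalue-lower : ∀ m → m ℕ.≤ d → 0ℚ ℚ.< α m → ∀ i → - ξ i ≤ fromℚ κ
    eigenvalue-lower m m≤d 0<α i = ≮⇒≥ λ κ<-ξ → independent⇒≉0 {x = vectors} independent i
      (vanish y κ<-ξ (≤-trans
        (proj₁ (≈-trans
          (pointwise-≈ { - ξ i * ⟨ y , y ⟩} { - (ξ i * ⟨ y , y ⟩)} λ l →
            sym (ℚP.neg-distribˡ-* (seq (ξ i) l) (seq ⟨ y , y ⟩ l)))
          (neg-cong (≈-sym (≈-trans (⟨,⟩-cong y (eigenvectors i)) (⟨,⟩-scale (ξ i) y y))))))
        (lower m m≤d 0<α y)))
      where y = vectors i

  spectral-gap : ∀ {η} → (∀ m → seq η m ℚ.≤ e) → ∀ m → m ℕ.≤ d → 0ℚ ℚ.< α m →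
    SpectralGap η X (b zero)
  spectral-gap {η} η≤e m m≤d 0<α ρ (ξ , spectrum , (i , 1≤i , ρ≈) , _) = ≤-trans (proj₁ ρ≈)
    (≤-trans (∣x∣≤y (eigenvalue-upper spectrum i 1≤i) (eigenvalue-lower spectrum m m≤d 0<α i))
      (pointwise-≤ {fromℚ κ} {fromℕ (b zero) * (1ℝ - η)} λ l →
        *-mono-≤ k 0≤k (ℚP.+-monoʳ-≤ 1ℚ (ℚP.neg-antimono-≤ (η≤e l)))))

  large-intersection-numbers : ∀ {ε} → (∀ m → seq ε m ℚ.≤ ½) → (∀ i → a i ≡ 0) →
    LargeIntersectionNumbers ε b c
  large-intersection-numbers {ε} ε≤½ a≡0 =
    let i , bᵢ , cᵢ = decidable-stable (FinP.any? large?) impossible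
    in i , bound (b (inject₁ i)) bᵢ , bound (c (suc i)) cᵢ
    where
    bound : ∀ x → ½ ℚ.* k ℚ.≤ ι x → ε * fromℕ (b zero) ≤ fromℕ x
    bound x h = pointwise-≤ {ε * fromℕ (b zero)} {fromℕ x} λ l →
      ℚP.≤-trans (ℚP.*-monoʳ-≤-nonNeg k {{ℚ.nonNegative 0≤k}} (ε≤½ l)) h

    large? : ∀ (i : Fin d) → Dec (½ ℚ.* k ℚ.≤ ι (b (inject₁ i)) × ½ ℚ.* k ℚ.≤ ι (c (suc i)))
    large? i = (½ ℚ.* k ℚ.≤? ι (b (inject₁ i))) ×-dec (½ ℚ.* k ℚ.≤? ι (c (suc i)))

    -- The neighbour sum of the constant profile 1 at a pair at distance i is c i + a i + b i, and
    -- also the degree.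
    sum : ∀ i → ι (c i) ℚ.+ ι (b i) ≡ k
    sum i =
      let v , w , vw = pair-at-distance (toℕ i) (ℕP.≤-pred (FinP.toℕ<n i)) in
      trans (cong₂ ℚ._+_ (trans (sym (extend-toℕ 1ℚ c i)) (pad (γ (toℕ i))))
                         (trans (sym (extend-toℕ 0ℚ b i)) (sym (ℚP.*-identityʳ (β (toℕ i))))))
      (trans (cong (λ z → γ (toℕ i) ℚ.* 1ℚ ℚ.+ z ℚ.* 1ℚ ℚ.+ β (toℕ i) ℚ.* 1ℚ)
               (sym (trans (extend-toℕ 0ℚ a i) (cong ι (a≡0 i)))))
      (trans (cong (step (λ _ → 1ℚ)) (sym vw))
      (trans (sym (Σ-neighbours (λ _ → 1ℚ) v w))
      (trans (Σ-cong λ u → ℚP.*-identityʳ (δ 1 w u)) (degree w)))))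
      where
      open Variation X reg 1ℚ refl (λ _ → 0ℚ) using (degree)
      pad : ∀ r → r ≡ r ℚ.* 1ℚ ℚ.+ 0ℚ ℚ.* 1ℚ
      pad r = sym (trans (ℚP.+-identityʳ (r ℚ.* 1ℚ)) (ℚP.*-identityʳ r))

    b-last : ι (b (Fin.fromℕ d)) ≡ 0ℚ
    b-last = let v , w , D = proj₁ diameter in Exactly-∅
      (b-count (Fin.fromℕ d) v w (subst (Dist X v w) (sym (FinP.toℕ-fromℕ d)) D))
      λ u (_ , D′) → ℕP.1+n≰n (ℕP.≤-trans
        (ℕP.≤-reflexive (cong suc (sym (FinP.toℕ-fromℕ d)))) (proj₂ diameter v u _ D′))
      where open IsDistanceRegular reg

    impossible : ¬ ¬ (∃[ i ] ½ ℚ.* k ℚ.≤ ι (b (inject₁ i)) × ½ ℚ.* k ℚ.≤ ι (c (suc i)))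
    impossible none =
      -- At the end b d = 0, so c d = k; with `large-b` the index d - 1 is good after all.
      let i , eq = last d (ℕP.≤-trans (ℕ.s≤s ℕ.z≤n) 2≤d) in
      none (i , large-b (inject₁ i) , subst (½ ℚ.* k ℚ.≤_)
        (sym (trans (sym (trans (cong (ι (c (suc i)) ℚ.+_) (trans (cong (ι ∘ b) eq) b-last))
                                (ℚP.+-identityʳ (ι (c (suc i))))))
                    (sum (suc i))))
        ½k≤k)
      where
      open ℚSolver.+-*-Solver
      ½k≤k : ½ ℚ.* k ℚ.≤ k
      ½k≤k = ≤-by-diff (½ ℚ.* k) (*-nonneg (ℚP.<⇒≤ (ℚP.positive⁻¹ ½)) 0≤k) (sym (½+½ k))
      last : ∀ d → 1 ℕ.≤ d → ∃[ i ] suc i ≡ Fin.fromℕ d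
      last (suc d) _ = Fin.fromℕ d , refl
      -- If no index is good, b i ≥ k/2 forces c (i + 1) < k/2, hence b (i + 1) = k - c (i + 1) ≥
      -- k/2; the induction starts from b 0 = k.
      large-b : ∀ i → ½ ℚ.* k ℚ.≤ ι (b i)
      large-b = <-weakInduction (λ i → ½ ℚ.* k ℚ.≤ ι (b i)) ½k≤k λ i bᵢ →
        ≤-by-diff (½ ℚ.* k ℚ.- ι (c (suc i)))
          (p≤q⇒0≤q-p (ℚP.<⇒≤ (ℚP.≰⇒> λ cᵢ → none (i , bᵢ , cᵢ))))
          (trans (solve 2 (λ c b → b := (c :+ b) :- c) refl (ι (c (suc i))) (ι (b (suc i))))
          (trans (cong (ℚ._- ι (c (suc i))) (trans (sum (suc i)) (sym (½+½ k))))
            (ℚP.+-assoc (½ ℚ.* k) (½ ℚ.* k) (ℚ.- ι (c (suc i))))))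

-- The case split asks whether all a i are 0, that is, whether X is bipartite: exactly then -k is an
-- eigenvalue and no bound on ∣ξ∣ below k can hold.
dichotomy : ∀ d → 2 ℕ.≤ d → ∀ {ε η} e → ι 4 ℚ.* (ι d ℚ.* ι d) ℚ.* e ≡ 1ℚ →
  (∀ m → seq ε m ℚ.≤ ½) → (∀ m → seq η m ℚ.≤ e) → Dichotomy d ε η
dichotomy d 2≤d {ε} {η} e 4d²e≡1 ε≤½ η≤e X a b c reg with FinP.any? (λ i → ¬? (a i ℕ.≟ 0))
... | no all-zero = inj₁ (large-intersection-numbers {ε} ε≤½
        λ i → decidable-stable (a i ℕ.≟ 0) λ aᵢ≢0 → all-zero (i , aᵢ≢0))
  where open Spectral X reg 2≤d e 4d²e≡1
... | yes (i , aᵢ≢0) = inj₂ (spectral-gap {η} η≤e (toℕ i) (ℕP.≤-pred (FinP.toℕ<n i))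
        (subst (0ℚ ℚ.<_) (sym (extend-toℕ 0ℚ a i)) (0<ι {a i} (ℕP.n≢0⇒n>0 aᵢ≢0))))
  where
  open Spectral X reg 2≤d e 4d²e≡1
  open Regular X reg using (extend-toℕ)

theorem3 : ∀ (d : ℕ) .{{_ : ℕ.NonZero d}} → 2 ℕ.≤ d →
    (∃[ ε ] ∃[ η ] 0ℝ < ε × 0ℝ < η × Dichotomy d ε η)
    × (0ℝ < ε₀ d × 0ℝ < η₀ d × Dichotomy d (ε₀ d) (η₀ d))
theorem3 d 2≤d = (ε₀ d , η₀ d , bounds) , bounds
  where
  0<ιd : 0ℚ ℚ.< ι d
  0<ιd = 0<ι {d} (ℕP.≤-trans (ℕ.s≤s ℕ.z≤n) 2≤d)
  -- e is 1/(4d²), the relative gap shared by the upper and the lower eigenvalue bound.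
  inverse = 1/pos (*-pos {ι 4} (0<ι {4} (ℕ.s≤s ℕ.z≤n)) (*-pos 0<ιd 0<ιd))
  e = proj₁ inverse
  4d²e≡1 = proj₂ (proj₂ inverse)
  bounds : 0ℝ < ε₀ d × 0ℝ < η₀ d × Dichotomy d (ε₀ d) (η₀ d)
  bounds = 0<ε₀ d , 0<η₀ d ,
    dichotomy d 2≤d {ε₀ d} {η₀ d} e 4d²e≡1 (ε₀-upper d) (η₀-upper d 2≤d e 4d²e≡1)
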